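{- Let $d \geq 2$ be an integer. There exist constants $C, c, q_0 > 0$, depending only on $d$, such that the following holds. Let $q \geq q_0$ be a power of an odd prime, let $\rho$ be a real number with $C q^{ -1/2} \leq \rho \leq 1$, and let $E \subset \mathbb{F}_q^d$ satisfy $|E| \geq \rho q^d$. Then $$|T_d(E)| \geq c\, \rho^{d-1} q^{\binom{d+1}{2}}.$$
   Context: $\mathbb{F}_q$ is the finite field with $q$ elements, and $\mathbb{F}_q^d$ is the $d$-dimensional vector space over it. For $x \in \mathbb{F}_q^d$ put $\|x\| = \sum_{j=1}^d x_j^2 \in \mathbb{F}_q$. Let $O_d(\mathbb{F}_q)$ be the group of linear maps $\mathbb{F}_q^d \to \mathbb{F}_q^d$ that preserve $\|\cdot\|$ (orthogonal matrices). A $k$-simplex is a $(k+1)$-tuple $(V_0, \dots, V_k)$ of points of $\mathbb{F}_q^d$ which spans a $k$-dimensional (affine) subspace, i.e. the vectors $V_1 - V_0, \dots, V_k - V_0$ are linearly independent. Two $k$-simplices $(V_0,\dots,V_k)$ and $(W_0,\dots,W_k)$ are equivalent, written $\sim$, if one is a rotated, shifted, reflected copy of the other, i.e. there exist $\tau \in \mathbb{F}_q^d$ and $O \in O_d(\mathbb{F}_q)$ with $W_i = \tau + O(V_i)$ for all $i = 0, \dots, k$. For $E \subset \mathbb{F}_q^d$, $T_k(E)$ denotes the set of equivalence classes under $\sim$ of $k$-simplices all of whose vertices lie in $E$. -}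

module Defs where

open import Level using (0ℓ)
open import Algebra.Apartness.Bundles using (HeytingField; HeytingCommutativeRing)
open import Algebra.Bundles using (CommutativeRing)
open import Algebra.Module.Bundles.Raw using (RawLeftModule)
open import Algebra.Module.Morphism.Structures using (module LeftModuleMorphisms)
import Algebra.Definitions.RawMonoid as RawMonoidDefs
open import Data.Fin.Base using (Fin; zero; suc)
import Data.Integer.Base as ℤ
import Data.Integer.Properties as ℤ
open import Data.Nat.Base as ℕ using (ℕ; zero; suc; NonZero)
import Data.Nat.Properties as ℕ
import Data.Nat.Solver as ℕ
open import Data.Nat.Primality using (Prime)
open import Data.Product.Base using (Σ; ∃; ∃-syntax; _×_; _,_; proj₁; proj₂)
open import Data.Rational.Base as ℚ using (ℚ; mkℚ; 0ℚ; 1ℚ; _/_; ∣_∣)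
import Data.Rational.Properties as ℚ
import Data.Rational.Solver as ℚ
import Data.Rational.Unnormalised.Base as ℚᵘ
import Data.Rational.Unnormalised.Properties as ℚᵘ
open import Data.Sum.Base using ([_,_]′)
open import Data.Vec.Functional using (Vector)
open import Data.Vec.Functional.Relation.Binary.Pointwise using (Pointwise)
open import Function.Base using (_on_)
open import Function.Definitions using (Congruent; Bijective)
open import Relation.Binary.Core using (Rel)
open import Relation.Binary.PropositionalEquality
  using (_≡_; _≢_; refl; sym; trans; cong; cong₂; subst; subst₂)
open import Relation.Nullary using (yes; no)
open import Relation.Unary using (Pred)

------------------------------------------------------------------------
-- Real numbers, as Cauchy sequences of rationals

IsCauchy : (ℕ → ℚ) → Set
IsCauchy s = ∀ ε → 0ℚ ℚ.< ε →
  ∃[ N ] ∀ m n → N ℕ.≤ m → N ℕ.≤ n → ∣ s m ℚ.- s n ∣ ℚ.< ε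

record ℝ : Set where
  constructor mkℝ
  field
    seq    : ℕ → ℚ
    cauchy : IsCauchy seq

open ℝ public

infix 4 _≤ᵣ_ _<ᵣ_ _≃ᵣ_

_≤ᵣ_ : Rel ℝ 0ℓ
x ≤ᵣ y = ∀ ε → 0ℚ ℚ.< ε →
  ∃[ N ] ∀ n → N ℕ.≤ n → seq x n ℚ.≤ seq y n ℚ.+ ε

_<ᵣ_ : Rel ℝ 0ℓ
x <ᵣ y = ∃[ ε ] 0ℚ ℚ.< ε ×
  ∃[ N ] ∀ n → N ℕ.≤ n → seq x n ℚ.+ ε ℚ.≤ seq y n

_≃ᵣ_ : Rel ℝ 0ℓ
x ≃ᵣ y = x ≤ᵣ y × y ≤ᵣ x

fromℚ : ℚ → ℝ
fromℚ p = mkℝ (λ _ → p) λ ε 0<ε →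
  0 , λ _ _ _ _ → subst (ℚ._< ε) (sym (cong ∣_∣ (ℚ.+-inverseʳ p))) 0<ε

fromℕ : ℕ → ℝ
fromℕ n = fromℚ (ℤ.+ n / 1)

private
  bounded : (x : ℝ) → ∃[ B ] 0ℚ ℚ.< B ×
            ∃[ N ] ∀ n → N ℕ.≤ n → ∣ seq x n ∣ ℚ.≤ B
  bounded (mkℝ s c) = 1ℚ ℚ.+ ∣ s N ∣ , B>0 , N , bound
    where
    N = proj₁ (c 1ℚ (ℚ.positive⁻¹ 1ℚ))
    close = proj₂ (c 1ℚ (ℚ.positive⁻¹ 1ℚ))
    open ℚ.≤-Reasoning
    B>0 : 0ℚ ℚ.< 1ℚ ℚ.+ ∣ s N ∣
    B>0 = begin-strict
      0ℚ              ≡⟨ sym (ℚ.+-identityˡ 0ℚ) ⟩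
      0ℚ ℚ.+ 0ℚ       <⟨ ℚ.+-mono-<-≤ (ℚ.positive⁻¹ 1ℚ) (ℚ.0≤∣p∣ (s N)) ⟩
      1ℚ ℚ.+ ∣ s N ∣  ∎
    bound : ∀ n → N ℕ.≤ n → ∣ s n ∣ ℚ.≤ 1ℚ ℚ.+ ∣ s N ∣
    bound n N≤n = begin
      ∣ s n ∣                            ≡⟨ cong ∣_∣ (sym (split (s n) (s N))) ⟩
      ∣ (s n ℚ.- s N) ℚ.+ s N ∣          ≤⟨ ℚ.∣p+q∣≤∣p∣+∣q∣ (s n ℚ.- s N) (s N) ⟩
      ∣ s n ℚ.- s N ∣ ℚ.+ ∣ s N ∣        ≤⟨ ℚ.+-monoˡ-≤ ∣ s N ∣ (ℚ.<⇒≤ (close n N N≤n ℕ.≤-refl)) ⟩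
      1ℚ ℚ.+ ∣ s N ∣                     ∎
      where
      open ℚ.+-*-Solver
      split : ∀ a b → (a ℚ.- b) ℚ.+ b ≡ a
      split = solve 2 (λ a b → (a :- b) :+ b := a) refl

  difference : ∀ a b c d → a ℚ.* b ℚ.- c ℚ.* d ≡ a ℚ.* (b ℚ.- d) ℚ.+ d ℚ.* (a ℚ.- c)
  difference = solve 4 (λ a b c d → a :* b :- c :* d := a :* (b :- d) :+ d :* (a :- c)) refl
    where open ℚ.+-*-Solver

  product-< : ∀ {K δ} p d → 0ℚ ℚ.< K → ∣ p ∣ ℚ.≤ K → ∣ d ∣ ℚ.< δ →
              ∣ p ℚ.* d ∣ ℚ.< K ℚ.* δ
  product-< {K} {δ} p d 0<K p≤K d<δ = begin-strict
    ∣ p ℚ.* d ∣      ≡⟨ ℚ.∣p*q∣≡∣p∣*∣q∣ p d ⟩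
    ∣ p ∣ ℚ.* ∣ d ∣  ≤⟨ ℚ.*-monoʳ-≤-nonNeg ∣ d ∣ {{ℚ.∣-∣-nonNeg d}} p≤K ⟩
    K ℚ.* ∣ d ∣      <⟨ ℚ.*-monoʳ-<-pos K {{ℚ.positive 0<K}} d<δ ⟩
    K ℚ.* δ          ∎
    where open ℚ.≤-Reasoning

  difference-< : ∀ {A B δ} a b c d → 0ℚ ℚ.< A → 0ℚ ℚ.< B → ∣ a ∣ ℚ.≤ A → ∣ d ∣ ℚ.≤ B →
                 ∣ b ℚ.- d ∣ ℚ.< δ → ∣ a ℚ.- c ∣ ℚ.< δ →
                 ∣ a ℚ.* b ℚ.- c ℚ.* d ∣ ℚ.< (A ℚ.+ B) ℚ.* δ
  difference-< {A} {B} {δ} a b c d 0<A 0<B a≤A d≤B bd ac = begin-strict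
    ∣ a ℚ.* b ℚ.- c ℚ.* d ∣                          ≡⟨ cong ∣_∣ (difference a b c d) ⟩
    ∣ a ℚ.* (b ℚ.- d) ℚ.+ d ℚ.* (a ℚ.- c) ∣          ≤⟨ ℚ.∣p+q∣≤∣p∣+∣q∣ (a ℚ.* (b ℚ.- d)) (d ℚ.* (a ℚ.- c)) ⟩
    ∣ a ℚ.* (b ℚ.- d) ∣ ℚ.+ ∣ d ℚ.* (a ℚ.- c) ∣      <⟨ ℚ.+-mono-< (product-< a (b ℚ.- d) 0<A a≤A bd) (product-< d (a ℚ.- c) 0<B d≤B ac) ⟩
    A ℚ.* δ ℚ.+ B ℚ.* δ                              ≡⟨ sym (ℚ.*-distribʳ-+ δ A B) ⟩
    (A ℚ.+ B) ℚ.* δ                                  ∎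
    where open ℚ.≤-Reasoning

  0<+ : ∀ A B → 0ℚ ℚ.< A → 0ℚ ℚ.< B → 0ℚ ℚ.< A ℚ.+ B
  0<+ A B 0<A 0<B = ℚ.positive⁻¹ (A ℚ.+ B) {{ℚ.pos+pos⇒pos A {{ℚ.positive 0<A}} B {{ℚ.positive 0<B}}}}

  divide : ∀ K ε → 0ℚ ℚ.< K → 0ℚ ℚ.< ε → ∃[ δ ] 0ℚ ℚ.< δ × K ℚ.* δ ≡ ε
  divide K ε 0<K 0<ε = r ℚ.* ε , 0<δ , eq
    where
    instance
      K>0 : ℚ.Positive K
      K>0 = ℚ.positive 0<K
      K≢0 : ℚ.NonZero K
      K≢0 = ℚ.pos⇒nonZero K
    r = ℚ.1/ K
    0<δ : 0ℚ ℚ.< r ℚ.* ε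
    0<δ = ℚ.positive⁻¹ (r ℚ.* ε) {{ℚ.pos*pos⇒pos r {{ℚ.1/pos⇒pos K}} ε {{ℚ.positive 0<ε}}}}
    eq : K ℚ.* (r ℚ.* ε) ≡ ε
    eq = trans (sym (ℚ.*-assoc K r ε))
        (trans (cong (ℚ._* ε) (ℚ.*-inverseʳ K)) (ℚ.*-identityˡ ε))

  *-cauchy : (x y : ℝ) → IsCauchy (λ n → seq x n ℚ.* seq y n)
  *-cauchy x y ε 0<ε =
    let A , 0<A , N₁ , xA = bounded x
        B , 0<B , N₂ , yB = bounded y
        δ , 0<δ , eq      = divide (A ℚ.+ B) ε (0<+ A B 0<A 0<B) 0<ε
        N₃ , xδ           = cauchy x δ 0<δ
        N₄ , yδ           = cauchy y δ 0<δ
        left              = λ {o : ℕ} → ℕ.m⊔n≤o⇒m≤o {o} (N₁ ℕ.⊔ N₂) (N₃ ℕ.⊔ N₄)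
        right             = λ {o : ℕ} → ℕ.m⊔n≤o⇒n≤o {o} (N₁ ℕ.⊔ N₂) (N₃ ℕ.⊔ N₄)
    in (N₁ ℕ.⊔ N₂) ℕ.⊔ (N₃ ℕ.⊔ N₄) , λ m n N≤m N≤n →
    subst (∣ seq x m ℚ.* seq y m ℚ.- seq x n ℚ.* seq y n ∣ ℚ.<_) eq
      (difference-< {A} {B} {δ} (seq x m) (seq y m) (seq x n) (seq y n) 0<A 0<B
        (xA m (ℕ.m⊔n≤o⇒m≤o N₁ N₂ (left N≤m)))
        (yB n (ℕ.m⊔n≤o⇒n≤o N₁ N₂ (left N≤n)))
        (yδ m n (ℕ.m⊔n≤o⇒n≤o N₃ N₄ (right N≤m)) (ℕ.m⊔n≤o⇒n≤o N₃ N₄ (right N≤n)))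
        (xδ m n (ℕ.m⊔n≤o⇒m≤o N₃ N₄ (right N≤m)) (ℕ.m⊔n≤o⇒m≤o N₃ N₄ (right N≤n))))

infixl 7 _*ᵣ_
infixr 8 _^ᵣ_

_*ᵣ_ : ℝ → ℝ → ℝ
x *ᵣ y = mkℝ (λ n → seq x n ℚ.* seq y n) (*-cauchy x y)

_^ᵣ_ : ℝ → ℕ → ℝ
x ^ᵣ zero  = fromℕ 1
x ^ᵣ suc n = x *ᵣ x ^ᵣ n

------------------------------------------------------------------------
-- q ^-½ is approximated by k/(n+1), where k ≤ n+1 is greatest with
-- k² q ≤ (n+1)².  Its specification is ^-½-spec below (at q ≡ 0 the value
-- is junk).

private
  root : (q N b : ℕ) → ℕ
  root q N zero    = 0
  root q N (suc b) with suc b ℕ.* suc b ℕ.* q ℕ.≤? N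
  ... | yes _ = suc b
  ... | no  _ = root q N b

  root-≤ : ∀ q N b → root q N b ℕ.* root q N b ℕ.* q ℕ.≤ N
  root-≤ q N zero    = ℕ.z≤n
  root-≤ q N (suc b) with suc b ℕ.* suc b ℕ.* q ℕ.≤? N
  ... | yes p = p
  ... | no  _ = root-≤ q N b

  root-bound : ∀ q N b → root q N b ℕ.≤ b
  root-bound q N zero    = ℕ.z≤n
  root-bound q N (suc b) with suc b ℕ.* suc b ℕ.* q ℕ.≤? N
  ... | yes _ = ℕ.≤-refl
  ... | no  _ = ℕ.m≤n⇒m≤1+n (root-bound q N b)

  root-> : ∀ q N b → N ℕ.< suc b ℕ.* suc b ℕ.* q →
           let k = suc (root q N b) in N ℕ.< k ℕ.* k ℕ.* q
  root-> q N zero    h = h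
  root-> q N (suc b) h with suc b ℕ.* suc b ℕ.* q ℕ.≤? N
  ... | yes _ = h
  ... | no ¬p = root-> q N b (ℕ.≰⇒> ¬p)

  num : (q n : ℕ) → ℕ
  num q n = root q (suc n ℕ.* suc n) (suc n)

  num-> : ∀ q .{{_ : NonZero q}} n →
          suc n ℕ.* suc n ℕ.< suc (num q n) ℕ.* suc (num q n) ℕ.* q
  num-> q n = root-> q (suc n ℕ.* suc n) (suc n)
    (ℕ.<-≤-trans (ℕ.*-mono-< (ℕ.n<1+n (suc n)) (ℕ.n<1+n (suc n)))
                 (ℕ.m≤m*n (suc (suc n) ℕ.* suc (suc n)) q))

  -- k(n)/(n+1) ≤ (k(m)+1)/(m+1)
  num-cross : ∀ q n m → num q n ℕ.* suc m ℕ.≤ suc (num q m) ℕ.* suc n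
  num-cross zero      n m = junk
    where
    top : ∀ b N → root 0 N b ≡ b
    top zero    N = refl
    top (suc b) N with suc b ℕ.* suc b ℕ.* 0 ℕ.≤? N
    ... | yes _ = refl
    ... | no ¬p with () ← ¬p (subst (ℕ._≤ N) (sym (ℕ.*-zeroʳ (suc b ℕ.* suc b))) ℕ.z≤n)
    junk : num 0 n ℕ.* suc m ℕ.≤ suc (num 0 m) ℕ.* suc n
    junk rewrite top (suc n) (suc n ℕ.* suc n) | top (suc m) (suc m ℕ.* suc m) =
      ℕ.≤-trans (ℕ.≤-reflexive (ℕ.*-comm (suc n) (suc m))) (ℕ.*-monoˡ-≤ (suc n) (ℕ.n≤1+n (suc m)))
  num-cross q@(suc _) n m = ℕ.≮⇒≥ λ lt →
    ℕ.<-irrefl refl (chain (num q n) (num q m) lt (root-≤ q (suc n ℕ.* suc n) (suc n)) (num-> q m))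
    where
    open ℕ.≤-Reasoning
    open ℕ.+-*-Solver
    chain : ∀ k l → suc l ℕ.* suc n ℕ.< k ℕ.* suc m →
            k ℕ.* k ℕ.* q ℕ.≤ suc n ℕ.* suc n →
            suc m ℕ.* suc m ℕ.< suc l ℕ.* suc l ℕ.* q →
            suc m ℕ.* suc m ℕ.* (suc n ℕ.* suc n) ℕ.< suc m ℕ.* suc m ℕ.* (suc n ℕ.* suc n)
    chain k l lt k≤ l> = begin-strict
      suc m ℕ.* suc m ℕ.* (suc n ℕ.* suc n)
        <⟨ ℕ.*-monoˡ-< (suc n ℕ.* suc n) l> ⟩
      suc l ℕ.* suc l ℕ.* q ℕ.* (suc n ℕ.* suc n)
        ≡⟨ solve 3 (λ a b c → a :* a :* c :* (b :* b) := a :* b :* (a :* b) :* c) refl (suc l) (suc n) q ⟩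
      suc l ℕ.* suc n ℕ.* (suc l ℕ.* suc n) ℕ.* q
        ≤⟨ ℕ.*-monoˡ-≤ q (ℕ.*-mono-≤ (ℕ.<⇒≤ lt) (ℕ.<⇒≤ lt)) ⟩
      k ℕ.* suc m ℕ.* (k ℕ.* suc m) ℕ.* q
        ≡⟨ solve 3 (λ a b c → a :* b :* (a :* b) :* c := b :* b :* (a :* a :* c)) refl k (suc m) q ⟩
      suc m ℕ.* suc m ℕ.* (k ℕ.* k ℕ.* q)
        ≤⟨ ℕ.*-monoʳ-≤ (suc m ℕ.* suc m) k≤ ⟩
      suc m ℕ.* suc m ℕ.* (suc n ℕ.* suc n) ∎

  toℚᵘ-/ : ∀ a b → ℚ.toℚᵘ (ℤ.+ a / suc b) ℚᵘ.≃ ℚᵘ.mkℚᵘ (ℤ.+ a) b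
  toℚᵘ-/ a b = ℚ.toℚᵘ-fromℚᵘ (ℚᵘ.mkℚᵘ (ℤ.+ a) b)

  /-≤ : ∀ a b c d → a ℕ.* suc d ℕ.≤ c ℕ.* suc b → ℤ.+ a / suc b ℚ.≤ ℤ.+ c / suc d
  /-≤ a b c d h = ℚ.toℚᵘ-cancel-≤ (begin
    ℚ.toℚᵘ (ℤ.+ a / suc b)  ≃⟨ toℚᵘ-/ a b ⟩
    ℚᵘ.mkℚᵘ (ℤ.+ a) b       ≤⟨ ℚᵘ.*≤* (subst₂ ℤ._≤_ (ℤ.pos-* a (suc d)) (ℤ.pos-* c (suc b)) (ℤ.+≤+ h)) ⟩
    ℚᵘ.mkℚᵘ (ℤ.+ c) d       ≃⟨ ℚᵘ.≃-sym (toℚᵘ-/ c d) ⟩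
    ℚ.toℚᵘ (ℤ.+ c / suc d)  ∎)
    where open ℚᵘ.≤-Reasoning

  /-+ : ∀ a c b → ℤ.+ (a ℕ.+ c) / suc b ≡ ℤ.+ a / suc b ℚ.+ ℤ.+ c / suc b
  /-+ a c b = ℚ.toℚᵘ-injective (begin-equality
    ℚ.toℚᵘ (ℤ.+ (a ℕ.+ c) / suc b)                         ≃⟨ toℚᵘ-/ (a ℕ.+ c) b ⟩
    ℚᵘ.mkℚᵘ (ℤ.+ (a ℕ.+ c)) b                              ≃⟨ ℚᵘ.*≡* cross ⟩
    ℚᵘ.mkℚᵘ (ℤ.+ a) b ℚᵘ.+ ℚᵘ.mkℚᵘ (ℤ.+ c) b               ≃⟨ ℚᵘ.≃-sym (ℚᵘ.+-cong (toℚᵘ-/ a b) (toℚᵘ-/ c b)) ⟩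
    ℚ.toℚᵘ (ℤ.+ a / suc b) ℚᵘ.+ ℚ.toℚᵘ (ℤ.+ c / suc b)     ≃⟨ ℚᵘ.≃-sym (ℚ.toℚᵘ-homo-+ (ℤ.+ a / suc b) (ℤ.+ c / suc b)) ⟩
    ℚ.toℚᵘ (ℤ.+ a / suc b ℚ.+ ℤ.+ c / suc b)               ∎)
    where
    open ℚᵘ.≤-Reasoning
    s = ℤ.+ suc b
    cross : ℤ.+ (a ℕ.+ c) ℤ.* (ℤ.+ (suc b ℕ.* suc b)) ≡ (ℤ.+ a ℤ.* s ℤ.+ ℤ.+ c ℤ.* s) ℤ.* s
    cross = trans (cong₂ ℤ._*_ (ℤ.pos-+ a c) (ℤ.pos-* (suc b) (suc b)))
           (trans (sym (ℤ.*-assoc (ℤ.+ a ℤ.+ ℤ.+ c) s s))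
                  (cong (ℤ._* s) (ℤ.*-distribʳ-+ s (ℤ.+ a) (ℤ.+ c))))

  /-* : ∀ a b c d → ℤ.+ a / suc b ℚ.* (ℤ.+ c / suc d) ≡ ℤ.+ (a ℕ.* c) / (suc b ℕ.* suc d)
  /-* a b c d = ℚ.toℚᵘ-injective (begin-equality
    ℚ.toℚᵘ (ℤ.+ a / suc b ℚ.* (ℤ.+ c / suc d))             ≃⟨ ℚ.toℚᵘ-homo-* (ℤ.+ a / suc b) (ℤ.+ c / suc d) ⟩
    ℚ.toℚᵘ (ℤ.+ a / suc b) ℚᵘ.* ℚ.toℚᵘ (ℤ.+ c / suc d)     ≃⟨ ℚᵘ.*-cong (toℚᵘ-/ a b) (toℚᵘ-/ c d) ⟩
    ℚᵘ.mkℚᵘ (ℤ.+ a) b ℚᵘ.* ℚᵘ.mkℚᵘ (ℤ.+ c) d               ≃⟨ ℚᵘ.*≡* (cong (ℤ._* ℤ.+ (suc b ℕ.* suc d)) (sym (ℤ.pos-* a c))) ⟩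
    ℚᵘ.mkℚᵘ (ℤ.+ (a ℕ.* c)) (d ℕ.+ b ℕ.* suc d)            ≃⟨ ℚᵘ.≃-sym (toℚᵘ-/ (a ℕ.* c) (d ℕ.+ b ℕ.* suc d)) ⟩
    ℚ.toℚᵘ (ℤ.+ (a ℕ.* c) / (suc b ℕ.* suc d))             ∎)
    where open ℚᵘ.≤-Reasoning

  archimedean : ∀ a ε → 0ℚ ℚ.< ε → ∃[ N ] ∀ n → N ℕ.≤ n → ℤ.+ a / suc n ℚ.< ε
  archimedean a ε@(mkℚ ℤ.+[1+ p ] d _) 0<ε = a ℕ.* suc d , λ n N≤n → ℚ.toℚᵘ-cancel-< (begin-strict
    ℚ.toℚᵘ (ℤ.+ a / suc n)     ≃⟨ toℚᵘ-/ a n ⟩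
    ℚᵘ.mkℚᵘ (ℤ.+ a) n          <⟨ ℚᵘ.*<* (subst₂ ℤ._<_ (ℤ.pos-* a (suc d)) (ℤ.pos-* (suc p) (suc n))
                                    (ℤ.+<+ (ℕ.<-≤-trans (ℕ.s≤s N≤n) (ℕ.m≤n*m (suc n) (suc p))))) ⟩
    ℚ.toℚᵘ ε                   ∎)
    where open ℚᵘ.≤-Reasoning
  archimedean a (mkℚ (ℤ.+ zero)   d _) (ℚ.*<* (ℤ.+<+ ()))
  archimedean a (mkℚ ℤ.-[1+ p ]   d _) (ℚ.*<* ())

  approx : ℕ → ℕ → ℚ
  approx q n = ℤ.+ num q n / suc n

  approx-close : ∀ q n m → approx q n ℚ.- approx q m ℚ.≤ ℤ.+ 1 / suc m
  approx-close q n m = begin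
    approx q n ℚ.- approx q m
      ≤⟨ ℚ.+-monoˡ-≤ (ℚ.- approx q m) (/-≤ (num q n) n (suc (num q m)) m (num-cross q n m)) ⟩
    ℤ.+ suc (num q m) / suc m ℚ.- approx q m
      ≡⟨ cong (ℚ._- approx q m) (/-+ 1 (num q m) m) ⟩
    (ℤ.+ 1 / suc m ℚ.+ approx q m) ℚ.- approx q m
      ≡⟨ solve 2 (λ a b → (a :+ b) :- b := a) refl (ℤ.+ 1 / suc m) (approx q m) ⟩
    ℤ.+ 1 / suc m ∎
    where
    open ℚ.≤-Reasoning
    open ℚ.+-*-Solver

  ∣-∣-< : ∀ a b {ε} → a ℚ.- b ℚ.< ε → b ℚ.- a ℚ.< ε → ∣ a ℚ.- b ∣ ℚ.< ε
  ∣-∣-< a b {ε} ab ba = [ (λ eq → subst (ℚ._< ε) (sym eq) ab)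
                        , (λ eq → subst (ℚ._< ε) (sym (trans eq (flip a b))) ba)
                        ]′ (ℚ.∣p∣≡p∨∣p∣≡-p (a ℚ.- b))
    where
    open ℚ.+-*-Solver
    flip : ∀ a b → ℚ.- (a ℚ.- b) ≡ b ℚ.- a
    flip = solve 2 (λ a b → :- (a :- b) := b :- a) refl

  approx-cauchy : ∀ q → IsCauchy (approx q)
  approx-cauchy q ε 0<ε =
    let N , small = archimedean 1 ε 0<ε
    in N , λ m n N≤m N≤n → ∣-∣-< (approx q m) (approx q n)
         (ℚ.≤-<-trans (approx-close q m n) (small n N≤n))
         (ℚ.≤-<-trans (approx-close q n m) (small m N≤m))

infix 9 _^-½

_^-½ : ℕ → ℝ
q ^-½ = mkℝ (approx q) (approx-cauchy q)

private
  approx² : ∀ q n → let k = num q n in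
    approx q n ℚ.* approx q n ℚ.* (ℤ.+ q / 1) ≡ ℤ.+ (k ℕ.* k ℕ.* q) / (suc n ℕ.* suc n)
  approx² q n = trans (cong (ℚ._* (ℤ.+ q / 1)) (/-* k n k n))
    (trans (/-* (k ℕ.* k) (n ℕ.+ n ℕ.* suc n) q 0)
           (ℚ./-cong {ℤ.+ (k ℕ.* k ℕ.* q)} refl (ℕ.*-identityʳ (suc n ℕ.* suc n))))
    where k = num q n

^-½-spec : ∀ q .{{_ : NonZero q}} → (q ^-½) *ᵣ (q ^-½) *ᵣ fromℕ q ≃ᵣ fromℕ 1
^-½-spec q = upper , lower
  where
  open ℚ.≤-Reasoning
  upper : (q ^-½) *ᵣ (q ^-½) *ᵣ fromℕ q ≤ᵣ fromℕ 1
  upper ε 0<ε = 0 , λ n _ → begin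
    approx q n ℚ.* approx q n ℚ.* (ℤ.+ q / 1)
      ≡⟨ approx² q n ⟩
    ℤ.+ (num q n ℕ.* num q n ℕ.* q) / (suc n ℕ.* suc n)
      ≤⟨ /-≤ (num q n ℕ.* num q n ℕ.* q) (n ℕ.+ n ℕ.* suc n) 1 0
           (subst₂ ℕ._≤_ (sym (ℕ.*-identityʳ _)) (sym (ℕ.*-identityˡ _))
             (root-≤ q (suc n ℕ.* suc n) (suc n))) ⟩
    1ℚ
      ≡⟨ sym (ℚ.+-identityʳ 1ℚ) ⟩
    1ℚ ℚ.+ 0ℚ
      ≤⟨ ℚ.+-monoʳ-≤ 1ℚ (ℚ.<⇒≤ 0<ε) ⟩
    1ℚ ℚ.+ ε ∎

  square : ∀ n k → suc n ℕ.* suc n ℕ.< suc k ℕ.* suc k ℕ.* q → k ℕ.≤ suc n →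
           suc n ℕ.* suc n ℕ.≤ k ℕ.* k ℕ.* q ℕ.+ 3 ℕ.* q ℕ.* suc n
  square n k h k≤ = ℕR.begin
    suc n ℕ.* suc n
      ℕR.≤⟨ ℕ.<⇒≤ h ⟩
    suc k ℕ.* suc k ℕ.* q
      ℕR.≡⟨ solve 2 (λ k q → (con 1 :+ k) :* (con 1 :+ k) :* q
                     := k :* k :* q :+ q :* (con 2 :* k :+ con 1)) refl k q ⟩
    k ℕ.* k ℕ.* q ℕ.+ q ℕ.* (2 ℕ.* k ℕ.+ 1)
      ℕR.≤⟨ ℕ.+-monoʳ-≤ (k ℕ.* k ℕ.* q) (ℕ.*-monoʳ-≤ q (ℕ.+-mono-≤ (ℕ.*-monoʳ-≤ 2 k≤) (ℕ.s≤s ℕ.z≤n))) ⟩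
    k ℕ.* k ℕ.* q ℕ.+ q ℕ.* (2 ℕ.* suc n ℕ.+ suc n)
      ℕR.≡⟨ cong (k ℕ.* k ℕ.* q ℕ.+_)
             (solve 2 (λ q n → q :* (con 2 :* n :+ n) := con 3 :* q :* n) refl q (suc n)) ⟩
    k ℕ.* k ℕ.* q ℕ.+ 3 ℕ.* q ℕ.* suc n ℕR.∎
    where
    module ℕR = ℕ.≤-Reasoning
    open ℕ.+-*-Solver

  lower : fromℕ 1 ≤ᵣ (q ^-½) *ᵣ (q ^-½) *ᵣ fromℕ q
  lower ε 0<ε = let N , small = archimedean (3 ℕ.* q) ε 0<ε in N , λ n N≤n →
    let k  = num q n
        N² = n ℕ.+ n ℕ.* suc n
    in begin
      1ℚ
        ≤⟨ /-≤ 1 0 (k ℕ.* k ℕ.* q ℕ.+ 3 ℕ.* q ℕ.* suc n) N²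
             (subst₂ ℕ._≤_ (sym (ℕ.*-identityˡ _)) (sym (ℕ.*-identityʳ _))
               (square n k (num-> q n) (root-bound q (suc n ℕ.* suc n) (suc n)))) ⟩
      ℤ.+ (k ℕ.* k ℕ.* q ℕ.+ 3 ℕ.* q ℕ.* suc n) / suc N²
        ≡⟨ /-+ (k ℕ.* k ℕ.* q) (3 ℕ.* q ℕ.* suc n) N² ⟩
      ℤ.+ (k ℕ.* k ℕ.* q) / suc N² ℚ.+ ℤ.+ (3 ℕ.* q ℕ.* suc n) / suc N²
        ≤⟨ ℚ.+-monoʳ-≤ (ℤ.+ (k ℕ.* k ℕ.* q) / suc N²)
             (/-≤ (3 ℕ.* q ℕ.* suc n) N² (3 ℕ.* q) n
               (ℕ.≤-reflexive (ℕ.*-assoc (3 ℕ.* q) (suc n) (suc n)))) ⟩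
      ℤ.+ (k ℕ.* k ℕ.* q) / suc N² ℚ.+ ℤ.+ (3 ℕ.* q) / suc n
        ≤⟨ ℚ.+-mono-≤ (ℚ.≤-reflexive (sym (approx² q n))) (ℚ.<⇒≤ (small n N≤n)) ⟩
      approx q n ℚ.* approx q n ℚ.* (ℤ.+ q / 1) ℚ.+ ε ∎

------------------------------------------------------------------------
-- A / _≈_ has exactly n elements.  This forces _≈_ to be a decidable
-- equivalence relation; it is also used for _∼_ below to count classes.

HasCardinality : ∀ {A : Set} → Rel A 0ℓ → ℕ → Set
HasCardinality {A} _≈_ n = Σ (A → Fin n) λ f →
  Congruent _≈_ _≡_ f × Bijective _≈_ _≡_ f

OddPrimePower : ℕ → Set
OddPrimePower q = ∃[ p ] ∃[ n ] Prime p × p ≢ 2 × 1 ℕ.≤ n × q ≡ p ℕ.^ n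

------------------------------------------------------------------------
-- Geometry of F^d.  Together with HasCardinality _≈_ q a Heyting field is
-- just a field with q elements: _≈_ is then decidable, and _#_ is its
-- negation.

module Geometry (F : HeytingField 0ℓ 0ℓ 0ℓ) (d : ℕ) where

  private
    open module F = HeytingField F using (_≈_; 0#) renaming (Carrier to 𝔽)
    R : CommutativeRing 0ℓ 0ℓ
    R = HeytingCommutativeRing.commutativeRing F.heytingCommutativeRing

  space : RawLeftModule 𝔽 0ℓ 0ℓ
  space = record
    { Carrierᴹ = Vector 𝔽 d
    ; _≈ᴹ_     = Pointwise _≈_
    ; _+ᴹ_     = λ x y j → x j F.+ y j
    ; _*ₗ_     = λ a x j → a F.* x j
    ; 0ᴹ       = λ _ → 0#
    ; -ᴹ_      = λ x j → F.- x j
    }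

  open RawLeftModule space public
    using (_≈ᴹ_; _+ᴹ_; _*ₗ_; 0ᴹ; -ᴹ_) renaming (Carrierᴹ to Point)

  ‖_‖ : Point → 𝔽
  ‖ x ‖ = RawMonoidDefs.sum (CommutativeRing.+-rawMonoid R) (λ j → x j F.* x j)

  IsOrthogonal : (Point → Point) → Set
  IsOrthogonal O = LeftModuleMorphisms.IsLeftModuleHomomorphism space space O
                 × (∀ x → ‖ O x ‖ ≈ ‖ x ‖)

  LinearlyIndependent : ∀ {k} → Vector Point k → Set
  LinearlyIndependent {k} v = ∀ (a : Vector 𝔽 k) →
    RawMonoidDefs.sum (RawLeftModule.+ᴹ-rawMonoid space) (λ i → a i *ₗ v i) ≈ᴹ 0ᴹ →
    ∀ i → a i ≈ 0#

  IsSimplex : ∀ {k} → Vector Point (suc k) → Set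
  IsSimplex V = LinearlyIndependent (λ i → V (suc i) +ᴹ -ᴹ V zero)

  infix 4 _∼_

  _∼_ : ∀ {k} → Rel (Vector Point (suc k)) 0ℓ
  V ∼ W = ∃[ τ ] ∃[ O ] IsOrthogonal O × (∀ i → W i ≈ᴹ τ +ᴹ O (V i))

  -- E has n points
  ∣_∣≡_ : Pred Point 0ℓ → ℕ → Set
  ∣ E ∣≡ n = HasCardinality {∃ E} (_≈ᴹ_ on proj₁) n

  SimplexIn : ℕ → Pred Point 0ℓ → Set
  SimplexIn k E = Σ (Vector Point (suc k)) λ V → IsSimplex V × (∀ i → E (V i))

  -- T_k(E) = SimplexIn k E / _∼_ has n elements
  ∣T_⟨_⟩∣≡_ : ℕ → Pred Point 0ℓ → ℕ → Set
  ∣T k ⟨ E ⟩∣≡ n = HasCardinality {SimplexIn k E} (_∼_ on proj₁) n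

{-# OPTIONS --safe #-}
module Submission where

-- For y ≠ z the points equidistant from y and z form a hyperplane.  Hence, on
-- average over x ∈ 𝔽ᵈ, the number of pairs in E × E equidistant from x exceeds
-- its Cauchy–Schwarz minimum ∣E∣²/q by at most ∣E∣, and if ∣E∣² ≥ qᵈ⁺¹, then some
-- x₀ ∈ E has at most 2∣E∣²/q such pairs; E realises at least q/8 distances from x₀.
--
-- Let c₁ - x₀, …, cₖ - x₀ be independent with cᵢ ∈ E and 1 ≤ k < d.  Points with
-- the same distances to x₀ and all cᵢ as z, a point off the span, lie in a
-- translate of a space of dimension d - k, and on a nonconstant quadric
-- in it, so there are at most 2qᵈ⁻ᵏ⁻¹ of them.  Therefore E contains at least
-- ∣E∣/(4qᵈ⁻ᵏ⁻¹) candidates for cₖ₊₁ with different distances to x₀, c₁, …, cₖ.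
-- Choosing c₁, …, c_d in this way produces q ∣E∣ᵈ⁻¹ / (2 · 4ᵈ q^((d-1)(d-2)/2)) simplices,
-- up to equivalence pairwise different because distances are invariants.

open import Defs
open import Level using (0ℓ)
open import Algebra.Apartness.Bundles using (HeytingField)
open import Data.Nat.Base using (ℕ; suc; _≤_; _∸_; _^_)
open import Data.Nat.Combinatorics using () renaming (_C_ to _choose_)
open import Data.Product.Base using (∃-syntax; _×_)
open import Relation.Binary.Definitions using (_Respects_)
open import Relation.Unary using (Pred)

open import Algebra.Apartness.Bundles using (HeytingCommutativeRing)
open import Algebra.Bundles using (CommutativeRing)
import Algebra.Definitions.RawMonoid as RawMonoidDefs
open import Algebra.Module.Bundles.Raw using (RawLeftModule)
open import Algebra.Module.Morphism.Structures using (module LeftModuleMorphisms)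
import Algebra.Properties.CommutativeMonoid.Sum
import Algebra.Properties.Ring
import Algebra.Properties.Semiring.Mult
import Algebra.Properties.Semiring.Sum
import Algebra.Solver.Ring
open import Algebra.Solver.Ring.AlmostCommutativeRing using (fromCommutativeRing; _-Raw-AlmostCommutative⟶_)
open import Data.Empty using (⊥-elim)
open import Data.Fin.Base as Fin using (Fin; zero; suc)
import Data.Fin.Properties as Fin
import Data.Integer.Base as ℤ
import Data.Integer.Properties as ℤ
open import Data.List.Base using (List; []; _∷_; _++_; length; map; concat; lookup; tabulate; cartesianProductWith)
open import Data.List.Membership.Propositional using (_∈_; find; lose)
open import Data.List.Membership.Propositional.Properties using (∈-lookup)
open import Data.List.Properties using (length-++; length-map; length-tabulate; map-tabulate)
open import Data.List.Relation.Unary.All as All using (All; []; _∷_)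
import Data.List.Relation.Unary.All.Properties as All
open import Data.List.Relation.Unary.AllPairs as AllPairs using (AllPairs; []; _∷_)
import Data.List.Relation.Unary.AllPairs.Properties as AllPairs
open import Data.List.Relation.Unary.Any as Any using (Any; here; there)
open import Data.List.Relation.Unary.Any.Properties using (lookup-index)
import Data.Maybe.Base as Maybe
open import Data.Nat.Base as ℕ using (zero; _<_; z≤n; s≤s)
open import Data.Nat.Combinatorics using (nC1≡n; nCk+nC[k+1]≡[n+1]C[k+1])
open import Data.Nat.Coprimality using (Coprime)
open import Data.Nat.Divisibility using (_∣_; divides; ∣1⇒≡1)
open import Data.Nat.Primality using (euclidsLemma; prime⇒irreducible; prime⇒nonTrivial; prime[2])
import Data.Nat.Properties as ℕ
open import Data.Nat.Solver using (module +-*-Solver)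
open import Data.Product.Base using (∃; Σ-syntax; _,_; proj₁; proj₂)
open import Data.Rational.Base as ℚ using (ℚ; 0ℚ; 1ℚ; _/_; ∣_∣)
import Data.Rational.Properties as ℚ
import Data.Rational.Solver as ℚ
import Data.Rational.Unnormalised.Base as ℚᵘ
import Data.Rational.Unnormalised.Properties as ℚᵘ
open import Data.Sum.Base using (inj₁; inj₂; [_,_]′)
open import Data.Unit.Base using (⊤; tt)
open import Data.Vec.Functional as Vector using (Vector)
open import Data.Vec.Functional.Relation.Binary.Pointwise using (Pointwise)
import Data.Vec.Functional.Relation.Binary.Pointwise.Properties as Pointwise
open import Function.Base using (_∘_; _on_; id)
open import Relation.Binary.Core using (Rel)
open import Relation.Binary.Definitions using (tri<; tri≈; tri>)
open import Relation.Binary.PropositionalEquality as ≡ using (_≡_; _≢_)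
import Relation.Binary.Reasoning.Setoid
open import Relation.Binary.Structures using (IsEquivalence)
open import Relation.Nullary using (Dec; yes; no; ¬_; ¬?; _×-dec_; _→-dec_)
open import Relation.Nullary.Decidable using (map′; decidable-stable; dec⇒maybe)

-- The generic step alone already produces first vertices, but only about `∣E∣` / (4 q^(d-1)) = ρ q
-- / 4 of them, and d such steps would cost ρ^d. A pin with few isosceles pairs replaces this first
-- factor by q / 8, which saves one power of ρ.
--
-- The counting uses the threshold ρ ≥ 2 q^(-1/2) in the form 4 q^(2d) ≤ q ∣E∣². For d ≥ 2 this
-- yields q^(d+1) ≤ ∣E∣² for the pin, and q^(d-1) ≤ ∣E∣ / 2, so that a hyperplane covers at most
-- half of E.
--
-- Over a finite field nonzero vectors may have norm 0, and spheres may contain whole affine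
-- subspaces. Each step therefore fixes a nonzero u orthogonal to the edges chosen so far and takes
-- new vertices off the hyperplane through x₀ with normal u. This single condition certifies
-- independence and keeps the quadric from being constant.
--
-- The lower bound uses that ∼ preserves distances. The converse, for d-simplices, whose edges form
-- a basis, makes ∼ decidable; from this it follows that T_d(E) has a cardinality at all.

module FiniteSums where
  open import Data.Nat.Base using (_<_; z≤n; _+_; _*_)
  open import Data.Nat.Properties
  open ≡ using (refl; sym; trans; cong; cong₂; subst)

  -- Sums of natural numbers over lists, Cauchy-Schwarz, and counting classes

  private variable
    A B P Q R : Set

  ∑ : List A → (A → ℕ) → ℕ
  ∑ []       f = 0
  ∑ (x ∷ xs) f = f x + ∑ xs f

  syntax ∑ xs (λ x → e) = ∑[ x ∈ xs ] e
  infix 5 ∑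

  𝟙 : Dec P → ℕ
  𝟙 (yes _) = 1
  𝟙 (no  _) = 0

  𝟙≤1 : (p : Dec P) → 𝟙 p ≤ 1
  𝟙≤1 (yes _) = ≤-refl
  𝟙≤1 (no  _) = z≤n

  𝟙-true : (p : Dec P) → P → 𝟙 p ≡ 1
  𝟙-true (yes _) _ = refl
  𝟙-true (no ¬p) p = ⊥-elim (¬p p)

  𝟙-false : (p : Dec P) → ¬ P → 𝟙 p ≡ 0
  𝟙-false (yes p) ¬p = ⊥-elim (¬p p)
  𝟙-false (no  _) _  = refl

  𝟙-mono : (p : Dec P) (q : Dec Q) → (P → Q) → 𝟙 p ≤ 𝟙 q
  𝟙-mono (yes p) q p⇒q = ≤-reflexive (sym (𝟙-true q (p⇒q p)))
  𝟙-mono (no  _) q p⇒q = z≤n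

  𝟙-cong : (p : Dec P) (q : Dec Q) → (P → Q) → (Q → P) → 𝟙 p ≡ 𝟙 q
  𝟙-cong p q p⇒q q⇒p = ≤-antisym (𝟙-mono p q p⇒q) (𝟙-mono q p q⇒p)

  𝟙-× : (p : Dec P) (q : Dec Q) → 𝟙 p * 𝟙 q ≡ 𝟙 (p ×-dec q)
  𝟙-× (yes _) (yes _) = refl
  𝟙-× (yes _) (no  _) = refl
  𝟙-× (no  _) (yes _) = refl
  𝟙-× (no  _) (no  _) = refl

  𝟙-*-≤ : (p : Dec P) {m n : ℕ} → (P → m ≤ n) → 𝟙 p * m ≤ 𝟙 p * n
  𝟙-*-≤ (yes p) h = *-monoʳ-≤ 1 (h p)
  𝟙-*-≤ (no  _) h = z≤n

  ∑-mono : (xs : List A) {f g : A → ℕ} → (∀ x → f x ≤ g x) → ∑ xs f ≤ ∑ xs g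
  ∑-mono []       f≤g = z≤n
  ∑-mono (x ∷ xs) f≤g = +-mono-≤ (f≤g x) (∑-mono xs f≤g)

  ∑-mono-All : {xs : List A} {f g : A → ℕ} → All (λ x → f x ≤ g x) xs → ∑ xs f ≤ ∑ xs g
  ∑-mono-All []        = z≤n
  ∑-mono-All (p ∷ ps) = +-mono-≤ p (∑-mono-All ps)

  ∑-cong : (xs : List A) {f g : A → ℕ} → (∀ x → f x ≡ g x) → ∑ xs f ≡ ∑ xs g
  ∑-cong []       f≡g = refl
  ∑-cong (x ∷ xs) f≡g = cong₂ _+_ (f≡g x) (∑-cong xs f≡g)

  ∑-+ : (xs : List A) (f g : A → ℕ) → ∑[ x ∈ xs ] (f x + g x) ≡ ∑ xs f + ∑ xs g
  ∑-+ []       f g = refl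
  ∑-+ (x ∷ xs) f g = trans (cong (f x + g x +_) (∑-+ xs f g))
    (solve 4 (λ a b c d → a :+ b :+ (c :+ d) := a :+ c :+ (b :+ d)) refl (f x) (g x) (∑ xs f) (∑ xs g))
    where open +-*-Solver

  ∑-*ˡ : (xs : List A) (n : ℕ) (f : A → ℕ) → ∑[ x ∈ xs ] n * f x ≡ n * ∑ xs f
  ∑-*ˡ []       n f = sym (*-zeroʳ n)
  ∑-*ˡ (x ∷ xs) n f = trans (cong (n * f x +_) (∑-*ˡ xs n f)) (sym (*-distribˡ-+ n (f x) (∑ xs f)))

  ∑-*ʳ : (xs : List A) (f : A → ℕ) (n : ℕ) → ∑[ x ∈ xs ] f x * n ≡ ∑ xs f * n
  ∑-*ʳ xs f n = trans (∑-cong xs (λ x → *-comm (f x) n)) (trans (∑-*ˡ xs n f) (*-comm n (∑ xs f)))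

  ∑-const : (xs : List A) (n : ℕ) → ∑[ _ ∈ xs ] n ≡ length xs * n
  ∑-const []       n = refl
  ∑-const (x ∷ xs) n = cong (n +_) (∑-const xs n)

  ∑-one : (xs : List A) → ∑[ _ ∈ xs ] 1 ≡ length xs
  ∑-one xs = trans (∑-const xs 1) (*-identityʳ (length xs))

  ∑-zero : (xs : List A) → ∑[ _ ∈ xs ] 0 ≡ 0
  ∑-zero xs = trans (∑-const xs 0) (*-zeroʳ (length xs))

  ∑-swap : (xs : List A) (ys : List B) (f : A → B → ℕ) →
           ∑[ x ∈ xs ] ∑[ y ∈ ys ] f x y ≡ ∑[ y ∈ ys ] ∑[ x ∈ xs ] f x y
  ∑-swap []       ys f = sym (∑-zero ys)
  ∑-swap (x ∷ xs) ys f = trans (cong (∑ ys (f x) +_) (∑-swap xs ys f))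
                               (sym (∑-+ ys (f x) (λ y → ∑[ x ∈ xs ] f x y)))

  ∑-++ : (xs ys : List A) (f : A → ℕ) → ∑ (xs ++ ys) f ≡ ∑ xs f + ∑ ys f
  ∑-++ []       ys f = refl
  ∑-++ (x ∷ xs) ys f = trans (cong (f x +_) (∑-++ xs ys f)) (sym (+-assoc (f x) (∑ xs f) (∑ ys f)))

  ∑-map : (h : A → B) (xs : List A) (f : B → ℕ) → ∑ (map h xs) f ≡ ∑ xs (f ∘ h)
  ∑-map h []       f = refl
  ∑-map h (x ∷ xs) f = cong (f (h x) +_) (∑-map h xs f)

  select : {P : A → Set} → (∀ x → Dec (P x)) → List A → List (∃ P)
  select P? []       = []
  select P? (x ∷ xs) with P? x
  ... | yes p = (x , p) ∷ select P? xs
  ... | no  _ = select P? xs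

  select-Any : {P Q : A → Set} (P? : ∀ x → Dec (P x)) → (∀ {x} → Q x → P x) → {xs : List A} → Any Q xs → Any (Q ∘ proj₁) (select P? xs)
  select-Any P? Q⇒P {x ∷ xs} (here q) with P? x
  ... | yes _ = here q
  ... | no ¬p = ⊥-elim (¬p (Q⇒P q))
  select-Any P? Q⇒P {x ∷ xs} (there qs) with P? x
  ... | yes _ = there (select-Any P? Q⇒P qs)
  ... | no  _ = select-Any P? Q⇒P qs

  ∑-select : {P : A → Set} (P? : ∀ x → Dec (P x)) (xs : List A) (f : A → ℕ) →
             ∑ (select P? xs) (f ∘ proj₁) ≡ ∑[ x ∈ xs ] 𝟙 (P? x) * f x
  ∑-select P? []       f = refl
  ∑-select P? (x ∷ xs) f with P? x
  ... | yes _ = cong₂ _+_ (sym (+-identityʳ (f x))) (∑-select P? xs f)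
  ... | no  _ = ∑-select P? xs f

  ∑-select-≤ : {P : A → Set} (P? : ∀ x → Dec (P x)) (xs : List A) (f : A → ℕ) → ∑ (select P? xs) (f ∘ proj₁) ≤ ∑ xs f
  ∑-select-≤ P? xs f = ≤-trans (≤-reflexive (∑-select P? xs f))
    (∑-mono xs (λ x → ≤-trans (*-monoˡ-≤ (f x) (𝟙≤1 (P? x))) (≤-reflexive (*-identityˡ (f x)))))

  ∑-select-mono : {P Q : A → Set} (P? : ∀ x → Dec (P x)) (Q? : ∀ x → Dec (Q x)) → (∀ x → P x → Q x) → (xs : List A) {f g : A → ℕ} →
    (∀ x → f x ≤ g x) → ∑ (select P? xs) (f ∘ proj₁) ≤ ∑ (select Q? xs) (g ∘ proj₁)
  ∑-select-mono P? Q? P⇒Q xs {f} {g} f≤g = begin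
    ∑ (select P? xs) (f ∘ proj₁)         ≡⟨ ∑-select P? xs f ⟩
    ∑[ x ∈ xs ] 𝟙 (P? x) * f x           ≤⟨ ∑-mono xs (λ x → *-mono-≤ (𝟙-mono (P? x) (Q? x) (P⇒Q x)) (f≤g x)) ⟩
    ∑[ x ∈ xs ] 𝟙 (Q? x) * g x           ≡⟨ ∑-select Q? xs g ⟨
    ∑ (select Q? xs) (g ∘ proj₁)         ∎
    where open ≤-Reasoning

  length-select : {P : A → Set} (P? : ∀ x → Dec (P x)) (xs : List A) → length (select P? xs) ≡ ∑[ x ∈ xs ] 𝟙 (P? x)
  length-select P? xs = trans (sym (∑-one (select P? xs)))
    (trans (∑-select P? xs (λ _ → 1)) (∑-cong xs (λ x → *-identityʳ (𝟙 (P? x)))))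

  length-concatMap : (f : A → List B) (xs : List A) → length (concat (map f xs)) ≡ ∑[ x ∈ xs ] length (f x)
  length-concatMap f []       = refl
  length-concatMap f (x ∷ xs) = trans (length-++ (f x)) (cong (length (f x) +_) (length-concatMap f xs))

  ∑-witness : (xs : List A) (f g : A → ℕ) → ∑ xs f < ∑ xs g → ∃[ x ] f x < g x
  ∑-witness (x ∷ xs) f g lt with f x <? g x
  ... | yes fx<gx = x , fx<gx
  ... | no  fx≮gx = ∑-witness xs f g (+-cancelˡ-< (f x) _ _ (<-≤-trans lt (+-monoˡ-≤ (∑ xs g) (≮⇒≥ fx≮gx))))

  ∑-≥-member : {xs : List A} {x : A} (f : A → ℕ) → x ∈ xs → f x ≤ ∑ xs f
  ∑-≥-member f (here refl) = m≤m+n _ _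
  ∑-≥-member f (there x∈)  = ≤-trans (∑-≥-member f x∈) (m≤n+m _ _)

  -- Writing the larger number as the smaller plus c turns the defect into c², which avoids
  -- truncated subtraction.
  2ab≤a²+b² : ∀ a b → 2 * (a * b) ≤ a * a + b * b
  2ab≤a²+b² a b with ≤-total a b
  ... | inj₁ a≤b with c , refl ← m≤n⇒∃[o]m+o≡n a≤b = subst (2 * (a * (a + c)) ≤_)
    (solve 2 (λ a c → con 2 :* (a :* (a :+ c)) :+ c :* c := a :* a :+ (a :+ c) :* (a :+ c)) refl a c) (m≤m+n _ (c * c))
    where open +-*-Solver
  ... | inj₂ b≤a with c , refl ← m≤n⇒∃[o]m+o≡n b≤a = subst (2 * ((b + c) * b) ≤_)
    (solve 2 (λ b c → con 2 :* ((b :+ c) :* b) :+ c :* c := (b :+ c) :* (b :+ c) :+ b :* b) refl b c) (m≤m+n _ (c * c))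
    where open +-*-Solver

  cauchy-schwarz : (xs : List A) (f : A → ℕ) → ∑ xs f * ∑ xs f ≤ length xs * (∑[ x ∈ xs ] f x * f x)
  cauchy-schwarz []       f = z≤n
  cauchy-schwarz (x ∷ xs) f = begin
    (a + S) * (a + S)
      ≡⟨ solve 2 (λ a s → (a :+ s) :* (a :+ s) := a :* a :+ (con 2 :* (a :* s) :+ s :* s)) refl a S ⟩
    a * a + (2 * (a * S) + S * S)           ≤⟨ +-monoʳ-≤ (a * a) (+-mono-≤ cross (cauchy-schwarz xs f)) ⟩
    a * a + ((length xs * (a * a) + T) + length xs * T) ≡⟨ solve 3 (λ a l t → a :* a :+ ((l :* (a :* a) :+ t) :+ l :* t) := (con 1 :+ l) :* (a :* a :+ t)) refl a (length xs) T ⟩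
    suc (length xs) * (a * a + T)           ∎
    where
    open ≤-Reasoning
    open +-*-Solver
    a = f x
    S = ∑ xs f
    T = ∑[ x ∈ xs ] f x * f x
    cross : 2 * (a * S) ≤ length xs * (a * a) + T
    cross = begin
      2 * (a * S)                           ≡⟨ cong (2 *_) (sym (∑-*ˡ xs a f)) ⟩
      2 * (∑[ y ∈ xs ] a * f y)               ≡⟨ sym (∑-*ˡ xs 2 (λ y → a * f y)) ⟩
      ∑[ y ∈ xs ] 2 * (a * f y)             ≤⟨ ∑-mono xs (λ y → 2ab≤a²+b² a (f y)) ⟩
      ∑[ y ∈ xs ] (a * a + f y * f y)       ≡⟨ ∑-+ xs (λ _ → a * a) (λ y → f y * f y) ⟩
      (∑[ _ ∈ xs ] a * a) + T               ≡⟨ cong (_+ T) (∑-const xs (a * a)) ⟩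
      length xs * (a * a) + T               ∎

  -- Cauchy–Schwarz for a map to ts: g x t indicates that x lies over t, and
  -- h x x′ that x and x′ lie over the same point.
  square≤collisions : (xs : List A) (ts : List B) (g : A → B → ℕ) (h : A → A → ℕ) →
    All (λ x → 1 ≤ ∑[ t ∈ ts ] g x t) xs →
    (∀ x x′ → ∑[ t ∈ ts ] g x t * g x′ t ≤ h x x′) →
    length xs * length xs ≤ length ts * (∑[ x ∈ xs ] ∑[ x′ ∈ xs ] h x x′)
  square≤collisions xs ts g h covered same = begin
    length xs * length xs                                              ≤⟨ *-mono-≤ lower lower ⟩
    ∑ ts G * ∑ ts G                                                    ≤⟨ cauchy-schwarz ts G ⟩
    length ts * (∑[ t ∈ ts ] G t * G t)                                  ≡⟨ cong (length ts *_) expand ⟩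
    length ts * (∑[ x ∈ xs ] ∑[ x′ ∈ xs ] ∑[ t ∈ ts ] g x t * g x′ t)
      ≤⟨ *-monoʳ-≤ (length ts) (∑-mono xs λ x → ∑-mono xs (same x)) ⟩
    length ts * (∑[ x ∈ xs ] ∑[ x′ ∈ xs ] h x x′)                        ∎
    where
    open ≤-Reasoning
    G : _ → ℕ
    G t = ∑[ x ∈ xs ] g x t
    lower : length xs ≤ ∑ ts G
    lower = begin
      length xs                        ≡⟨ sym (∑-one xs) ⟩
      ∑[ _ ∈ xs ] 1                    ≤⟨ ∑-mono-All covered ⟩
      ∑[ x ∈ xs ] ∑[ t ∈ ts ] g x t    ≡⟨ ∑-swap xs ts g ⟩
      ∑ ts G                           ∎
    expand : ∑[ t ∈ ts ] G t * G t ≡ ∑[ x ∈ xs ] ∑[ x′ ∈ xs ] ∑[ t ∈ ts ] g x t * g x′ t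
    expand = begin-equality
      ∑[ t ∈ ts ] G t * G t
        ≡⟨ ∑-cong ts (λ t → sym (∑-*ʳ xs (λ x → g x t) (G t))) ⟩
      ∑[ t ∈ ts ] ∑[ x ∈ xs ] g x t * G t
        ≡⟨ ∑-cong ts (λ t → ∑-cong xs λ x → sym (∑-*ˡ xs (g x t) (λ x′ → g x′ t))) ⟩
      ∑[ t ∈ ts ] ∑[ x ∈ xs ] ∑[ x′ ∈ xs ] g x t * g x′ t        ≡⟨ ∑-swap ts xs (λ t x → ∑[ x′ ∈ xs ] g x t * g x′ t) ⟩
      ∑[ x ∈ xs ] ∑[ t ∈ ts ] ∑[ x′ ∈ xs ] g x t * g x′ t
        ≡⟨ ∑-cong xs (λ x → ∑-swap ts xs (λ t x′ → g x t * g x′ t)) ⟩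
      ∑[ x ∈ xs ] ∑[ x′ ∈ xs ] ∑[ t ∈ ts ] g x t * g x′ t        ∎

  module Representatives {A : Set} {_~_ : Rel A 0ℓ} (_~?_ : ∀ x y → Dec (x ~ y))
    (~-refl : ∀ {x} → x ~ x) (~-sym : ∀ {x y} → x ~ y → y ~ x) (~-trans : ∀ {x y z} → x ~ y → y ~ z → x ~ z) where

    reps : List A → List A
    reps []       = []
    reps (x ∷ xs) with Any.any? (x ~?_) (reps xs)
    ... | yes _ = reps xs
    ... | no  _ = x ∷ reps xs

    reps-All : {P : A → Set} {xs : List A} → All P xs → All P (reps xs)
    reps-All [] = []
    reps-All {xs = x ∷ xs} (p ∷ ps) with Any.any? (x ~?_) (reps xs)
    ... | yes _ = reps-All ps
    ... | no  _ = p ∷ reps-All ps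

    reps-distinct : (xs : List A) → AllPairs (λ x y → ¬ x ~ y) (reps xs)
    reps-distinct [] = []
    reps-distinct (x ∷ xs) with Any.any? (x ~?_) (reps xs)
    ... | yes _ = reps-distinct xs
    ... | no ¬p = All.¬Any⇒All¬ (reps xs) ¬p ∷ reps-distinct xs

    reps-cover : (xs : List A) → All (λ x → Any (x ~_) (reps xs)) xs
    reps-cover [] = []
    reps-cover (x ∷ xs) with Any.any? (x ~?_) (reps xs)
    ... | yes p = p ∷ reps-cover xs
    ... | no  _ = here ~-refl ∷ All.map there (reps-cover xs)

    -- Two members related to x would be related to each other.
    distinct-≤1 : {ys : List A} → AllPairs (λ x y → ¬ x ~ y) ys → (x : A) → ∑[ y ∈ ys ] 𝟙 (x ~? y) ≤ 1
    distinct-≤1 [] x = z≤n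
    distinct-≤1 {y ∷ ys} (y≁ ∷ ps) x with x ~? y
    ... | no  _   = distinct-≤1 ps x
    ... | yes x~y = ≤-reflexive (cong suc (n≤0⇒n≡0 (≤-trans (∑-mono-All (All.map (λ {z} y≁z →
                      ≤-reflexive (𝟙-false (x ~? z) (λ x~z → y≁z (~-trans (~-sym x~y) x~z)))) y≁)) (≤-reflexive (∑-zero ys)))))

    -- This turns an upper bound for the number of related pairs into a lower bound for the number
    -- of classes: it is `square≤collisions` for the map from elements to representatives.
    reps-collisions : (xs : List A) →
      length xs * length xs ≤ length (reps xs) * (∑[ x ∈ xs ] ∑[ x′ ∈ xs ] 𝟙 (x ~? x′))
    reps-collisions xs = square≤collisions xs (reps xs) (λ x y → 𝟙 (x ~? y)) (λ x x′ → 𝟙 (x ~? x′))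
      (All.map covered (reps-cover xs)) same
      where
      covered : ∀ {x} → Any (x ~_) (reps xs) → 1 ≤ ∑[ y ∈ reps xs ] 𝟙 (x ~? y)
      covered {x} p with y , y∈ , x~y ← find p =
        ≤-trans (≤-reflexive (sym (𝟙-true (x ~? y) x~y))) (∑-≥-member (λ y → 𝟙 (x ~? y)) y∈)
      same : ∀ x x′ → ∑[ y ∈ reps xs ] 𝟙 (x ~? y) * 𝟙 (x′ ~? y) ≤ 𝟙 (x ~? x′)
      same x x′ with x ~? x′
      ... | yes _ = ≤-trans (∑-mono (reps xs) λ y → ≤-trans (*-monoʳ-≤ (𝟙 (x ~? y)) (𝟙≤1 (x′ ~? y))) (≤-reflexive (*-identityʳ _)))
                            (distinct-≤1 (reps-distinct xs) x)
      ... | no ¬p = ≤-reflexive (trans (∑-cong (reps xs) λ y → trans (𝟙-× (x ~? y) (x′ ~? y))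
                      (𝟙-false (x ~? y ×-dec x′ ~? y) λ (r , s) → ¬p (~-trans r (~-sym s)))) (∑-zero (reps xs)))

open FiniteSums

-- Finite setoids: double counting, pigeonhole and quotients

module FiniteSetoids where
  open import Data.Nat.Base using (z≤n; _+_; _*_)
  open import Data.Nat.Properties hiding (_≟_)
  open ≡ using (refl; sym; trans; cong; cong₂; subst)

  private variable
    A B : Set

  ∑-tabulate : ∀ {n} (g : Fin n → A) (f : A → ℕ) → ∑ (tabulate g) f ≡ ∑ (tabulate id) (f ∘ g)
  ∑-tabulate g f = trans (cong (λ xs → ∑ xs f) (sym (map-tabulate id g))) (∑-map g (tabulate id) f)

  ∑-Fin-once : ∀ {n} (j : Fin n) → ∑[ i ∈ tabulate id ] 𝟙 (i Fin.≟ j) ≡ 1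
  ∑-Fin-once {suc n} zero = cong suc (trans (∑-tabulate {n = n} suc (λ i → 𝟙 (i Fin.≟ zero)))
    (trans (∑-cong (tabulate {n = n} id) (λ i → 𝟙-false (suc i Fin.≟ zero) λ ())) (∑-zero (tabulate {n = n} id))))
  ∑-Fin-once (suc j) = trans (∑-tabulate suc (λ i → 𝟙 (i Fin.≟ suc j)))
    (trans (∑-cong (tabulate id) (λ i → 𝟙-cong (suc i Fin.≟ suc j) (i Fin.≟ j) Fin.suc-injective (cong suc))) (∑-Fin-once j))

  ∑-cartesianProductWith : ∀ {C : Set} (f : A → B → C) (xs : List A) (ys : List B) (h : C → ℕ) →
    ∑ (cartesianProductWith f xs ys) h ≡ ∑[ x ∈ xs ] ∑[ y ∈ ys ] h (f x y)
  ∑-cartesianProductWith f []       ys h = refl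
  ∑-cartesianProductWith f (x ∷ xs) ys h = trans (∑-++ (map (f x) ys) _ h)
    (cong₂ _+_ (∑-map (f x) ys h) (∑-cartesianProductWith f xs ys h))

  record FiniteSetoid : Set₁ where
    infix 4 _≈_ _≟_
    field
      Carrier       : Set
      _≈_           : Rel Carrier 0ℓ
      isEquivalence : IsEquivalence _≈_
      _≟_           : ∀ x y → Dec (x ≈ y)
      elements      : List Carrier
      -- Completeness of the list and absence of repetitions up to `_≈_` in one equation, in the
      -- form in which double counting consumes them.
      once          : ∀ y → ∑[ x ∈ elements ] 𝟙 (x ≟ y) ≡ 1

    private module ≈ = IsEquivalence isEquivalence

    size : ℕ
    size = length elements

    member : ∀ y → Any (_≈ y) elements
    member y = go elements (≤-reflexive (sym (once y)))
      where
      go : ∀ xs → 1 ≤ ∑[ x ∈ xs ] 𝟙 (x ≟ y) → Any (_≈ y) xs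
      go (x ∷ xs) h with x ≟ y
      ... | yes x≈y = here x≈y
      ... | no  _   = there (go xs h)

    module _ {P : Carrier → Set} (P? : ∀ x → Dec (P x)) where

      ∃? : (∀ {x y} → x ≈ y → P x → P y) → Dec (∃ P)
      ∃? resp = map′ (λ p → let x , _ , px = find p in x , px)
                     (λ (y , py) → Any.map (λ x≈y → resp (≈.sym x≈y) py) (member y))
                     (Any.any? P? elements)

      ∀? : (∀ {x y} → x ≈ y → P x → P y) → Dec (∀ x → P x)
      ∀? resp = map′ (λ ps y → let x , x∈ , x≈y = find (member y) in resp x≈y (All.lookup ps x∈))
                     (λ ps → All.tabulate (λ {x} _ → ps x))
                     (All.all? P? elements)

      ∑𝟙≤1 : (∀ x y → P x → P y → x ≈ y) → ∑[ x ∈ elements ] 𝟙 (P? x) ≤ 1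
      ∑𝟙≤1 unique with Any.any? P? elements
      ... | yes p = let x₀ , _ , px₀ = find p in
        ≤-trans (∑-mono elements (λ x → 𝟙-mono (P? x) (x ≟ x₀) (λ px → unique x x₀ px px₀))) (≤-reflexive (once x₀))
      ... | no ¬p = ≤-trans (∑-mono-All (All.tabulate (λ {x} x∈ → ≤-reflexive (𝟙-false (P? x) (λ px → ¬p (lose x∈ px))))))
                            (≤-trans (≤-reflexive (∑-zero elements)) z≤n)

      ∑𝟙≡1 : ∀ x₀ → (∀ x → P x → x ≈ x₀) → (∀ x → x ≈ x₀ → P x) → ∑[ x ∈ elements ] 𝟙 (P? x) ≡ 1
      ∑𝟙≡1 x₀ unique exists = trans (∑-cong elements (λ x → 𝟙-cong (P? x) (x ≟ x₀) (unique x) (exists x))) (once x₀)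

    -- Each summand is spread over all x with the weight `𝟙 (x ≟ σ y)`, and the sums are exchanged.
    -- The two implications say that τ inverts σ, in the form that the inner count asks for.
    ∑-bijection : (f : Carrier → ℕ) → (∀ {x y} → x ≈ y → f x ≡ f y) →
      (σ τ : Carrier → Carrier) → (∀ x y → x ≈ σ y → y ≈ τ x) → (∀ x y → y ≈ τ x → x ≈ σ y) →
      ∑[ x ∈ elements ] f (σ x) ≡ ∑ elements f
    ∑-bijection f f-cong σ τ to from = begin-equality
      ∑[ y ∈ elements ] f (σ y)                                            ≡⟨ ∑-cong elements (λ y → spread y) ⟩
      ∑[ y ∈ elements ] ∑[ x ∈ elements ] 𝟙 (x ≟ σ y) * f x                ≡⟨ ∑-swap elements elements _ ⟩
      ∑[ x ∈ elements ] ∑[ y ∈ elements ] 𝟙 (x ≟ σ y) * f x                ≡⟨ ∑-cong elements (λ x → trans (∑-*ʳ elements (λ y → 𝟙 (x ≟ σ y)) (f x))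
                                                                              (trans (cong (_* f x) (∑𝟙≡1 (λ y → x ≟ σ y) (τ x) (to x) (from x))) (*-identityˡ (f x)))) ⟩
      ∑[ x ∈ elements ] f x                                                ∎
      where
      open ≤-Reasoning
      spread : ∀ y → f (σ y) ≡ ∑[ x ∈ elements ] 𝟙 (x ≟ σ y) * f x
      spread y = begin-equality
        f (σ y)                                       ≡⟨ sym (*-identityˡ (f (σ y))) ⟩
        1 * f (σ y)                                   ≡⟨ cong (_* f (σ y)) (sym (once (σ y))) ⟩
        (∑[ x ∈ elements ] 𝟙 (x ≟ σ y)) * f (σ y)     ≡⟨ sym (∑-*ʳ elements (λ x → 𝟙 (x ≟ σ y)) (f (σ y))) ⟩
        ∑[ x ∈ elements ] 𝟙 (x ≟ σ y) * f (σ y)       ≡⟨ ∑-cong elements (λ x → ≤-antisym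
                                                           (𝟙-*-≤ (x ≟ σ y) (λ e → ≤-reflexive (f-cong (≈.sym e))))
                                                           (𝟙-*-≤ (x ≟ σ y) (λ e → ≤-reflexive (f-cong e)))) ⟩
        ∑[ x ∈ elements ] 𝟙 (x ≟ σ y) * f x           ∎

    -- The fibres of φ have total size `size` and at most one element each, so an empty fibre over y
    -- would leave too little room. Being hit is decidable, hence refuting that y is missed
    -- suffices.
    injective⇒surjective : (φ : Carrier → Carrier) → (∀ {x y} → x ≈ y → φ x ≈ φ y) →
      (∀ x y → φ x ≈ φ y → x ≈ y) → ∀ y → ∃[ x ] φ x ≈ y
    injective⇒surjective φ φ-cong φ-inj y =
      decidable-stable (∃? (λ x → φ x ≟ y) (λ x≈x′ e → ≈.trans (φ-cong (≈.sym x≈x′)) e)) λ missed → <-irrefl refl (begin-strict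
        size                                                                  <⟨ n<1+n size ⟩
        1 + size                                                              ≡⟨ cong₂ _+_ (sym (once y)) count ⟩
        (∑[ z ∈ elements ] 𝟙 (z ≟ y)) + (∑[ z ∈ elements ] fibre z)           ≡⟨ sym (∑-+ elements _ _) ⟩
        ∑[ z ∈ elements ] (𝟙 (z ≟ y) + fibre z)
          ≤⟨ ∑-mono elements (λ z → one missed z (z ≟ y)) ⟩
        ∑[ _ ∈ elements ] 1                                                   ≡⟨ ∑-one elements ⟩
        size                                                                  ∎)
      where
      open ≤-Reasoning
      fibre : Carrier → ℕ
      fibre z = ∑[ x ∈ elements ] 𝟙 (z ≟ φ x)
      fibre≤1 : ∀ z → fibre z ≤ 1
      fibre≤1 z = ∑𝟙≤1 (λ x → z ≟ φ x) (λ x x′ e e′ → φ-inj x x′ (≈.trans (≈.sym e) e′))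
      count : size ≡ ∑ elements fibre
      count = trans (sym (∑-one elements)) (trans (∑-cong elements (λ x → sym (once (φ x)))) (∑-swap elements elements _))
      one : ¬ (∃[ x ] φ x ≈ y) → ∀ z (d : Dec (z ≈ y)) → 𝟙 d + fibre z ≤ 1
      one missed z (no  _)   = fibre≤1 z
      one missed z (yes z≈y) = ≤-reflexive (cong suc (trans
        (∑-cong elements (λ x → 𝟙-false (z ≟ φ x) (λ e → missed (x , ≈.trans (≈.sym e) z≈y)))) (∑-zero elements)))

  fromCardinality : {_≈_ : Rel A 0ℓ} {n : ℕ} → IsEquivalence _≈_ → HasCardinality _≈_ n → FiniteSetoid
  fromCardinality {A} {_≈_} {n} isEquivalence (f , f-cong , f-inj , f-surj) = record
    { Carrier       = A
    ; _≈_           = _≈_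
    ; isEquivalence = isEquivalence
    ; _≟_           = λ x y → map′ f-inj f-cong (f x Fin.≟ f y)
    ; elements      = tabulate g
    ; once          = λ y → trans (∑-tabulate g _) (trans
        (∑-cong (tabulate id) (λ i → 𝟙-cong (map′ f-inj f-cong (f (g i) Fin.≟ f y)) (i Fin.≟ f y)
          (λ e → trans (sym (fg i)) (f-cong e)) (λ e → f-inj (trans (fg i) e)))) (∑-Fin-once (f y)))
    }
    where
    g : Fin n → A
    g i = proj₁ (f-surj i)
    fg : ∀ i → f (g i) ≡ i
    fg i = proj₂ (f-surj i) (IsEquivalence.refl isEquivalence)

  size-fromCardinality : {_≈_ : Rel A 0ℓ} {n : ℕ} (eq : IsEquivalence _≈_) (c : HasCardinality _≈_ n) →
    FiniteSetoid.size (fromCardinality eq c) ≡ n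
  size-fromCardinality eq c = length-tabulate _

  module _ (S : FiniteSetoid) where
    open FiniteSetoid S

    vectors : ∀ n → List (Vector Carrier n)
    vectors zero    = Vector.[] ∷ []
    vectors (suc n) = cartesianProductWith Vector._∷_ elements (vectors n)

    private
      vec-≟ : ∀ {n} (x y : Vector Carrier n) → Dec (Pointwise _≈_ x y)
      vec-≟ = Pointwise.decidable _≟_

      vectors-once : ∀ n (y : Vector Carrier n) → ∑[ x ∈ vectors n ] 𝟙 (vec-≟ x y) ≡ 1
      vectors-once zero    y = cong (_+ 0) (𝟙-true (vec-≟ Vector.[] y) (λ ()))
      vectors-once (suc n) y = begin-equality
        ∑[ x ∈ vectors (suc n) ] 𝟙 (vec-≟ x y)
          ≡⟨ ∑-cartesianProductWith Vector._∷_ elements (vectors n) _ ⟩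
        ∑[ s ∈ elements ] ∑[ x ∈ vectors n ] 𝟙 (vec-≟ (s Vector.∷ x) y)
          ≡⟨ ∑-cong elements (λ s → ∑-cong (vectors n) (split s)) ⟩
        ∑[ s ∈ elements ] ∑[ x ∈ vectors n ] 𝟙 (s ≟ y zero) * 𝟙 (vec-≟ x (y ∘ suc))  ≡⟨ ∑-cong elements (λ s → trans (∑-*ˡ (vectors n) (𝟙 (s ≟ y zero)) _)
                                                                                          (trans (cong (𝟙 (s ≟ y zero) *_) (vectors-once n (y ∘ suc))) (*-identityʳ _))) ⟩
        ∑[ s ∈ elements ] 𝟙 (s ≟ y zero)                                             ≡⟨ once (y zero) ⟩
        1                                                                            ∎
        where
        open ≤-Reasoning
        split : ∀ s x → 𝟙 (vec-≟ (s Vector.∷ x) y) ≡ 𝟙 (s ≟ y zero) * 𝟙 (vec-≟ x (y ∘ suc))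
        split s x = trans (𝟙-cong (vec-≟ (s Vector.∷ x) y) (s ≟ y zero ×-dec vec-≟ x (y ∘ suc))
          (λ e → e zero , e ∘ suc) (λ (e , es) → λ { zero → e ; (suc i) → es i }))
          (sym (𝟙-× (s ≟ y zero) (vec-≟ x (y ∘ suc))))

    vectorSetoid : ℕ → FiniteSetoid
    vectorSetoid n = record
      { Carrier       = Vector Carrier n
      ; _≈_           = Pointwise _≈_
      ; isEquivalence = Pointwise.isEquivalence isEquivalence n
      ; _≟_           = vec-≟
      ; elements      = vectors n
      ; once          = vectors-once n
      }

    length-vectors : ∀ n → length (vectors n) ≡ size ^ n
    length-vectors zero    = refl
    length-vectors (suc n) = begin-equality
      length (vectors (suc n))                        ≡⟨ sym (∑-one (vectors (suc n))) ⟩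
      ∑[ _ ∈ vectors (suc n) ] 1
        ≡⟨ ∑-cartesianProductWith Vector._∷_ elements (vectors n) (λ _ → 1) ⟩
      ∑[ _ ∈ elements ] ∑[ _ ∈ vectors n ] 1
        ≡⟨ ∑-cong elements (λ _ → trans (∑-one (vectors n)) (length-vectors n)) ⟩
      ∑[ _ ∈ elements ] size ^ n                      ≡⟨ ∑-const elements (size ^ n) ⟩
      size * size ^ n                                 ∎
      where open ≤-Reasoning

  distinct⇒lookup-injective : {_~_ : Rel A 0ℓ} → (∀ {x y} → x ~ y → y ~ x) → {xs : List A} → AllPairs (λ x y → ¬ x ~ y) xs →
    ∀ i j → lookup xs i ~ lookup xs j → i ≡ j
  distinct⇒lookup-injective sy (p ∷ ps) zero    zero    e = refl
  distinct⇒lookup-injective sy (p ∷ ps) zero    (suc j) e = ⊥-elim (All.lookup p (∈-lookup j) e)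
  distinct⇒lookup-injective sy (p ∷ ps) (suc i) zero    e = ⊥-elim (All.lookup p (∈-lookup i) (sy e))
  distinct⇒lookup-injective sy (p ∷ ps) (suc i) (suc j) e = cong suc (distinct⇒lookup-injective sy ps i j e)

  module _ {_~_ : Rel A 0ℓ} (~-equiv : IsEquivalence _~_) where
    private module ~ = IsEquivalence ~-equiv

    distinct-length≤cardinality : ∀ {n} → HasCardinality _~_ n → {zs : List A} → AllPairs (λ x y → ¬ x ~ y) zs → length zs ≤ n
    distinct-length≤cardinality (f , _ , f-inj , _) {zs} distinct =
      Fin.injective⇒≤ {f = f ∘ lookup zs} (λ {i} {j} e → distinct⇒lookup-injective ~.sym distinct i j (f-inj e))

    -- Each class is numbered by the position of its representative; decidability of `_~_` is what
    -- allows representatives to be chosen.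
    listed⇒cardinality : (_~?_ : ∀ x y → Dec (x ~ y)) (xs : List A) → (∀ a → Any (a ~_) xs) → ∃[ n ] HasCardinality _~_ n
    listed⇒cardinality _~?_ xs listed = length ys , class , congruent , injective , surjective
      where
      open Representatives _~?_ ~.refl ~.sym ~.trans
      ys : List A
      ys = reps xs
      cover : ∀ a → Any (a ~_) ys
      cover a = let x , x∈ , a~x = find (listed a) in Any.map (~.trans a~x) (All.lookup (reps-cover xs) x∈)
      class : A → Fin (length ys)
      class a = Any.index (cover a)
      in-class : ∀ a → a ~ lookup ys (class a)
      in-class a = lookup-index (cover a)
      index-unique = distinct⇒lookup-injective ~.sym (reps-distinct xs)
      congruent : ∀ {a b} → a ~ b → class a ≡ class b
      congruent {a} {b} a~b = index-unique _ _ (~.trans (~.sym (in-class a)) (~.trans a~b (in-class b)))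
      injective : ∀ {a b} → class a ≡ class b → a ~ b
      injective {a} {b} e = ~.trans (in-class a) (subst (λ i → lookup ys i ~ b) (sym e) (~.sym (in-class b)))
      surjective : ∀ i → ∃[ a ] (∀ {b} → b ~ a → class b ≡ i)
      surjective i = lookup ys i , λ {b} b~ → index-unique _ _ (~.trans (~.sym (in-class b)) b~)

open FiniteSetoids

-- The finite field

module IntegerCoefficients (R : CommutativeRing 0ℓ 0ℓ) where
  open CommutativeRing R
  open Algebra.Properties.Ring ring using (-‿distribˡ-*; -‿distribʳ-*; -0#≈0#; -‿involutive; -‿+-comm)
  open Algebra.Properties.Semiring.Mult semiring using (×1-homo-*; ×-homo-+) renaming (_×_ to infixr 8 _·_)
  open Relation.Binary.Reasoning.Setoid setoid

  fromℤ : ℤ.ℤ → Carrier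
  fromℤ (ℤ.+ n     ) = n · 1#
  fromℤ (ℤ.-[1+ n ]) = - (suc n · 1#)

  ⊖-homo : ∀ m n → fromℤ (m ℤ.⊖ n) ≈ m · 1# - n · 1#
  ⊖-homo m       zero    = sym (trans (+-congˡ -0#≈0#) (+-identityʳ _))
  ⊖-homo zero    (suc n) = sym (+-identityˡ _)
  ⊖-homo (suc m) (suc n) = begin
    fromℤ (suc m ℤ.⊖ suc n)                        ≡⟨ ≡.cong fromℤ (ℤ.[1+m]⊖[1+n]≡m⊖n m n) ⟩
    fromℤ (m ℤ.⊖ n)                                ≈⟨ ⊖-homo m n ⟩
    m · 1# - n · 1#                            ≈⟨ +-congʳ (sym (+-identityʳ _)) ⟩
    (m · 1# + 0#) - n · 1#                     ≈⟨ +-congʳ (+-congˡ (sym (-‿inverseʳ 1#))) ⟩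
    (m · 1# + (1# - 1#)) - n · 1#              ≈⟨ +-congʳ (trans (sym (+-assoc _ _ _)) (+-congʳ (+-comm _ _))) ⟩
    ((1# + m · 1#) - 1#) - n · 1#              ≈⟨ +-assoc _ _ _ ⟩
    (1# + m · 1#) + (- 1# - n · 1#)            ≈⟨ +-congˡ (-‿+-comm _ _) ⟩
    (1# + m · 1#) - (1# + n · 1#)              ∎

  -‿homo : ∀ i → fromℤ (ℤ.- i) ≈ - fromℤ (i)
  -‿homo (ℤ.+ zero)    = sym -0#≈0#
  -‿homo (ℤ.+ suc n)   = refl
  -‿homo (ℤ.-[1+ n ])  = sym (-‿involutive _)

  +-homo : ∀ i j → fromℤ (i ℤ.+ j) ≈ fromℤ (i) + fromℤ (j)
  +-homo (ℤ.+ m)      (ℤ.+ n)      = ×-homo-+ 1# m n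
  +-homo (ℤ.+ m)      (ℤ.-[1+ n ]) = ⊖-homo m (suc n)
  +-homo (ℤ.-[1+ m ]) (ℤ.+ n)      = trans (⊖-homo n (suc m)) (+-comm _ _)
  +-homo (ℤ.-[1+ m ]) (ℤ.-[1+ n ]) = begin
    - (suc (suc (m ℕ.+ n)) · 1#)            ≡⟨ ≡.cong (λ k → - (k · 1#)) (≡.sym (≡.cong suc (ℕ.+-suc m n))) ⟩
    - ((suc m ℕ.+ suc n) · 1#)              ≈⟨ -‿cong (×-homo-+ 1# (suc m) (suc n)) ⟩
    - (suc m · 1# + suc n · 1#)             ≈⟨ sym (-‿+-comm _ _) ⟩
    - (suc m · 1#) - suc n · 1#             ∎

  *-homo : ∀ i j → fromℤ (i ℤ.* j) ≈ fromℤ (i) * fromℤ (j)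
  *-homo (ℤ.+ m) (ℤ.+ n) = trans (reflexive (≡.cong fromℤ (≡.sym (ℤ.pos-* m n)))) (×1-homo-* m n)
  *-homo (ℤ.+ m) (ℤ.-[1+ n ]) = begin
    fromℤ (ℤ.+ m ℤ.* ℤ.-[1+ n ])            ≡⟨ ≡.cong fromℤ (≡.sym (ℤ.neg-distribʳ-* (ℤ.+ m) (ℤ.+ suc n))) ⟩
    fromℤ (ℤ.- (ℤ.+ m ℤ.* ℤ.+ suc n))       ≈⟨ -‿homo (ℤ.+ m ℤ.* ℤ.+ suc n) ⟩
    - fromℤ (ℤ.+ m ℤ.* ℤ.+ suc n)           ≈⟨ -‿cong (*-homo (ℤ.+ m) (ℤ.+ suc n)) ⟩
    - (m · 1# * (suc n · 1#))           ≈⟨ -‿distribʳ-* _ _ ⟩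
    m · 1# * - (suc n · 1#)             ∎
  *-homo (ℤ.-[1+ m ]) (ℤ.+ n) = begin
    fromℤ (ℤ.-[1+ m ] ℤ.* ℤ.+ n)            ≡⟨ ≡.cong fromℤ (≡.sym (ℤ.neg-distribˡ-* (ℤ.+ suc m) (ℤ.+ n))) ⟩
    fromℤ (ℤ.- (ℤ.+ suc m ℤ.* ℤ.+ n))       ≈⟨ -‿homo (ℤ.+ suc m ℤ.* ℤ.+ n) ⟩
    - fromℤ (ℤ.+ suc m ℤ.* ℤ.+ n)           ≈⟨ -‿cong (*-homo (ℤ.+ suc m) (ℤ.+ n)) ⟩
    - (suc m · 1# * (n · 1#))           ≈⟨ -‿distribˡ-* _ _ ⟩
    - (suc m · 1#) * (n · 1#)           ∎
  *-homo (ℤ.-[1+ m ]) (ℤ.-[1+ n ]) = begin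
    (suc m ℕ.* suc n) · 1#              ≈⟨ ×1-homo-* (suc m) (suc n) ⟩
    suc m · 1# * (suc n · 1#)           ≈⟨ sym (-‿involutive _) ⟩
    - - (suc m · 1# * (suc n · 1#))     ≈⟨ -‿cong (-‿distribʳ-* _ _) ⟩
    - (suc m · 1# * - (suc n · 1#))     ≈⟨ -‿distribˡ-* _ _ ⟩
    - (suc m · 1#) * - (suc n · 1#)     ∎

  -- Equality of integer coefficients is decided by computation, so the solver can cancel terms and
  -- treat negation and constants without inspecting R.
  morphism : ℤ.+-*-rawRing -Raw-AlmostCommutative⟶ fromCommutativeRing R
  morphism = record
    { ⟦_⟧ = fromℤ ; +-homo = +-homo ; *-homo = *-homo ; -‿homo = -‿homo ; 0-homo = refl ; 1-homo = +-identityʳ 1# }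

  open Algebra.Solver.Ring ℤ.+-*-rawRing (fromCommutativeRing R) morphism
    (λ i j → Maybe.map (reflexive ∘ ≡.cong fromℤ) (dec⇒maybe (i ℤ.≟ j))) public

odd-primePower : ∀ {q} → OddPrimePower q → ¬ 2 ∣ q
odd-primePower (p , n , p-prime , p≢2 , _ , ≡.refl) = go n
  where
  go : ∀ n → ¬ 2 ∣ p ℕ.^ n
  go zero    2∣1 with () ← ∣1⇒≡1 2∣1
  go (suc n) 2∣p^n with euclidsLemma p (p ℕ.^ n) prime[2] 2∣p^n
  ... | inj₂ 2∣p^n′ = go n 2∣p^n′
  ... | inj₁ 2∣p with prime⇒irreducible p-prime 2∣p
  ...   | inj₁ ()
  ...   | inj₂ 2≡p = p≢2 (≡.sym 2≡p)

module FiniteField (F : HeytingField 0ℓ 0ℓ 0ℓ) {q : ℕ} (q-odd : OddPrimePower q)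
  (card : HasCardinality (HeytingField._≈_ F) q) where

  R : CommutativeRing 0ℓ 0ℓ
  R = HeytingCommutativeRing.commutativeRing (HeytingField.heytingCommutativeRing F)

  open HeytingField F public using (_≈_; 0#; 1#; #⇒invertible; invertible⇒#; tight)
    renaming (Carrier to 𝔽; _+_ to infixl 6 _⊕_; _*_ to infixl 7 _⊗_; -_ to infix 8 ⊝_)
  open CommutativeRing R public using (isEquivalence; setoid)
    renaming (refl to ≈-refl; sym to ≈-sym; trans to ≈-trans; +-cong to ⊕-cong; +-congˡ to ⊕-congˡ; +-congʳ to ⊕-congʳ;
              *-cong to ⊗-cong; *-congˡ to ⊗-congˡ; *-congʳ to ⊗-congʳ; -‿cong to ⊝-cong;
              zeroˡ to ⊗-zeroˡ; zeroʳ to ⊗-zeroʳ; *-comm to ⊗-comm; *-identityˡ to ⊗-identityˡ; *-identityʳ to ⊗-identityʳ;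
              +-identityˡ to ⊕-identityˡ; +-identityʳ to ⊕-identityʳ; -‿inverseʳ to ⊝-inverseʳ)
  module ≈-Reasoning = Relation.Binary.Reasoning.Setoid setoid
  module 𝔽-Solver = IntegerCoefficients R
  open 𝔽-Solver using (solve; _:=_; _:+_; _:*_; :-_; con)

  𝔽ₛ : FiniteSetoid
  𝔽ₛ = fromCardinality isEquivalence card

  open FiniteSetoid 𝔽ₛ public using (_≟_) renaming (elements to scalars)
  module 𝔽ₛ = FiniteSetoid 𝔽ₛ

  size-𝔽 : 𝔽ₛ.size ≡ q
  size-𝔽 = size-fromCardinality isEquivalence card

  x-y≈0⇒x≈y : ∀ {x y} → x ⊕ ⊝ y ≈ 0# → x ≈ y
  x-y≈0⇒x≈y {x} {y} e = begin
    x                 ≈⟨ solve 2 (λ x y → x := (x :+ :- y) :+ y) ≈-refl x y ⟩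
    (x ⊕ ⊝ y) ⊕ y     ≈⟨ ⊕-congʳ e ⟩
    0# ⊕ y            ≈⟨ ⊕-identityˡ y ⟩
    y                 ∎
    where open ≈-Reasoning

  x≈y⇒x-y≈0 : ∀ {x y} → x ≈ y → x ⊕ ⊝ y ≈ 0#
  x≈y⇒x-y≈0 {x} {y} e = ≈-trans (⊕-congʳ e) (⊝-inverseʳ y)

  -- Apartness comes without a decision procedure, but the search for an inverse through the finite
  -- field is decidable. If it fails, x is not apart from 0, and tightness gives x ≈ 0.
  inverse : ∀ {x} → ¬ x ≈ 0# → ∃[ y ] y ⊗ x ≈ 1#
  inverse {x} x≉0 with 𝔽ₛ.∃? (λ y → y ⊗ x ≟ 1#) (λ y≈y′ e → ≈-trans (⊗-congʳ (≈-sym y≈y′)) e)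
  ... | yes inv  = inv
  ... | no  ¬inv = ⊥-elim (x≉0 (proj₁ (tight x 0#) λ x#0 →
    let y , y[x-0]≈1 , _ = #⇒invertible x#0 in ¬inv (y , (begin
      y ⊗ x            ≈⟨ solve 2 (λ x y → y :* x := y :* (x :+ :- con (ℤ.+ 0))) ≈-refl x y ⟩
      y ⊗ (x ⊕ ⊝ 0#)   ≈⟨ y[x-0]≈1 ⟩
      1#               ∎))))
    where open ≈-Reasoning

  x*y≈0⇒y≈0 : ∀ {x y} → ¬ x ≈ 0# → x ⊗ y ≈ 0# → y ≈ 0#
  x*y≈0⇒y≈0 {x} {y} x≉0 e = let x⁻¹ , inv = inverse x≉0 in begin
    y                 ≈⟨ ⊗-identityˡ y ⟨
    1# ⊗ y            ≈⟨ ⊗-congʳ inv ⟨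
    x⁻¹ ⊗ x ⊗ y       ≈⟨ CommutativeRing.*-assoc R x⁻¹ x y ⟩
    x⁻¹ ⊗ (x ⊗ y)     ≈⟨ ⊗-congˡ e ⟩
    x⁻¹ ⊗ 0#          ≈⟨ ⊗-zeroʳ x⁻¹ ⟩
    0#                ∎
    where open ≈-Reasoning

  -- In a zero ring every difference is invertible, so 0 would be apart from itself.
  1≉0 : ¬ 1# ≈ 0#
  1≉0 1≈0 = proj₂ (tight 0# 0#) ≈-refl (invertible⇒# (0# , (collapse _ _ , collapse _ _)))
    where
    open ≈-Reasoning
    collapse : ∀ x y → x ≈ y
    collapse x y = ≈-trans (zero-ring x) (≈-sym (zero-ring y))
      where
      zero-ring : ∀ x → x ≈ 0#
      zero-ring x = begin
        x        ≈⟨ ⊗-identityˡ x ⟨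
        1# ⊗ x   ≈⟨ ⊗-congʳ 1≈0 ⟩
        0# ⊗ x   ≈⟨ ⊗-zeroˡ x ⟩
        0#       ∎

  -- In characteristic 2, s ↦ s + 1 would pair off the elements of the field.
  1+1≉0 : ¬ 1# ⊕ 1# ≈ 0#
  1+1≉0 2≈0 = odd-primePower q-odd (divides ascents (R.begin-equality
    q                                   R.≡⟨ total ⟨
    ascents ℕ.+ ∑ scalars descend
      R.≡⟨ ≡.cong (ascents ℕ.+_) (≡.trans descents≡ascents (≡.sym (ℕ.+-identityʳ ascents))) ⟩
    2 ℕ.* ascents                       R.≡⟨ ℕ.*-comm 2 ascents ⟩
    ascents ℕ.* 2                       R.∎))
    where
    module R = ℕ.≤-Reasoning
    index : 𝔽 → Fin q
    index = proj₁ card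
    index-cong = proj₁ (proj₂ card)
    open ≈-Reasoning

    twice : ∀ s → s ⊕ 1# ⊕ 1# ≈ s
    twice s = begin
      s ⊕ 1# ⊕ 1#      ≈⟨ solve 2 (λ s e → s :+ e :+ e := s :+ (e :+ e)) ≈-refl s 1# ⟩
      s ⊕ (1# ⊕ 1#)    ≈⟨ ⊕-congˡ 2≈0 ⟩
      s ⊕ 0#           ≈⟨ ⊕-identityʳ s ⟩
      s                ∎

    -- The order of the indices distinguishes the two ends of each pair: every s is either an ascent
    -- or a descent, and the shift by 1 exchanges the two kinds.
    ascend descend : 𝔽 → ℕ
    ascend  s = 𝟙 (index s Fin.<? index (s ⊕ 1#))
    descend s = 𝟙 (index (s ⊕ 1#) Fin.<? index s)
    ascents : ℕ
    ascents = ∑ scalars ascend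

    index-≢ : ∀ s → index s ≢ index (s ⊕ 1#)
    index-≢ s e = 1≉0 (begin
      1#                 ≈⟨ solve 2 (λ s e → e := (s :+ e) :+ :- s) ≈-refl s 1# ⟩
      (s ⊕ 1#) ⊕ ⊝ s     ≈⟨ x≈y⇒x-y≈0 (≈-sym (proj₁ (proj₂ (proj₂ card)) e)) ⟩
      0#                 ∎)

    one : ∀ s → ascend s ℕ.+ descend s ≡ 1
    one s with Fin.<-cmp (index s) (index (s ⊕ 1#))
    ... | tri< lt _ ¬gt = ≡.cong₂ ℕ._+_ (𝟙-true (_ Fin.<? _) lt) (𝟙-false (_ Fin.<? _) ¬gt)
    ... | tri≈ _ eq _   = ⊥-elim (index-≢ s eq)
    ... | tri> ¬lt _ gt = ≡.cong₂ ℕ._+_ (𝟙-false (_ Fin.<? _) ¬lt) (𝟙-true (_ Fin.<? _) gt)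

    descend-shift : ∀ s → descend (s ⊕ 1#) ≡ ascend s
    descend-shift s = ≡.cong (λ i → 𝟙 (i Fin.<? index (s ⊕ 1#))) (index-cong (twice s))

    descend-cong : ∀ {s t} → s ≈ t → descend s ≡ descend t
    descend-cong s≈t = ≡.cong₂ (λ i j → 𝟙 (i Fin.<? j)) (index-cong (⊕-congʳ s≈t)) (index-cong s≈t)

    flip : ∀ s t → s ≈ t ⊕ 1# → t ≈ s ⊕ 1#
    flip s t e = ≈-sym (≈-trans (⊕-congʳ e) (twice t))

    descents≡ascents : ∑ scalars descend ≡ ascents
    descents≡ascents = ≡.trans (≡.sym (𝔽ₛ.∑-bijection descend descend-cong (_⊕ 1#) (_⊕ 1#) flip (λ s t → flip t s)))
                               (∑-cong scalars descend-shift)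

    total : ascents ℕ.+ ∑ scalars descend ≡ q
    total = ≡.trans (≡.sym (∑-+ scalars ascend descend)) (≡.trans (∑-cong scalars one) (≡.trans (∑-one scalars) size-𝔽))

  x+x≈0⇒x≈0 : ∀ {x} → x ⊕ x ≈ 0# → x ≈ 0#
  x+x≈0⇒x≈0 {x} e = x*y≈0⇒y≈0 1+1≉0 (begin
    (1# ⊕ 1#) ⊗ x     ≈⟨ solve 2 (λ e x → (e :+ e) :* x := e :* (x :+ x)) ≈-refl 1# x ⟩
    1# ⊗ (x ⊕ x)      ≈⟨ ⊗-identityˡ _ ⟩
    x ⊕ x             ≈⟨ e ⟩
    0#                ∎)
    where open ≈-Reasoning

  linear? : ∀ a b s → Dec (a ⊗ s ⊕ b ≈ 0#)
  linear? a b s = a ⊗ s ⊕ b ≟ 0#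

  linear-root-unique : ∀ {a b} → ¬ a ≈ 0# → ∀ s t → a ⊗ s ⊕ b ≈ 0# → a ⊗ t ⊕ b ≈ 0# → s ≈ t
  linear-root-unique {a} {b} a≉0 s t es et = x-y≈0⇒x≈y (x*y≈0⇒y≈0 a≉0 (begin
    a ⊗ (s ⊕ ⊝ t)
      ≈⟨ solve 4 (λ a b s t → a :* (s :+ :- t) := (a :* s :+ b) :+ :- (a :* t :+ b)) ≈-refl a b s t ⟩
    (a ⊗ s ⊕ b) ⊕ ⊝ (a ⊗ t ⊕ b)        ≈⟨ x≈y⇒x-y≈0 (≈-trans es (≈-sym et)) ⟩
    0#                                 ∎))
    where open ≈-Reasoning

  linear-roots-≤1 : ∀ {a b} → ¬ a ≈ 0# → ∑[ s ∈ scalars ] 𝟙 (a ⊗ s ⊕ b ≟ 0#) ≤ 1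
  linear-roots-≤1 {a} {b} a≉0 = 𝔽ₛ.∑𝟙≤1 (linear? a b) (linear-root-unique a≉0)

  linear-roots-≡1 : ∀ {a b} → ¬ a ≈ 0# → ∑[ s ∈ scalars ] 𝟙 (a ⊗ s ⊕ b ≟ 0#) ≡ 1
  linear-roots-≡1 {a} {b} a≉0 = let a⁻¹ , inv = inverse a≉0; s₀ = a⁻¹ ⊗ ⊝ b
                                    root : a ⊗ s₀ ⊕ b ≈ 0#
                                    root = begin
                                      a ⊗ (a⁻¹ ⊗ ⊝ b) ⊕ b
                                        ≈⟨ solve 3 (λ a b c → a :* (c :* :- b) :+ b := (c :* a) :* (:- b) :+ b) ≈-refl a b a⁻¹ ⟩
                                      (a⁻¹ ⊗ a) ⊗ ⊝ b ⊕ b      ≈⟨ ⊕-congʳ (⊗-congʳ inv) ⟩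
                                      1# ⊗ ⊝ b ⊕ b             ≈⟨ ⊕-congʳ (⊗-identityˡ (⊝ b)) ⟩
                                      ⊝ b ⊕ b                  ≈⟨ solve 1 (λ b → :- b :+ b := con (ℤ.+ 0)) ≈-refl b ⟩
                                      0#                       ∎
    in 𝔽ₛ.∑𝟙≡1 (linear? a b) s₀ (λ s e → linear-root-unique a≉0 s s₀ e root) (λ s e → ≈-trans (⊕-congʳ (⊗-congˡ e)) root)
    where open ≈-Reasoning

  -- Once a root r is known, every other root annihilates the cofactor a s + (a r + b) of s - r.
  -- This cofactor is linear, or, if a vanishes, the nonzero constant b.
  quadratic-roots-≤2 : ∀ {a b c} → ¬ (a ≈ 0# × b ≈ 0#) →
    ∑[ s ∈ scalars ] 𝟙 (a ⊗ s ⊗ s ⊕ b ⊗ s ⊕ c ≟ 0#) ≤ 2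
  quadratic-roots-≤2 {a} {b} {c} nonconstant with 𝔽ₛ.∃? (λ s → a ⊗ s ⊗ s ⊕ b ⊗ s ⊕ c ≟ 0#)
    (λ s≈t e → ≈-trans (⊕-congʳ (⊕-cong (⊗-cong (⊗-congˡ (≈-sym s≈t)) (≈-sym s≈t)) (⊗-congˡ (≈-sym s≈t)))) e)
  ... | no ¬root = ℕ.≤-trans (ℕ.≤-reflexive (≡.trans (∑-cong scalars (λ s → 𝟙-false (_ ≟ 0#) (λ e → ¬root (s , e)))) (∑-zero scalars))) z≤n
  ... | yes (r , root) = begin
    ∑[ s ∈ scalars ] 𝟙 (a ⊗ s ⊗ s ⊕ b ⊗ s ⊕ c ≟ 0#)                     ≤⟨ ∑-mono scalars split ⟩
    ∑[ s ∈ scalars ] (𝟙 (s ≟ r) ℕ.+ 𝟙 (linear? a (a ⊗ r ⊕ b) s))        ≡⟨ ∑-+ scalars _ _ ⟩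
    (∑[ s ∈ scalars ] 𝟙 (s ≟ r)) ℕ.+ (∑[ s ∈ scalars ] 𝟙 (linear? a (a ⊗ r ⊕ b) s))
      ≤⟨ ℕ.+-mono-≤ (ℕ.≤-reflexive (𝔽ₛ.once r)) other ⟩
    2                                                                    ∎
    where
    open ℕ.≤-Reasoning
    split : ∀ s → 𝟙 (a ⊗ s ⊗ s ⊕ b ⊗ s ⊕ c ≟ 0#) ≤ 𝟙 (s ≟ r) ℕ.+ 𝟙 (linear? a (a ⊗ r ⊕ b) s)
    split s with s ≟ r
    ... | yes _  = ℕ.≤-trans (𝟙≤1 (_ ≟ 0#)) (s≤s z≤n)
    ... | no s≉r = 𝟙-mono (_ ≟ 0#) (linear? a (a ⊗ r ⊕ b) s) λ e → x*y≈0⇒y≈0 (s≉r ∘ x-y≈0⇒x≈y)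
      (≈-trans (solve 5 (λ a b c r s → (s :+ :- r) :* (a :* s :+ (a :* r :+ b))
                 := (a :* s :* s :+ b :* s :+ c) :+ :- (a :* r :* r :+ b :* r :+ c)) ≈-refl a b c r s)
               (x≈y⇒x-y≈0 (≈-trans e (≈-sym root))))
    other : ∑[ s ∈ scalars ] 𝟙 (linear? a (a ⊗ r ⊕ b) s) ≤ 1
    other with a ≟ 0#
    ... | no a≉0 = linear-roots-≤1 a≉0
    ... | yes a≈0 = ℕ.≤-trans (ℕ.≤-reflexive (≡.trans (∑-cong scalars λ s → 𝟙-false (linear? a (a ⊗ r ⊕ b) s) λ e →
        nonconstant (a≈0 , ≈-trans (≈-sym (b-only s)) e)) (∑-zero scalars))) z≤n
      where
      b-only : ∀ s → a ⊗ s ⊕ (a ⊗ r ⊕ b) ≈ b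
      b-only s = ≈-trans (⊕-cong (≈-trans (⊗-congʳ a≈0) (⊗-zeroˡ s)) (⊕-congʳ (≈-trans (⊗-congʳ a≈0) (⊗-zeroˡ r))))
                         (≈-trans (⊕-identityˡ _) (⊕-identityˡ b))

-- Linear algebra and quadrics in 𝔽ᵈ

module Space (F : HeytingField 0ℓ 0ℓ 0ℓ) {q : ℕ} (q-odd : OddPrimePower q)
  (card : HasCardinality (HeytingField._≈_ F) q) (d : ℕ) where

  open FiniteField F q-odd card public
  open Geometry F d public
  open 𝔽-Solver using (solve; _:=_; _:+_; _:*_; :-_)

  private
    module Σ  = Algebra.Properties.CommutativeMonoid.Sum (CommutativeRing.+-commutativeMonoid R)
    module Σ* = Algebra.Properties.Semiring.Sum (CommutativeRing.semiring R)

  sum : ∀ {k} → Vector 𝔽 k → 𝔽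
  sum = RawMonoidDefs.sum (CommutativeRing.+-rawMonoid R)

  sumᴹ : ∀ {k} → Vector Point k → Point
  sumᴹ = RawMonoidDefs.sum (RawLeftModule.+ᴹ-rawMonoid space)

  Pointₛ : FiniteSetoid
  Pointₛ = vectorSetoid 𝔽ₛ d
  module Pointₛ = FiniteSetoid Pointₛ
  open FiniteSetoid Pointₛ public using () renaming (_≟_ to _≟ᴹ_; elements to points)

  size-Point : length points ≡ q ℕ.^ d
  size-Point = ≡.trans (length-vectors 𝔽ₛ d) (≡.cong (ℕ._^ d) size-𝔽)

  infixl 6 _-ᴹ_
  _-ᴹ_ : Point → Point → Point
  x -ᴹ y = x +ᴹ -ᴹ y

  ≈ᴹ-sym : ∀ {x y} → x ≈ᴹ y → y ≈ᴹ x
  ≈ᴹ-sym e j = ≈-sym (e j)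

  dot : Point → Point → 𝔽
  dot x y = sum (λ j → x j ⊗ y j)

  dot-cong : ∀ {x x′ y y′} → x ≈ᴹ x′ → y ≈ᴹ y′ → dot x y ≈ dot x′ y′
  dot-cong ex ey = Σ.sum-cong-≋ (λ j → ⊗-cong (ex j) (ey j))

  dot-congˡ : ∀ {x x′ y} → x ≈ᴹ x′ → dot x y ≈ dot x′ y
  dot-congˡ e = dot-cong e (λ _ → ≈-refl)

  dot-comm : ∀ x y → dot x y ≈ dot y x
  dot-comm x y = Σ.sum-cong-≋ (λ j → ⊗-comm (x j) (y j))

  dot-+ˡ : ∀ x y z → dot (x +ᴹ y) z ≈ dot x z ⊕ dot y z
  dot-+ˡ x y z = ≈-trans (Σ.sum-cong-≋ (λ j → CommutativeRing.distribʳ R (z j) (x j) (y j)))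
                         (Σ.∑-distrib-+ (λ j → x j ⊗ z j) (λ j → y j ⊗ z j))

  dot-*ˡ : ∀ a x z → dot (a *ₗ x) z ≈ a ⊗ dot x z
  dot-*ˡ a x z = ≈-trans (Σ.sum-cong-≋ (λ j → CommutativeRing.*-assoc R a (x j) (z j)))
                         (≈-sym (Σ*.*-distribˡ-sum a (λ j → x j ⊗ z j)))

  dot-0ˡ : ∀ z → dot 0ᴹ z ≈ 0#
  dot-0ˡ z = ≈-trans (Σ.sum-cong-≋ (λ j → ⊗-zeroˡ (z j))) (Σ.sum-replicate-zero d)

  dot-negˡ : ∀ x z → dot (-ᴹ x) z ≈ ⊝ dot x z
  dot-negˡ x z = begin
    dot (-ᴹ x) z
      ≈⟨ solve 2 (λ a b → b := (a :+ b) :+ :- a) ≈-refl (dot x z) (dot (-ᴹ x) z) ⟩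
    (dot x z ⊕ dot (-ᴹ x) z) ⊕ ⊝ dot x z      ≈⟨ ⊕-congʳ (dot-+ˡ x (-ᴹ x) z) ⟨
    dot (x -ᴹ x) z ⊕ ⊝ dot x z                ≈⟨ ⊕-congʳ (≈-trans (dot-congˡ (λ j → ⊝-inverseʳ (x j))) (dot-0ˡ z)) ⟩
    0# ⊕ ⊝ dot x z                            ≈⟨ ⊕-identityˡ _ ⟩
    ⊝ dot x z                                 ∎
    where open ≈-Reasoning

  dot--ˡ : ∀ x y z → dot (x -ᴹ y) z ≈ dot x z ⊕ ⊝ dot y z
  dot--ˡ x y z = ≈-trans (dot-+ˡ x (-ᴹ y) z) (⊕-congˡ (dot-negˡ y z))

  dot-line : ∀ x s w z → dot (x +ᴹ s *ₗ w) z ≈ dot x z ⊕ s ⊗ dot w z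
  dot-line x s w z = ≈-trans (dot-+ˡ x (s *ₗ w) z) (⊕-congˡ (dot-*ˡ s w z))

  dot-+ʳ : ∀ x y z → dot x (y +ᴹ z) ≈ dot x y ⊕ dot x z
  dot-+ʳ x y z = ≈-trans (dot-comm x (y +ᴹ z)) (≈-trans (dot-+ˡ y z x) (⊕-cong (dot-comm y x) (dot-comm z x)))

  dot--ʳ : ∀ x y z → dot x (y -ᴹ z) ≈ dot x y ⊕ ⊝ dot x z
  dot--ʳ x y z = ≈-trans (dot-comm x (y -ᴹ z)) (≈-trans (dot--ˡ y z x) (⊕-cong (dot-comm y x) (⊝-cong (dot-comm z x))))

  dot-*ʳ : ∀ a x z → dot x (a *ₗ z) ≈ a ⊗ dot x z
  dot-*ʳ a x z = ≈-trans (dot-comm x (a *ₗ z)) (≈-trans (dot-*ˡ a z x) (⊗-congˡ (dot-comm z x)))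

  dot-sumʳ : ∀ {k} u (f : Vector Point k) → dot u (sumᴹ f) ≈ sum (λ i → dot u (f i))
  dot-sumʳ {zero}  u f = ≈-trans (dot-comm u 0ᴹ) (dot-0ˡ u)
  dot-sumʳ {suc k} u f = ≈-trans (dot-+ʳ u (f zero) (sumᴹ (f ∘ suc))) (⊕-congˡ (dot-sumʳ u (f ∘ suc)))

  ‖‖-cong : ∀ {x y} → x ≈ᴹ y → ‖ x ‖ ≈ ‖ y ‖
  ‖‖-cong e = dot-cong e e

  ‖‖-+ : ∀ x y → ‖ x +ᴹ y ‖ ≈ ‖ x ‖ ⊕ ‖ y ‖ ⊕ (dot x y ⊕ dot x y)
  ‖‖-+ x y = begin
    dot (x +ᴹ y) (x +ᴹ y)                                ≈⟨ dot-+ˡ x y (x +ᴹ y) ⟩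
    dot x (x +ᴹ y) ⊕ dot y (x +ᴹ y)
      ≈⟨ ⊕-cong (dot-+ʳ x x y) (≈-trans (dot-+ʳ y x y) (⊕-congʳ (dot-comm y x))) ⟩
    (dot x x ⊕ dot x y) ⊕ (dot x y ⊕ dot y y)
      ≈⟨ solve 3 (λ a b c → (a :+ c) :+ (c :+ b) := a :+ b :+ (c :+ c)) ≈-refl _ _ _ ⟩
    ‖ x ‖ ⊕ ‖ y ‖ ⊕ (dot x y ⊕ dot x y)                  ∎
    where open ≈-Reasoning

  ‖‖-- : ∀ x y → ‖ x -ᴹ y ‖ ≈ ‖ x ‖ ⊕ ‖ y ‖ ⊕ ⊝ (dot x y ⊕ dot x y)
  ‖‖-- x y = begin
    dot (x -ᴹ y) (x -ᴹ y)                                  ≈⟨ dot--ˡ x y (x -ᴹ y) ⟩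
    dot x (x -ᴹ y) ⊕ ⊝ dot y (x -ᴹ y)
      ≈⟨ ⊕-cong (dot--ʳ x x y) (⊝-cong (≈-trans (dot--ʳ y x y) (⊕-congʳ (dot-comm y x)))) ⟩
    (dot x x ⊕ ⊝ dot x y) ⊕ ⊝ (dot x y ⊕ ⊝ dot y y)
      ≈⟨ solve 3 (λ a b c → (a :+ :- c) :+ :- (c :+ :- b) := a :+ b :+ :- (c :+ c)) ≈-refl _ _ _ ⟩
    ‖ x ‖ ⊕ ‖ y ‖ ⊕ ⊝ (dot x y ⊕ dot x y)                  ∎
    where open ≈-Reasoning

  ‖‖-line : ∀ x s w → ‖ x +ᴹ s *ₗ w ‖ ≈ ‖ w ‖ ⊗ s ⊗ s ⊕ (dot x w ⊕ dot x w) ⊗ s ⊕ ‖ x ‖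
  ‖‖-line x s w = begin
    ‖ x +ᴹ s *ₗ w ‖                                                            ≈⟨ ‖‖-+ x (s *ₗ w) ⟩
    ‖ x ‖ ⊕ ‖ s *ₗ w ‖ ⊕ (dot x (s *ₗ w) ⊕ dot x (s *ₗ w))
      ≈⟨ ⊕-cong (⊕-congˡ (≈-trans (dot-*ˡ s w _) (⊗-congˡ (dot-*ʳ s w w)))) (⊕-cong (dot-*ʳ s x w) (dot-*ʳ s x w)) ⟩
    ‖ x ‖ ⊕ s ⊗ (s ⊗ ‖ w ‖) ⊕ (s ⊗ dot x w ⊕ s ⊗ dot x w)
      ≈⟨ solve 4 (λ x s w c → x :+ s :* (s :* w) :+ (s :* c :+ s :* c) := w :* s :* s :+ (c :+ c) :* s :+ x) ≈-refl _ s _ _ ⟩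
    ‖ w ‖ ⊗ s ⊗ s ⊕ (dot x w ⊕ dot x w) ⊗ s ⊕ ‖ x ‖                            ∎
    where open ≈-Reasoning

  -- The unit vector at the first nonzero coordinate of n serves as w. The form is thus
  -- nondegenerate on the whole space, although nonzero vectors may have norm 0.
  nonzero⇒dot≉0 : ∀ n → ¬ n ≈ᴹ 0ᴹ → ∃[ w ] ¬ dot n w ≈ 0#
  nonzero⇒dot≉0 = go
    where
    go : ∀ {k} (n : Vector 𝔽 k) → ¬ (∀ j → n j ≈ 0#) → ∃[ w ] ¬ sum (λ j → n j ⊗ w j) ≈ 0#
    go {zero}  n n≉0 = ⊥-elim (n≉0 λ ())
    go {suc k} n n≉0 with n zero ≟ 0#
    ... | no n₀≉0 = (1# Vector.∷ λ _ → 0#) , λ e → n₀≉0 (begin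
      n zero                                              ≈⟨ ⊕-identityʳ _ ⟨
      n zero ⊕ 0#
        ≈⟨ ⊕-cong (⊗-identityʳ _) (≈-trans (Σ.sum-cong-≋ (λ j → ⊗-zeroʳ (n (suc j)))) (Σ.sum-replicate-zero k)) ⟨
      n zero ⊗ 1# ⊕ sum (λ j → n (suc j) ⊗ 0#)            ≈⟨ e ⟩
      0#                                                  ∎)
      where open ≈-Reasoning
    ... | yes n₀≈0 with w , nz ← go (n ∘ suc) (λ rest → n≉0 λ { zero → n₀≈0 ; (suc j) → rest j }) =
      (0# Vector.∷ w) , λ e → nz (≈-trans (≈-sym (≈-trans (⊕-congʳ (⊗-zeroʳ (n zero))) (⊕-identityˡ _))) e)

  -- Every point lies on exactly q of the parametrised lines s ↦ x + s w.
  ∑-lines : (f : Point → ℕ) → (∀ {x y} → x ≈ᴹ y → f x ≡ f y) → ∀ w →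
    q ℕ.* ∑ points f ≡ ∑[ x ∈ points ] ∑[ s ∈ scalars ] f (x +ᴹ s *ₗ w)
  ∑-lines f f-cong w = begin-equality
    q ℕ.* ∑ points f                                          ≡⟨ ≡.cong (ℕ._* ∑ points f) size-𝔽 ⟨
    𝔽ₛ.size ℕ.* ∑ points f                                    ≡⟨ ∑-const scalars (∑ points f) ⟨
    ∑[ _ ∈ scalars ] ∑ points f                               ≡⟨ ∑-cong scalars (λ s → ≡.sym (Pointₛ.∑-bijection f f-cong
                                                                   (λ x → x +ᴹ s *ₗ w) (λ x → x -ᴹ s *ₗ w)
                                                                   (λ x y e j → ≈-sym (≈-trans (⊕-congʳ (e j)) (cancel₁ (y j) (s ⊗ w j))))
                                                                   (λ x y e j → ≈-sym (≈-trans (⊕-congʳ (e j)) (cancel₂ (x j) (s ⊗ w j)))))) ⟩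
    ∑[ s ∈ scalars ] ∑[ x ∈ points ] f (x +ᴹ s *ₗ w)          ≡⟨ ∑-swap scalars points _ ⟩
    ∑[ x ∈ points ] ∑[ s ∈ scalars ] f (x +ᴹ s *ₗ w)          ∎
    where
    open ℕ.≤-Reasoning
    cancel₁ : ∀ a b → (a ⊕ b) ⊕ ⊝ b ≈ a
    cancel₁ = solve 2 (λ a b → (a :+ b) :+ :- b := a) ≈-refl
    cancel₂ : ∀ a b → (a ⊕ ⊝ b) ⊕ b ≈ a
    cancel₂ = solve 2 (λ a b → (a :+ :- b) :+ b := a) ≈-refl

  -- Lines in a direction w with n · w nonzero meet the hyperplane at most once. The factor q on the
  -- left avoids the exponent d - 1.
  hyperplane-≤ : ∀ n c → ¬ n ≈ᴹ 0ᴹ → q ℕ.* (∑[ x ∈ points ] 𝟙 (dot n x ⊕ c ≟ 0#)) ≤ q ℕ.^ d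
  hyperplane-≤ n c n≉0 with w , nw≉0 ← nonzero⇒dot≉0 n n≉0 = begin
    q ℕ.* (∑[ x ∈ points ] 𝟙 (dot n x ⊕ c ≟ 0#))
      ≡⟨ ∑-lines _ (λ e → 𝟙-cong (_ ≟ 0#) (_ ≟ 0#) (≈-trans (⊕-congʳ (dot-cong (λ _ → ≈-refl) (≈ᴹ-sym e)))) (≈-trans (⊕-congʳ (dot-cong (λ _ → ≈-refl) e)))) w ⟩
    ∑[ x ∈ points ] ∑[ s ∈ scalars ] 𝟙 (dot n (x +ᴹ s *ₗ w) ⊕ c ≟ 0#)        ≤⟨ ∑-mono points (λ x → ℕ.≤-trans
                                                                                  (∑-mono scalars (λ s → 𝟙-mono (_ ≟ 0#) (_ ≟ 0#) (≈-trans (linear x s))))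
                                                                                  (linear-roots-≤1 {dot n w} {dot n x ⊕ c} nw≉0)) ⟩
    ∑[ _ ∈ points ] 1                                                        ≡⟨ ≡.trans (∑-one points) size-Point ⟩
    q ℕ.^ d                                                                  ∎
    where
    open ℕ.≤-Reasoning
    linear : ∀ x s → dot n w ⊗ s ⊕ (dot n x ⊕ c) ≈ dot n (x +ᴹ s *ₗ w) ⊕ c
    linear x s = ≈-sym (≈-trans (⊕-congʳ (≈-trans (dot-+ʳ n x (s *ₗ w)) (⊕-congˡ (dot-*ʳ s n w))))
      (solve 4 (λ a s b c → a :+ s :* b :+ c := b :* s :+ (a :+ c)) ≈-refl (dot n x) s (dot n w) c))

  Annihilates : ∀ {k} → Vector Point k → Point → Set
  Annihilates v u = ∀ i → dot u (v i) ≈ 0#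

  annihilates? : ∀ {k} (v : Vector Point k) u → Dec (Annihilates v u)
  annihilates? v u = Fin.all? (λ i → dot u (v i) ≟ 0#)

  annihilates-resp : ∀ {k} (v : Vector Point k) {u u′} → u ≈ᴹ u′ → Annihilates v u → Annihilates v u′
  annihilates-resp v e a i = ≈-trans (dot-congˡ (≈ᴹ-sym e)) (a i)

  ∣Ann_∣ : ∀ {k} → Vector Point k → ℕ
  ∣Ann v ∣ = ∑[ u ∈ points ] 𝟙 (annihilates? v u)

  -- Linear independence with the explicit witnesses that triangular elimination would produce.
  Triangular : ∀ {k} → Vector Point k → Set
  Triangular {zero}  v = ⊤
  Triangular {suc k} v = (∃[ u ] Annihilates (v ∘ suc) u × ¬ dot u (v zero) ≈ 0#) × Triangular (v ∘ suc)

  -- Pairing a linear relation with u kills all terms but the first, so the leading coefficient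
  -- vanishes and a relation among the remaining vectors is left.
  triangular⇒independent : ∀ {k} (v : Vector Point k) → Triangular v → LinearlyIndependent v
  triangular⇒independent {suc k} v ((u , u-ann , u≉0) , tri) a Σav≈0 = λ
    { zero    → a₀≈0
    ; (suc i) → triangular⇒independent (v ∘ suc) tri (a ∘ suc) tail≈0 i }
    where
    open ≈-Reasoning
    rest : Point
    rest = sumᴹ (λ i → a (suc i) *ₗ v (suc i))
    a₀≈0 : a zero ≈ 0#
    a₀≈0 = x*y≈0⇒y≈0 u≉0 (begin
      dot u (v zero) ⊗ a zero                           ≈⟨ ⊗-comm _ _ ⟩
      a zero ⊗ dot u (v zero)                           ≈⟨ dot-*ʳ (a zero) u (v zero) ⟨
      dot u (a zero *ₗ v zero)                          ≈⟨ ⊕-identityʳ _ ⟨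
      dot u (a zero *ₗ v zero) ⊕ 0#                     ≈⟨ ⊕-congˡ (≈-trans (dot-sumʳ u (λ i → a (suc i) *ₗ v (suc i)))
                                                             (≈-trans (Σ.sum-cong-≋ (λ i → ≈-trans (dot-*ʳ (a (suc i)) u (v (suc i))) (≈-trans (⊗-congˡ (u-ann i)) (⊗-zeroʳ _)))) (Σ.sum-replicate-zero k))) ⟨
      dot u (a zero *ₗ v zero) ⊕ dot u rest             ≈⟨ dot-+ʳ u (a zero *ₗ v zero) rest ⟨
      dot u (a zero *ₗ v zero +ᴹ rest)
        ≈⟨ ≈-trans (dot-cong {u} (λ _ → ≈-refl) Σav≈0) (≈-trans (dot-comm u 0ᴹ) (dot-0ˡ u)) ⟩
      0#                                                ∎)
    tail≈0 : rest ≈ᴹ 0ᴹ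
    tail≈0 j = begin
      rest j                              ≈⟨ ⊕-identityˡ _ ⟨
      0# ⊕ rest j                         ≈⟨ ⊕-congʳ (≈-trans (⊗-congʳ a₀≈0) (⊗-zeroˡ _)) ⟨
      a zero ⊗ v zero j ⊕ rest j          ≈⟨ Σav≈0 j ⟩
      0#                                  ∎

  -- Each further vector divides the size of the annihilator by exactly q: every line in direction w
  -- inside the annihilator of the tail meets the smaller annihilator once, because w annihilates
  -- the tail but not the head. The product form of ∣Ann v∣ = q^(d-k) avoids subtraction.
  ∣Ann∣-triangular : ∀ {k} (v : Vector Point k) → Triangular v → q ℕ.^ k ℕ.* ∣Ann v ∣ ≡ q ℕ.^ d
  ∣Ann∣-triangular {zero}  v _ = ≡.trans (ℕ.*-identityˡ _)
    (≡.trans (∑-cong points (λ u → 𝟙-true (annihilates? v u) (λ ()))) (≡.trans (∑-one points) size-Point))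
  ∣Ann∣-triangular {suc k} v ((w , w-ann , w≉0) , tri) = begin-equality
    q ℕ.* q ℕ.^ k ℕ.* ∣Ann v ∣
      ≡⟨ ≡.cong (ℕ._* ∣Ann v ∣) (ℕ.*-comm q (q ℕ.^ k)) ⟩
    q ℕ.^ k ℕ.* q ℕ.* ∣Ann v ∣                                            ≡⟨ ℕ.*-assoc (q ℕ.^ k) q ∣Ann v ∣ ⟩
    q ℕ.^ k ℕ.* (q ℕ.* ∣Ann v ∣)                                          ≡⟨ ≡.cong (q ℕ.^ k ℕ.*_) (≡.trans
                                                                               (∑-lines _ (λ e → 𝟙-cong (annihilates? v _) (annihilates? v _) (annihilates-resp v e) (annihilates-resp v (≈ᴹ-sym e))) w)
                                                                               (∑-cong points line)) ⟩
    q ℕ.^ k ℕ.* ∣Ann v ∘ suc ∣                                            ≡⟨ ∣Ann∣-triangular (v ∘ suc) tri ⟩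
    q ℕ.^ d                                                               ∎
    where
    open ℕ.≤-Reasoning
    along : ∀ x s i → dot (x +ᴹ s *ₗ w) (v (suc i)) ≈ dot x (v (suc i))
    along x s i = ≈-trans (dot-line x s w _) (≈-trans (⊕-congˡ (≈-trans (⊗-congˡ (w-ann i)) (⊗-zeroʳ s))) (⊕-identityʳ _))
    head-line : ∀ x s → dot (x +ᴹ s *ₗ w) (v zero) ≈ dot w (v zero) ⊗ s ⊕ dot x (v zero)
    head-line x s = ≈-trans (dot-line x s w _) (solve 3 (λ a s b → a :+ s :* b := b :* s :+ a) ≈-refl _ s _)
    line : ∀ x → ∑[ s ∈ scalars ] 𝟙 (annihilates? v (x +ᴹ s *ₗ w)) ≡ 𝟙 (annihilates? (v ∘ suc) x)
    line x with annihilates? (v ∘ suc) x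
    ... | no ¬ann = ≡.trans (∑-cong scalars (λ s → 𝟙-false (annihilates? v _) (λ ann → ¬ann (λ i → ≈-trans (≈-sym (along x s i)) (ann (suc i)))))) (∑-zero scalars)
    ... | yes ann = ≡.trans (∑-cong scalars (λ s → 𝟙-cong (annihilates? v _) (dot w (v zero) ⊗ s ⊕ dot x (v zero) ≟ 0#)
        (λ a → ≈-trans (≈-sym (head-line x s)) (a zero))
        (λ e → λ { zero → ≈-trans (head-line x s) e ; (suc i) → ≈-trans (along x s i) (ann i) })))
      (linear-roots-≡1 {dot w (v zero)} {dot x (v zero)} w≉0)

primePower>1 : ∀ {q} → OddPrimePower q → 1 < q
primePower>1 (p , n , p-prime , _ , 1≤n , ≡.refl) = begin-strict
  1          <⟨ ℕ.nonTrivial⇒n>1 p {{prime⇒nonTrivial p-prime}} ⟩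
  p          ≡⟨ ℕ.*-identityʳ p ⟨
  p ℕ.^ 1    ≤⟨ ℕ.^-monoʳ-≤ p {{ℕ.>-nonZero (ℕ.<-trans ℕ.z<s (ℕ.nonTrivial⇒n>1 p {{prime⇒nonTrivial p-prime}}))}} 1≤n ⟩
  p ℕ.^ n    ∎
  where open ℕ.≤-Reasoning

-- Points with prescribed distances to a partial simplex

module Fibres (F : HeytingField 0ℓ 0ℓ 0ℓ) {q : ℕ} (q-odd : OddPrimePower q)
  (card : HasCardinality (HeytingField._≈_ F) q) (d : ℕ) where

  open Space F q-odd card d public
  open 𝔽-Solver using (solve; _:=_; _:+_; _:*_; :-_)

  -- The norms of the four points cancel on the right and leave inner products only. The inner
  -- product on the left is doubled so that nothing has to be divided by 2.
  polarisation : ∀ x y z c → dot (y -ᴹ z) (c -ᴹ x) ⊕ dot (y -ᴹ z) (c -ᴹ x)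
    ≈ (‖ y -ᴹ x ‖ ⊕ ⊝ ‖ z -ᴹ x ‖) ⊕ ⊝ (‖ y -ᴹ c ‖ ⊕ ⊝ ‖ z -ᴹ c ‖)
  polarisation x y z c = begin
    dot (y -ᴹ z) (c -ᴹ x) ⊕ dot (y -ᴹ z) (c -ᴹ x)
      ≈⟨ ⊕-cong expand expand ⟩
    D ⊕ D
      ≈⟨ solve 8 (λ X Y Z C yx yc zx zc →
           ((yc :+ :- zc) :+ :- (yx :+ :- zx)) :+ ((yc :+ :- zc) :+ :- (yx :+ :- zx)) :=
           ((Y :+ X :+ :- (yx :+ yx)) :+ :- (Z :+ X :+ :- (zx :+ zx))) :+ :- ((Y :+ C :+ :- (yc :+ yc)) :+ :- (Z :+ C :+ :- (zc :+ zc))))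
           ≈-refl (‖ x ‖) (‖ y ‖) (‖ z ‖) (‖ c ‖) (dot y x) (dot y c) (dot z x) (dot z c) ⟩
    _
      ≈⟨ ⊕-cong (⊕-cong (‖‖-- y x) (⊝-cong (‖‖-- z x))) (⊝-cong (⊕-cong (‖‖-- y c) (⊝-cong (‖‖-- z c)))) ⟨
    (‖ y -ᴹ x ‖ ⊕ ⊝ ‖ z -ᴹ x ‖) ⊕ ⊝ (‖ y -ᴹ c ‖ ⊕ ⊝ ‖ z -ᴹ c ‖) ∎
    where
    open ≈-Reasoning
    D : 𝔽
    D = (dot y c ⊕ ⊝ dot z c) ⊕ ⊝ (dot y x ⊕ ⊝ dot z x)
    expand : dot (y -ᴹ z) (c -ᴹ x) ≈ D
    expand = ≈-trans (dot--ʳ (y -ᴹ z) c x) (⊕-cong (dot--ˡ y z c) (⊝-cong (dot--ˡ y z x)))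

  halve : ∀ {x y} → x ⊕ x ≈ y ⊕ y → x ≈ y
  halve {x} {y} e = x-y≈0⇒x≈y (x+x≈0⇒x≈0 (≈-trans
    (solve 2 (λ x y → (x :+ :- y) :+ (x :+ :- y) := (x :+ x) :+ :- (y :+ y)) ≈-refl x y) (x≈y⇒x-y≈0 e)))

  SameDistances : ∀ {k} → Vector Point k → Point → Point → Set
  SameDistances V y z = ∀ i → ‖ y -ᴹ V i ‖ ≈ ‖ z -ᴹ V i ‖

  sameDistances? : ∀ {k} (V : Vector Point k) y z → Dec (SameDistances V y z)
  sameDistances? V y z = Fin.all? (λ i → ‖ y -ᴹ V i ‖ ≟ ‖ z -ᴹ V i ‖)

  from : ∀ {k} → Point → Vector Point k → Vector Point k
  from x₀ c i = c i -ᴹ x₀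

  -- Equal distances to x₀ and to `c i` make both brackets of `polarisation` vanish. The fibre of z
  -- thus lies in the translate of the annihilator through z.
  sameDistances⇒annihilates : ∀ {k} x₀ (c : Vector Point k) {y z} →
    SameDistances (x₀ Vector.∷ c) y z → Annihilates (from x₀ c) (y -ᴹ z)
  sameDistances⇒annihilates x₀ c {y} {z} same i = x+x≈0⇒x≈0 (begin
    dot (y -ᴹ z) (c i -ᴹ x₀) ⊕ dot (y -ᴹ z) (c i -ᴹ x₀)                                  ≈⟨ polarisation x₀ y z (c i) ⟩
    (‖ y -ᴹ x₀ ‖ ⊕ ⊝ ‖ z -ᴹ x₀ ‖) ⊕ ⊝ (‖ y -ᴹ c i ‖ ⊕ ⊝ ‖ z -ᴹ c i ‖)
      ≈⟨ x≈y⇒x-y≈0 (≈-trans (x≈y⇒x-y≈0 (same zero)) (≈-sym (x≈y⇒x-y≈0 (same (suc i))))) ⟩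
    0#                                                                                   ∎)
    where open ≈-Reasoning

  annihilates-sub : ∀ {k} {v : Vector Point k} {u s w} → Annihilates v w → Annihilates v (u +ᴹ s *ₗ w) → Annihilates v u
  annihilates-sub {v = v} {u} {s} {w} w-ann a i = begin
    dot u (v i)                         ≈⟨ ⊕-identityʳ _ ⟨
    dot u (v i) ⊕ 0#                    ≈⟨ ⊕-congˡ (≈-trans (⊗-congˡ (w-ann i)) (⊗-zeroʳ s)) ⟨
    dot u (v i) ⊕ s ⊗ dot w (v i)       ≈⟨ dot-line u s w (v i) ⟨
    dot (u +ᴹ s *ₗ w) (v i)             ≈⟨ a i ⟩
    0#                                  ∎
    where open ≈-Reasoning

  annihilates-+ : ∀ {k} {v : Vector Point k} {u w} → Annihilates v u → Annihilates v w → Annihilates v (u +ᴹ w)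
  annihilates-+ {v = v} {u} {w} u-ann w-ann i =
    ≈-trans (dot-+ˡ u w (v i)) (≈-trans (⊕-cong (u-ann i) (w-ann i)) (⊕-identityˡ 0#))

  ∣Ann∣-translate : ∀ {k} (v : Vector Point k) z → ∑[ y ∈ points ] 𝟙 (annihilates? v (y -ᴹ z)) ≡ ∣Ann v ∣
  ∣Ann∣-translate v z = Pointₛ.∑-bijection (λ u → 𝟙 (annihilates? v u))
    (λ e → 𝟙-cong (annihilates? v _) (annihilates? v _) (annihilates-resp v e) (annihilates-resp v (≈ᴹ-sym e)))
    (_-ᴹ z) (_+ᴹ z)
    (λ x y e j → ≈-trans (solve 2 (λ y z → y := (y :+ :- z) :+ z) ≈-refl (y j) (z j)) (⊕-congʳ (≈-sym (e j))))
    (λ x y e j → ≈-trans (solve 2 (λ y z → y := (y :+ z) :+ :- z) ≈-refl (x j) (z j)) (⊕-congʳ (≈-sym (e j))))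

  module _ {k} (x₀ : Point) (c : Vector Point k) (z : Point) where

    private
      V : Vector Point (suc k)
      V = x₀ Vector.∷ c
      v : Vector Point k
      v = from x₀ c

    -- Along a line only the sphere around x₀ is used; the distances to the points of c are spent on
    -- confining the fibre to the translate of the annihilator.
    sphere-equation : ∀ y s w → SameDistances V (y +ᴹ s *ₗ w) z →
      ‖ w ‖ ⊗ s ⊗ s ⊕ (dot (y -ᴹ x₀) w ⊕ dot (y -ᴹ x₀) w) ⊗ s ⊕ (‖ y -ᴹ x₀ ‖ ⊕ ⊝ ‖ z -ᴹ x₀ ‖) ≈ 0#
    sphere-equation y s w same = begin
      _
        ≈⟨ CommutativeRing.+-assoc R _ _ _ ⟨
      ‖ w ‖ ⊗ s ⊗ s ⊕ (dot (y -ᴹ x₀) w ⊕ dot (y -ᴹ x₀) w) ⊗ s ⊕ ‖ y -ᴹ x₀ ‖ ⊕ ⊝ ‖ z -ᴹ x₀ ‖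
        ≈⟨ ⊕-congʳ (‖‖-line (y -ᴹ x₀) s w) ⟨
      ‖ (y -ᴹ x₀) +ᴹ s *ₗ w ‖ ⊕ ⊝ ‖ z -ᴹ x₀ ‖
        ≈⟨ ⊕-congʳ (‖‖-cong (λ j → solve 3 (λ y x t → (y :+ :- x) :+ t := (y :+ t) :+ :- x) ≈-refl (y j) (x₀ j) (s ⊗ w j))) ⟩
      ‖ (y +ᴹ s *ₗ w) -ᴹ x₀ ‖ ⊕ ⊝ ‖ z -ᴹ x₀ ‖                                            ≈⟨ x≈y⇒x-y≈0 (same zero) ⟩
      0#                                                                                ∎
      where
      open ≈-Reasoning

    -- Since w lies in the annihilator, a line in its direction either stays in the translate
    -- through z or misses it. In the first case the quadratic equation leaves at most two points of
    -- the fibre, in the second none.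
    fibre-along : ∀ w → Annihilates v w →
      (∀ y → Annihilates v (y -ᴹ z) → ¬ (‖ w ‖ ≈ 0# × dot (y -ᴹ x₀) w ⊕ dot (y -ᴹ x₀) w ≈ 0#)) →
      q ℕ.* (∑[ y ∈ points ] 𝟙 (sameDistances? V y z)) ≤ 2 ℕ.* ∣Ann v ∣
    fibre-along w w-ann nonconstant = begin
      q ℕ.* (∑[ y ∈ points ] 𝟙 (sameDistances? V y z))
        ≡⟨ ∑-lines _ (λ e → 𝟙-cong (sameDistances? V _ z) (sameDistances? V _ z) (resp e) (resp (≈ᴹ-sym e))) w ⟩
      ∑[ y ∈ points ] ∑[ s ∈ scalars ] 𝟙 (sameDistances? V (y +ᴹ s *ₗ w) z)     ≤⟨ ∑-mono points along ⟩
      ∑[ y ∈ points ] 2 ℕ.* 𝟙 (annihilates? v (y -ᴹ z))                         ≡⟨ ∑-*ˡ points 2 _ ⟩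
      2 ℕ.* (∑[ y ∈ points ] 𝟙 (annihilates? v (y -ᴹ z)))
        ≡⟨ ≡.cong (2 ℕ.*_) (∣Ann∣-translate v z) ⟩
      2 ℕ.* ∣Ann v ∣                                                            ∎
      where
      open ℕ.≤-Reasoning
      resp : ∀ {y y′} → y ≈ᴹ y′ → SameDistances V y z → SameDistances V y′ z
      resp e same i = ≈-trans (‖‖-cong (λ j → ⊕-congʳ (≈-sym (e j)))) (same i)
      along : ∀ y → ∑[ s ∈ scalars ] 𝟙 (sameDistances? V (y +ᴹ s *ₗ w) z) ≤ 2 ℕ.* 𝟙 (annihilates? v (y -ᴹ z))
      along y with annihilates? v (y -ᴹ z)
      ... | yes ann = ℕ.≤-trans (∑-mono scalars (λ s → 𝟙-mono (sameDistances? V _ z) (_ ≟ 0#) (sphere-equation y s w)))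
                                (quadratic-roots-≤2 (nonconstant y ann))
      ... | no ¬ann = ℕ.≤-reflexive (≡.trans (∑-cong scalars (λ s → 𝟙-false (sameDistances? V _ z) (λ same →
          ¬ann (annihilates-sub {u = y -ᴹ z} {s} w-ann (annihilates-resp v
            (λ j → solve 3 (λ y t z → (y :+ t) :+ :- z := (y :+ :- z) :+ t) ≈-refl (y j) (s ⊗ w j) (z j))
            (sameDistances⇒annihilates x₀ c same)))))) (∑-zero scalars))

    -- The fibre meets each line in an anisotropic direction w ∈ Ann v at most
    -- twice.  If Ann v is totally isotropic, then dot (y - x₀) u is constant,
    -- and not 0, on the fibre, which therefore meets each line in direction u at most once.
    fibre-≤ : ∀ u → Annihilates v u → ¬ dot u (z -ᴹ x₀) ≈ 0# →
      q ℕ.* (∑[ y ∈ points ] 𝟙 (sameDistances? V y z)) ≤ 2 ℕ.* ∣Ann v ∣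
    fibre-≤ u u-ann u≉0 with Pointₛ.∃? {P = λ w → Annihilates v w × ¬ ‖ w ‖ ≈ 0#} (λ w → annihilates? v w ×-dec ¬? (‖ w ‖ ≟ 0#))
      (λ e (a , n) → annihilates-resp v e a , λ n′ → n (≈-trans (‖‖-cong e) n′))
    ... | yes (w , w-ann , w≉0) = fibre-along w w-ann (λ y _ → w≉0 ∘ proj₁)
    ... | no ¬w = fibre-along u u-ann λ y ann (_ , e) → u≉0 (begin
        dot u (z -ᴹ x₀)                                  ≈⟨ dot-comm u (z -ᴹ x₀) ⟩
        dot (z -ᴹ x₀) u                                  ≈⟨ ⊕-identityˡ _ ⟨
        0# ⊕ dot (z -ᴹ x₀) u                             ≈⟨ ⊕-congʳ (orthogonal (y -ᴹ z) ann) ⟨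
        dot (y -ᴹ z) u ⊕ dot (z -ᴹ x₀) u                 ≈⟨ dot-+ˡ (y -ᴹ z) (z -ᴹ x₀) u ⟨
        dot ((y -ᴹ z) +ᴹ (z -ᴹ x₀)) u
          ≈⟨ dot-congˡ (λ j → solve 3 (λ y z x → (y :+ :- z) :+ (z :+ :- x) := y :+ :- x) ≈-refl (y j) (z j) (x₀ j)) ⟩
        dot (y -ᴹ x₀) u                                  ≈⟨ x+x≈0⇒x≈0 e ⟩
        0#                                               ∎)
      where
      open ≈-Reasoning
      isotropic : ∀ w → Annihilates v w → ‖ w ‖ ≈ 0#
      isotropic w a = decidable-stable (‖ w ‖ ≟ 0#) (λ n → ¬w (w , a , n))
      -- If the norm vanishes on a subspace, then ‖ t + u ‖ = 0 reads 2 (t · u) = 0 there, and 2 is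
      -- invertible.
      orthogonal : ∀ t → Annihilates v t → dot t u ≈ 0#
      orthogonal t t-ann = x+x≈0⇒x≈0 (begin
        dot t u ⊕ dot t u                          ≈⟨ ⊕-identityˡ _ ⟨
        0# ⊕ (dot t u ⊕ dot t u)
          ≈⟨ ⊕-congʳ (≈-trans (⊕-cong (isotropic t t-ann) (isotropic u u-ann)) (⊕-identityˡ 0#)) ⟨
        ‖ t ‖ ⊕ ‖ u ‖ ⊕ (dot t u ⊕ dot t u)        ≈⟨ ‖‖-+ t u ⟨
        ‖ t +ᴹ u ‖                                 ≈⟨ isotropic (t +ᴹ u) (annihilates-+ {u = t} t-ann u-ann) ⟩
        0#                                         ∎)

  abstract
    -- The annihilator has q^(d-k) > 1 elements, and the zero vector accounts for one of them only,
    -- so the two indicators differ somewhere. Since the definition is abstract, `extend` and the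
    -- lemmas about it share the same u without ever computing it.
    nonzero-annihilator : ∀ {k} → k < d → (v : Vector Point k) → Triangular v → ∃[ u ] Annihilates v u × ¬ u ≈ᴹ 0ᴹ
    nonzero-annihilator {k} k<d v tri = extract (∑-witness points (λ u → 𝟙 (u ≟ᴹ 0ᴹ)) (λ u → 𝟙 (annihilates? v u))
      (ℕ.≤-<-trans (ℕ.≤-reflexive (Pointₛ.once 0ᴹ)) (ℕ.≰⇒> λ ∣Ann∣≤1 → ℕ.<-irrefl ≡.refl (begin-strict
        q ℕ.^ k                <⟨ ℕ.^-monoʳ-< q (primePower>1 q-odd) k<d ⟩
        q ℕ.^ d                ≡⟨ ∣Ann∣-triangular v tri ⟨
        q ℕ.^ k ℕ.* ∣Ann v ∣   ≤⟨ ℕ.*-monoʳ-≤ (q ℕ.^ k) ∣Ann∣≤1 ⟩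
        q ℕ.^ k ℕ.* 1          ≡⟨ ℕ.*-identityʳ _ ⟩
        q ℕ.^ k                ∎))))
      where
      open ℕ.≤-Reasoning
      extract : ∃[ u ] 𝟙 (u ≟ᴹ 0ᴹ) < 𝟙 (annihilates? v u) → ∃[ u ] Annihilates v u × ¬ u ≈ᴹ 0ᴹ
      extract (u , lt) with u ≟ᴹ 0ᴹ | annihilates? v u
      ... | no u≉0 | yes ann = u , ann , u≉0
      extract (u , s≤s ()) | yes _ | yes _
      extract (u , ()) | _ | no _

-- Pinned distances and chains of points

-- Intended for `D` = q^d, `e` = ∣E∣ and `N k` chains of k points besides x₀. The exponent 1 of the
-- base and the exponents 2, ..., k + 1 of the later steps add up to the triangular number. Unlike
-- the case k = 0 of the step, the base costs no factor of density, so `N (suc k)` is bounded with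
-- `e` to the power k only.
growth : ∀ q e D {d} (N : ∀ k → k ≤ d → ℕ) → (∀ 0<d → q ≤ 8 ℕ.* N 1 0<d) →
  (∀ k k<d → q ℕ.^ suc k ℕ.* e ℕ.* N k (ℕ.<⇒≤ k<d) ≤ 4 ℕ.* D ℕ.* N (suc k) k<d) →
  ∀ k k<d → q ℕ.^ (suc (suc k) choose 2) ℕ.* e ℕ.^ k ≤ 8 ℕ.* 4 ℕ.^ k ℕ.* D ℕ.^ k ℕ.* N (suc k) k<d
growth q e D N base step zero 0<d = begin
  q ℕ.^ 1 ℕ.* 1             ≡⟨ ≡.trans (ℕ.*-identityʳ (q ℕ.^ 1)) (ℕ.*-identityʳ q) ⟩
  q                         ≤⟨ base 0<d ⟩
  8 ℕ.* N 1 0<d             ∎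
  where open ℕ.≤-Reasoning
growth q e D N base step (suc k) k<d = begin
  q ℕ.^ (suc (suc (suc k)) choose 2) ℕ.* (e ℕ.* e ℕ.^ k)
    ≡⟨ ≡.cong (λ n → q ℕ.^ n ℕ.* (e ℕ.* e ℕ.^ k)) triangle ⟩
  q ℕ.^ (suc (suc k) ℕ.+ T) ℕ.* (e ℕ.* e ℕ.^ k)
    ≡⟨ ≡.cong (ℕ._* (e ℕ.* e ℕ.^ k)) (ℕ.^-distribˡ-+-* q (suc (suc k)) T) ⟩
  Q ℕ.* q ℕ.^ T ℕ.* (e ℕ.* e ℕ.^ k)
    ≡⟨ solve 4 (λ a b c d → a :* b :* (c :* d) := a :* c :* (b :* d)) ≡.refl Q (q ℕ.^ T) e (e ℕ.^ k) ⟩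
  Q ℕ.* e ℕ.* (q ℕ.^ T ℕ.* e ℕ.^ k)
    ≤⟨ ℕ.*-monoʳ-≤ (Q ℕ.* e) (growth q e D N base step k (ℕ.<⇒≤ k<d)) ⟩
  Q ℕ.* e ℕ.* (8 ℕ.* 4 ℕ.^ k ℕ.* D ℕ.^ k ℕ.* M)
    ≡⟨ solve 4 (λ a b c d → a :* (con 8 :* b :* c :* d) := con 8 :* b :* c :* (a :* d)) ≡.refl (Q ℕ.* e) (4 ℕ.^ k) (D ℕ.^ k) M ⟩
  8 ℕ.* 4 ℕ.^ k ℕ.* D ℕ.^ k ℕ.* (Q ℕ.* e ℕ.* M)
    ≤⟨ ℕ.*-monoʳ-≤ (8 ℕ.* 4 ℕ.^ k ℕ.* D ℕ.^ k) (step (suc k) k<d) ⟩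
  8 ℕ.* 4 ℕ.^ k ℕ.* D ℕ.^ k ℕ.* (4 ℕ.* D ℕ.* M′)
    ≡⟨ solve 4 (λ a b c d → con 8 :* a :* b :* (con 4 :* c :* d) := con 8 :* (con 4 :* a) :* (c :* b) :* d) ≡.refl (4 ℕ.^ k) (D ℕ.^ k) D M′ ⟩
  8 ℕ.* (4 ℕ.* 4 ℕ.^ k) ℕ.* (D ℕ.* D ℕ.^ k) ℕ.* M′                ∎
  where
  open ℕ.≤-Reasoning
  open +-*-Solver using (solve; _:=_; _:*_; con)
  T Q M M′ : ℕ
  T = suc (suc k) choose 2
  Q = q ℕ.^ suc (suc k)
  M = N (suc k) (ℕ.<⇒≤ k<d)
  M′ = N (suc (suc k)) k<d
  triangle : suc (suc (suc k)) choose 2 ≡ suc (suc k) ℕ.+ T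
  triangle = ≡.trans (≡.sym (nCk+nC[k+1]≡[n+1]C[k+1] (suc (suc k)) 1)) (≡.cong (ℕ._+ T) (nC1≡n (suc (suc k))))

module Configurations (F : HeytingField 0ℓ 0ℓ 0ℓ) {q : ℕ} (q-odd : OddPrimePower q)
  (card : HasCardinality (HeytingField._≈_ F) q) (d : ℕ) where

  open Fibres F q-odd card d public

  Congruent : ∀ {k} → Vector Point k → Vector Point k → Set
  Congruent V W = ∀ i j → ‖ V i -ᴹ V j ‖ ≈ ‖ W i -ᴹ W j ‖

  -- The condition on x is affine with normal n = 2 (z - y), which is nonzero for y ≠ z because the
  -- characteristic is odd. The second term pays for y = z, where every x is equidistant.
  bisector-≤ : ∀ y z → q ℕ.* (∑[ x ∈ points ] 𝟙 (‖ y -ᴹ x ‖ ≟ ‖ z -ᴹ x ‖)) ≤ q ℕ.^ d ℕ.+ 𝟙 (y ≟ᴹ z) ℕ.* (q ℕ.* q ℕ.^ d)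
  bisector-≤ y z with y ≟ᴹ z
  ... | yes _ = begin
    q ℕ.* (∑[ x ∈ points ] 𝟙 (‖ y -ᴹ x ‖ ≟ ‖ z -ᴹ x ‖))    ≤⟨ ℕ.*-monoʳ-≤ q (∑-mono points (λ x → 𝟙≤1 (_ ≟ _))) ⟩
    q ℕ.* (∑[ _ ∈ points ] 1)                              ≡⟨ ≡.cong (q ℕ.*_) (≡.trans (∑-one points) size-Point) ⟩
    q ℕ.* q ℕ.^ d                                          ≡⟨ ℕ.*-identityˡ _ ⟨
    1 ℕ.* (q ℕ.* q ℕ.^ d)                                  ≤⟨ ℕ.m≤n+m _ (q ℕ.^ d) ⟩
    q ℕ.^ d ℕ.+ 1 ℕ.* (q ℕ.* q ℕ.^ d)                      ∎
    where open ℕ.≤-Reasoning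
  ... | no y≉z = ℕ.≤-trans (ℕ.≤-trans
      (ℕ.*-monoʳ-≤ q (∑-mono points (λ x → 𝟙-mono (‖ y -ᴹ x ‖ ≟ ‖ z -ᴹ x ‖) (dot n x ⊕ c ≟ 0#) (λ e → ≈-trans (on-hyperplane x) (x≈y⇒x-y≈0 e)))))
      (hyperplane-≤ n c (λ n≈0 → y≉z (λ j → ≈-sym (x-y≈0⇒x≈y (x+x≈0⇒x≈0 (n≈0 j)))))))
      (ℕ.m≤m+n (q ℕ.^ d) 0)
    where
    n : Point
    n = (z -ᴹ y) +ᴹ (z -ᴹ y)
    c : 𝔽
    c = ‖ y ‖ ⊕ ⊝ ‖ z ‖
    on-hyperplane : ∀ x → dot n x ⊕ c ≈ ‖ y -ᴹ x ‖ ⊕ ⊝ ‖ z -ᴹ x ‖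
    on-hyperplane x = begin
      dot n x ⊕ c
        ≈⟨ ⊕-congʳ (≈-trans (dot-+ˡ (z -ᴹ y) (z -ᴹ y) x) (⊕-cong (dot--ˡ z y x) (dot--ˡ z y x))) ⟩
      (dot z x ⊕ ⊝ dot y x) ⊕ (dot z x ⊕ ⊝ dot y x) ⊕ (‖ y ‖ ⊕ ⊝ ‖ z ‖)         ≈⟨ solve 5 (λ X Y Z yx zx → (zx :+ :- yx) :+ (zx :+ :- yx) :+ (Y :+ :- Z)
                                                                                     := (Y :+ X :+ :- (yx :+ yx)) :+ :- (Z :+ X :+ :- (zx :+ zx))) ≈-refl (‖ x ‖) (‖ y ‖) (‖ z ‖) (dot y x) (dot z x) ⟩
      (‖ y ‖ ⊕ ‖ x ‖ ⊕ ⊝ (dot y x ⊕ dot y x)) ⊕ ⊝ (‖ z ‖ ⊕ ‖ x ‖ ⊕ ⊝ (dot z x ⊕ dot z x))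
        ≈⟨ ⊕-cong (‖‖-- y x) (⊝-cong (‖‖-- z x)) ⟨
      ‖ y -ᴹ x ‖ ⊕ ⊝ ‖ z -ᴹ x ‖                                                 ∎
      where
      open ≈-Reasoning
      open 𝔽-Solver using (solve; _:=_; _:+_; _:*_; :-_)

  module PointSet {E : Pred Point 0ℓ} (E-resp : ∀ {x y} → x ≈ᴹ y → E x → E y) (E? : ∀ x → Dec (E x)) where

    es : List (∃ E)
    es = select E? points

    ∣E∣ : ℕ
    ∣E∣ = length es

    isosceles : Point → ℕ
    isosceles x = ∑[ y ∈ es ] ∑[ z ∈ es ] 𝟙 (‖ proj₁ y -ᴹ x ‖ ≟ ‖ proj₁ z -ᴹ x ‖)

    -- Cauchy-Schwarz over the q possible distances. It holds at points outside E too, and `pin`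
    -- uses it exactly there.
    isosceles-≥ : ∀ x → ∣E∣ ℕ.* ∣E∣ ≤ q ℕ.* isosceles x
    isosceles-≥ x = ≡.subst (λ m → ∣E∣ ℕ.* ∣E∣ ≤ m ℕ.* isosceles x) size-𝔽
      (square≤collisions es scalars (λ y t → 𝟙 (t ≟ ‖ proj₁ y -ᴹ x ‖)) (λ y z → 𝟙 (‖ proj₁ y -ᴹ x ‖ ≟ ‖ proj₁ z -ᴹ x ‖))
        (All.tabulate (λ {y} _ → ℕ.≤-reflexive (≡.sym (𝔽ₛ.once (‖ proj₁ y -ᴹ x ‖))))) same)
      where
      open ℕ.≤-Reasoning
      same : ∀ (y z : ∃ E) → ∑[ t ∈ scalars ] 𝟙 (t ≟ ‖ proj₁ y -ᴹ x ‖) ℕ.* 𝟙 (t ≟ ‖ proj₁ z -ᴹ x ‖) ≤ 𝟙 (‖ proj₁ y -ᴹ x ‖ ≟ ‖ proj₁ z -ᴹ x ‖)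
      same (y , _) (z , _) = begin
        ∑[ t ∈ scalars ] 𝟙 (t ≟ ‖ y -ᴹ x ‖) ℕ.* 𝟙 (t ≟ ‖ z -ᴹ x ‖)                   ≤⟨ ∑-mono scalars (λ t → 𝟙-*-≤ (t ≟ ‖ y -ᴹ x ‖) (λ e →
                                                                                          𝟙-mono (t ≟ ‖ z -ᴹ x ‖) (‖ y -ᴹ x ‖ ≟ ‖ z -ᴹ x ‖) (≈-trans (≈-sym e)))) ⟩
        ∑[ t ∈ scalars ] 𝟙 (t ≟ ‖ y -ᴹ x ‖) ℕ.* 𝟙 (‖ y -ᴹ x ‖ ≟ ‖ z -ᴹ x ‖)          ≡⟨ ∑-*ʳ scalars _ _ ⟩
        (∑[ t ∈ scalars ] 𝟙 (t ≟ ‖ y -ᴹ x ‖)) ℕ.* 𝟙 (‖ y -ᴹ x ‖ ≟ ‖ z -ᴹ x ‖)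
          ≡⟨ ≡.cong (ℕ._* 𝟙 (‖ y -ᴹ x ‖ ≟ ‖ z -ᴹ x ‖)) (𝔽ₛ.once (‖ y -ᴹ x ‖)) ⟩
        1 ℕ.* 𝟙 (‖ y -ᴹ x ‖ ≟ ‖ z -ᴹ x ‖)                                            ≡⟨ ℕ.*-identityˡ _ ⟩
        𝟙 (‖ y -ᴹ x ‖ ≟ ‖ z -ᴹ x ‖)                                                  ∎

    -- Exchanging the sums replaces isosceles pairs by sizes of bisectors; the last term comes from
    -- the diagonal pairs.
    isosceles-total : ∑[ x ∈ points ] q ℕ.* isosceles x ≤ ∣E∣ ℕ.* (∣E∣ ℕ.* q ℕ.^ d) ℕ.+ ∣E∣ ℕ.* (q ℕ.* q ℕ.^ d)
    isosceles-total = begin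
      ∑[ x ∈ points ] q ℕ.* isosceles x
        ≡⟨ ∑-*ˡ points q isosceles ⟩
      q ℕ.* (∑[ x ∈ points ] isosceles x)
        ≡⟨ ≡.cong (q ℕ.*_) (≡.trans (∑-swap points es _) (∑-cong es (λ y → ∑-swap points es _))) ⟩
      q ℕ.* (∑[ y ∈ es ] ∑[ z ∈ es ] ∑[ x ∈ points ] 𝟙 (‖ proj₁ y -ᴹ x ‖ ≟ ‖ proj₁ z -ᴹ x ‖))
        ≡⟨ ≡.trans (≡.sym (∑-*ˡ es q _)) (∑-cong es (λ y → ≡.sym (∑-*ˡ es q _))) ⟩
      ∑[ y ∈ es ] ∑[ z ∈ es ] q ℕ.* (∑[ x ∈ points ] 𝟙 (‖ proj₁ y -ᴹ x ‖ ≟ ‖ proj₁ z -ᴹ x ‖))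
        ≤⟨ ∑-mono es (λ y → ∑-mono es (λ z → bisector-≤ (proj₁ y) (proj₁ z))) ⟩
      ∑[ y ∈ es ] ∑[ z ∈ es ] (q ℕ.^ d ℕ.+ 𝟙 (proj₁ y ≟ᴹ proj₁ z) ℕ.* (q ℕ.* q ℕ.^ d))
        ≤⟨ ∑-mono es diagonal ⟩
      ∑[ y ∈ es ] (∣E∣ ℕ.* q ℕ.^ d ℕ.+ q ℕ.* q ℕ.^ d)
        ≡⟨ ∑-const es _ ⟩
      ∣E∣ ℕ.* (∣E∣ ℕ.* q ℕ.^ d ℕ.+ q ℕ.* q ℕ.^ d)
        ≡⟨ ℕ.*-distribˡ-+ ∣E∣ _ _ ⟩
      ∣E∣ ℕ.* (∣E∣ ℕ.* q ℕ.^ d) ℕ.+ ∣E∣ ℕ.* (q ℕ.* q ℕ.^ d) ∎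
      where
      open ℕ.≤-Reasoning
      once-in-E : ∀ y → ∑[ z ∈ es ] 𝟙 (y ≟ᴹ proj₁ z) ≤ 1
      once-in-E y = begin
        ∑[ z ∈ es ] 𝟙 (y ≟ᴹ proj₁ z)      ≤⟨ ∑-select-≤ E? points (λ z → 𝟙 (y ≟ᴹ z)) ⟩
        ∑[ z ∈ points ] 𝟙 (y ≟ᴹ z)        ≡⟨ ∑-cong points (λ z → 𝟙-cong (y ≟ᴹ z) (z ≟ᴹ y) ≈ᴹ-sym ≈ᴹ-sym) ⟩
        ∑[ z ∈ points ] 𝟙 (z ≟ᴹ y)        ≡⟨ Pointₛ.once y ⟩
        1                                 ∎
      diagonal : ∀ (y : ∃ E) → ∑[ z ∈ es ] (q ℕ.^ d ℕ.+ 𝟙 (proj₁ y ≟ᴹ proj₁ z) ℕ.* (q ℕ.* q ℕ.^ d)) ≤ ∣E∣ ℕ.* q ℕ.^ d ℕ.+ q ℕ.* q ℕ.^ d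
      diagonal (y , _) = begin
        ∑[ z ∈ es ] (q ℕ.^ d ℕ.+ 𝟙 (y ≟ᴹ proj₁ z) ℕ.* (q ℕ.* q ℕ.^ d))                          ≡⟨ ∑-+ es _ _ ⟩
        (∑[ _ ∈ es ] q ℕ.^ d) ℕ.+ (∑[ z ∈ es ] 𝟙 (y ≟ᴹ proj₁ z) ℕ.* (q ℕ.* q ℕ.^ d))
          ≡⟨ ≡.cong₂ ℕ._+_ (∑-const es _) (∑-*ʳ es _ _) ⟩
        ∣E∣ ℕ.* q ℕ.^ d ℕ.+ (∑[ z ∈ es ] 𝟙 (y ≟ᴹ proj₁ z)) ℕ.* (q ℕ.* q ℕ.^ d)
          ≤⟨ ℕ.+-monoʳ-≤ (∣E∣ ℕ.* q ℕ.^ d) (ℕ.*-monoˡ-≤ (q ℕ.* q ℕ.^ d) (once-in-E y)) ⟩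
        ∣E∣ ℕ.* q ℕ.^ d ℕ.+ 1 ℕ.* (q ℕ.* q ℕ.^ d)
          ≡⟨ ≡.cong (∣E∣ ℕ.* q ℕ.^ d ℕ.+_) (ℕ.*-identityˡ _) ⟩
        ∣E∣ ℕ.* q ℕ.^ d ℕ.+ q ℕ.* q ℕ.^ d                                                       ∎

    -- On average over all of 𝔽ᵈ, isosceles exceeds its minimum ∣E∣²/q by at most ∣E∣;
    -- so it cannot be large at every point of E.
    pin : 0 < ∣E∣ → q ℕ.* q ℕ.^ d ≤ ∣E∣ ℕ.* ∣E∣ → ∃[ x ] E x × q ℕ.* isosceles x ≤ 2 ℕ.* (∣E∣ ℕ.* ∣E∣)
    pin 0<e large = extract (∑-witness points (λ x → q ℕ.* isosceles x) bound (begin-strict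
      ∑[ x ∈ points ] q ℕ.* isosceles x                                ≤⟨ isosceles-total ⟩
      e ℕ.* (e ℕ.* q ℕ.^ d) ℕ.+ e ℕ.* (q ℕ.* q ℕ.^ d)
        ≤⟨ ℕ.+-monoʳ-≤ (e ℕ.* (e ℕ.* q ℕ.^ d)) (ℕ.*-monoʳ-≤ e large) ⟩
      e ℕ.* (e ℕ.* q ℕ.^ d) ℕ.+ e ℕ.* (e ℕ.* e)
        <⟨ ℕ.+-monoʳ-< (e ℕ.* (e ℕ.* q ℕ.^ d)) (ℕ.*-monoʳ-< e {{ℕ.>-nonZero 0<e}} (ℕ.n<1+n (e ℕ.* e))) ⟩
      e ℕ.* (e ℕ.* q ℕ.^ d) ℕ.+ e ℕ.* suc (e ℕ.* e)                    ≡⟨ ≡.cong₂ ℕ._+_ all-points in-E ⟨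
      (∑[ _ ∈ points ] e ℕ.* e) ℕ.+ (∑[ x ∈ points ] 𝟙 (E? x) ℕ.* suc (e ℕ.* e))   ≡⟨ ∑-+ points _ _ ⟨
      ∑ points bound                                                   ∎))
      where
      open ℕ.≤-Reasoning
      e = ∣E∣
      -- Outside E this is the Cauchy-Schwarz minimum, below which `isosceles` never falls, so a
      -- point strictly under the bound must lie in E. There the additional 1 turns the strict
      -- inequality into ≤ 2∣E∣².
      bound : Point → ℕ
      bound x = e ℕ.* e ℕ.+ 𝟙 (E? x) ℕ.* suc (e ℕ.* e)
      all-points : ∑[ _ ∈ points ] e ℕ.* e ≡ e ℕ.* (e ℕ.* q ℕ.^ d)
      all-points = ≡.trans (∑-const points (e ℕ.* e)) (≡.trans (≡.cong (ℕ._* (e ℕ.* e)) size-Point)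
        (≡.trans (ℕ.*-comm (q ℕ.^ d) (e ℕ.* e)) (ℕ.*-assoc e e (q ℕ.^ d))))
      in-E : ∑[ x ∈ points ] 𝟙 (E? x) ℕ.* suc (e ℕ.* e) ≡ e ℕ.* suc (e ℕ.* e)
      in-E = ≡.trans (∑-*ʳ points _ _) (≡.cong (ℕ._* suc (e ℕ.* e)) (≡.sym (length-select E? points)))
      extract : ∃[ x ] q ℕ.* isosceles x < bound x → ∃[ x ] E x × q ℕ.* isosceles x ≤ 2 ℕ.* (e ℕ.* e)
      extract (x , lt) with E? x
      ... | yes Ex = x , Ex , ℕ.≤-pred (≡.subst (q ℕ.* isosceles x <_)
              (solve 1 (λ s → s :+ con 1 :* (con 1 :+ s) := con 1 :+ con 2 :* s) ≡.refl (e ℕ.* e)) lt)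
        where open +-*-Solver using (solve; _:=_; _:+_; _:*_; con)
      ... | no  _  = ⊥-elim (ℕ.<⇒≱ lt (ℕ.≤-trans (ℕ.≤-reflexive (ℕ.+-identityʳ _)) (isosceles-≥ x)))

    module Pinned (x₀ : Point) (large : 2 ℕ.* q ℕ.^ d ≤ q ℕ.* ∣E∣) where

      Chain : ℕ → Set
      Chain k = Σ[ c ∈ Vector Point k ] Triangular (from x₀ c) × (∀ i → E (c i))

      vertices : ∀ {k} → Chain k → Vector Point (suc k)
      vertices c = x₀ Vector.∷ proj₁ c

      module Extend {k} (c : Vector Point k) (tri : Triangular (from x₀ c)) (c⊆E : ∀ i → E (c i))
        (u : Point) (u-ann : Annihilates (from x₀ c) u) (u≉0 : ¬ u ≈ᴹ 0ᴹ) where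

        private
          V : Vector Point (suc k)
          V = x₀ Vector.∷ c
          v : Vector Point k
          v = from x₀ c

        -- Lying off this hyperplane is stronger than lying off the span of the edges, but it is a
        -- single equation to avoid, and u is the witness that both `Triangular` and `fibre-≤`
        -- require.
        Extends : Point → Set
        Extends y = E y × ¬ dot u (y -ᴹ x₀) ≈ 0#

        extends? : ∀ y → Dec (Extends y)
        extends? y = E? y ×-dec ¬? (dot u (y -ᴹ x₀) ≟ 0#)

        candidates : List (∃ Extends)
        candidates = select extends? points

        -- The excluded hyperplane has at most q^(d-1) points, which by `large` is at most half of
        -- E. Adding q ∣E∣ on both sides replaces a subtraction.
        ∣E∣≤2∣candidates∣ : ∣E∣ ≤ 2 ℕ.* length candidates
        ∣E∣≤2∣candidates∣ = ℕ.*-cancelˡ-≤ q {{ℕ.>-nonZero (ℕ.<-trans ℕ.z<s (primePower>1 q-odd))}} (ℕ.+-cancelˡ-≤ (q ℕ.* ∣E∣) _ _ (begin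
          q ℕ.* ∣E∣ ℕ.+ q ℕ.* ∣E∣
            ≡⟨ solve 2 (λ q e → q :* e :+ q :* e := con 2 :* (q :* e)) ≡.refl q ∣E∣ ⟩
          2 ℕ.* (q ℕ.* ∣E∣)                                         ≤⟨ ℕ.*-monoʳ-≤ 2 split ⟩
          2 ℕ.* (q ℕ.^ d ℕ.+ q ℕ.* m)                               ≡⟨ ℕ.*-distribˡ-+ 2 (q ℕ.^ d) (q ℕ.* m) ⟩
          2 ℕ.* q ℕ.^ d ℕ.+ 2 ℕ.* (q ℕ.* m)                         ≤⟨ ℕ.+-monoˡ-≤ (2 ℕ.* (q ℕ.* m)) large ⟩
          q ℕ.* ∣E∣ ℕ.+ 2 ℕ.* (q ℕ.* m)
            ≡⟨ ≡.cong (q ℕ.* ∣E∣ ℕ.+_) (solve 2 (λ q m → con 2 :* (q :* m) := q :* (con 2 :* m)) ≡.refl q m) ⟩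
          q ℕ.* ∣E∣ ℕ.+ q ℕ.* (2 ℕ.* m)                             ∎))
          where
          open ℕ.≤-Reasoning
          open +-*-Solver using (solve; _:=_; _:+_; _:*_; con)
          m = length candidates
          bad : Point → ℕ
          bad y = 𝟙 (dot u y ⊕ ⊝ dot u x₀ ≟ 0#)
          case : ∀ y → 𝟙 (E? y) ≤ bad y ℕ.+ 𝟙 (extends? y)
          case y with dot u y ⊕ ⊝ dot u x₀ ≟ 0#
          ... | yes _ = ℕ.≤-trans (𝟙≤1 (E? y)) (s≤s z≤n)
          ... | no ¬b = 𝟙-mono (E? y) (extends? y) (λ Ey → Ey , λ e → ¬b (≈-trans (≈-sym (dot--ʳ u y x₀)) e))
          split : q ℕ.* ∣E∣ ≤ q ℕ.^ d ℕ.+ q ℕ.* m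
          split = begin
            q ℕ.* ∣E∣                                                    ≡⟨ ≡.cong (q ℕ.*_) (length-select E? points) ⟩
            q ℕ.* (∑[ y ∈ points ] 𝟙 (E? y))                             ≤⟨ ℕ.*-monoʳ-≤ q (∑-mono points case) ⟩
            q ℕ.* (∑[ y ∈ points ] (bad y ℕ.+ 𝟙 (extends? y)))
              ≡⟨ ≡.cong (q ℕ.*_) (≡.trans (∑-+ points bad _) (≡.cong (∑ points bad ℕ.+_) (≡.sym (length-select extends? points)))) ⟩
            q ℕ.* (∑ points bad ℕ.+ m)                                   ≡⟨ ℕ.*-distribˡ-+ q (∑ points bad) m ⟩
            q ℕ.* ∑ points bad ℕ.+ q ℕ.* m
              ≤⟨ ℕ.+-monoˡ-≤ (q ℕ.* m) (hyperplane-≤ u (⊝ dot u x₀) u≉0) ⟩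
            q ℕ.^ d ℕ.+ q ℕ.* m                                          ∎

        _~_ : ∃ Extends → ∃ Extends → Set
        _~_ = SameDistances V on proj₁

        _~?_ : ∀ y z → Dec (y ~ z)
        y ~? z = sameDistances? V (proj₁ y) (proj₁ z)

        open Representatives {_~_ = _~_} _~?_ (λ _ → ≈-refl) (λ s i → ≈-sym (s i)) (λ s t i → ≈-trans (s i) (t i))

        extension : ∃ Extends → Chain (suc k)
        extension (y , Ey , y-ext) = (y Vector.∷ c) , ((u , u-ann , y-ext) , tri) ,
          λ { zero → Ey ; (suc i) → c⊆E i }

        extensions : List (Chain (suc k))
        extensions = map extension (reps candidates)

        collisions : ℕ
        collisions = ∑[ y ∈ candidates ] ∑[ z ∈ candidates ] 𝟙 (y ~? z)

        collisions-bound : length candidates ℕ.* length candidates ≤ length extensions ℕ.* collisions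
        collisions-bound = ≡.subst (λ n → length candidates ℕ.* length candidates ≤ n ℕ.* collisions)
          (≡.sym (length-map extension (reps candidates))) (reps-collisions candidates)

        -- `fibre-≤` with ∣Ann v∣ = q^(d-k) inserted: the fibre of z has at most 2 q^(d-k-1) points.
        fibre-bound : ∀ (z : ∃ Extends) → q ℕ.^ suc k ℕ.* (∑[ y ∈ points ] 𝟙 (sameDistances? V y (proj₁ z))) ≤ 2 ℕ.* q ℕ.^ d
        fibre-bound (z , _ , z-ext) = begin
          q ℕ.* q ℕ.^ k ℕ.* S
            ≡⟨ solve 3 (λ a b c → a :* b :* c := b :* (a :* c)) ≡.refl q (q ℕ.^ k) S ⟩
          q ℕ.^ k ℕ.* (q ℕ.* S)                       ≤⟨ ℕ.*-monoʳ-≤ (q ℕ.^ k) (fibre-≤ x₀ c z u u-ann z-ext) ⟩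
          q ℕ.^ k ℕ.* (2 ℕ.* ∣Ann v ∣)
            ≡⟨ solve 2 (λ a b → a :* (con 2 :* b) := con 2 :* (a :* b)) ≡.refl (q ℕ.^ k) (∣Ann v ∣) ⟩
          2 ℕ.* (q ℕ.^ k ℕ.* ∣Ann v ∣)                ≡⟨ ≡.cong (2 ℕ.*_) (∣Ann∣-triangular v tri) ⟩
          2 ℕ.* q ℕ.^ d                               ∎
          where
          open ℕ.≤-Reasoning
          open +-*-Solver using (solve; _:=_; _:+_; _:*_; con)
          S = ∑[ y ∈ points ] 𝟙 (sameDistances? V y z)

        -- For m candidates in n classes, m² ≤ n · `collisions`, and the collisions fill at most m
        -- fibres; one factor m cancels. Of the constant 4, one factor 2 comes from the fibres and
        -- the other from passing to the candidates.
        many-extensions : 0 < ∣E∣ → q ℕ.^ suc k ℕ.* ∣E∣ ≤ 4 ℕ.* q ℕ.^ d ℕ.* length extensions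
        many-extensions 0<e = begin
          q ℕ.^ suc k ℕ.* ∣E∣                         ≤⟨ ℕ.*-monoʳ-≤ (q ℕ.^ suc k) ∣E∣≤2∣candidates∣ ⟩
          q ℕ.^ suc k ℕ.* (2 ℕ.* m)
            ≡⟨ solve 2 (λ a b → a :* (con 2 :* b) := con 2 :* (a :* b)) ≡.refl (q ℕ.^ suc k) m ⟩
          2 ℕ.* (q ℕ.^ suc k ℕ.* m)                   ≤⟨ ℕ.*-monoʳ-≤ 2 cancelled ⟩
          2 ℕ.* (2 ℕ.* q ℕ.^ d ℕ.* n)
            ≡⟨ solve 2 (λ a b → con 2 :* (con 2 :* a :* b) := con 4 :* a :* b) ≡.refl (q ℕ.^ d) n ⟩
          4 ℕ.* q ℕ.^ d ℕ.* n                         ∎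
          where
          open ℕ.≤-Reasoning
          open +-*-Solver using (solve; _:=_; _:+_; _:*_; con)
          m = length candidates
          n = length extensions
          0<m : 0 < m
          0<m = ℕ.*-cancelˡ-< 2 0 m (ℕ.<-≤-trans 0<e ∣E∣≤2∣candidates∣)
          collisions-≤ : q ℕ.^ suc k ℕ.* collisions ≤ m ℕ.* (2 ℕ.* q ℕ.^ d)
          collisions-≤ = begin
            q ℕ.^ suc k ℕ.* collisions
              ≡⟨ ≡.cong (q ℕ.^ suc k ℕ.*_) (∑-swap candidates candidates _) ⟩
            q ℕ.^ suc k ℕ.* (∑[ z ∈ candidates ] ∑[ y ∈ candidates ] 𝟙 (y ~? z))    ≡⟨ ∑-*ˡ candidates (q ℕ.^ suc k) _ ⟨
            ∑[ z ∈ candidates ] q ℕ.^ suc k ℕ.* (∑[ y ∈ candidates ] 𝟙 (y ~? z))    ≤⟨ ∑-mono candidates (λ z → ℕ.≤-trans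
                                                                                        (ℕ.*-monoʳ-≤ (q ℕ.^ suc k) (∑-select-≤ extends? points (λ y → 𝟙 (sameDistances? V y (proj₁ z)))))
                                                                                        (fibre-bound z)) ⟩
            ∑[ _ ∈ candidates ] 2 ℕ.* q ℕ.^ d                                       ≡⟨ ∑-const candidates _ ⟩
            m ℕ.* (2 ℕ.* q ℕ.^ d)                                                   ∎
          cancelled : q ℕ.^ suc k ℕ.* m ≤ 2 ℕ.* q ℕ.^ d ℕ.* n
          cancelled = ℕ.*-cancelʳ-≤ _ _ m {{ℕ.>-nonZero 0<m}} (begin
            q ℕ.^ suc k ℕ.* m ℕ.* m                   ≡⟨ ℕ.*-assoc (q ℕ.^ suc k) m m ⟩
            q ℕ.^ suc k ℕ.* (m ℕ.* m)                 ≤⟨ ℕ.*-monoʳ-≤ (q ℕ.^ suc k) collisions-bound ⟩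
            q ℕ.^ suc k ℕ.* (n ℕ.* collisions)
              ≡⟨ solve 3 (λ a b c → a :* (b :* c) := b :* (a :* c)) ≡.refl (q ℕ.^ suc k) n collisions ⟩
            n ℕ.* (q ℕ.^ suc k ℕ.* collisions)        ≤⟨ ℕ.*-monoʳ-≤ n collisions-≤ ⟩
            n ℕ.* (m ℕ.* (2 ℕ.* q ℕ.^ d))
              ≡⟨ solve 3 (λ n m a → n :* (m :* a) := a :* n :* m) ≡.refl n m (2 ℕ.* q ℕ.^ d) ⟩
            2 ℕ.* q ℕ.^ d ℕ.* n ℕ.* m                 ∎)

        -- Siblings differ only in the new point, which stands at position 1. Its distances to
        -- position 0 and to positions from 2 on are precisely those compared by `_~_`.
        extensions-distinct : AllPairs (λ a b → ¬ Congruent (vertices a) (vertices b)) extensions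
        extensions-distinct = AllPairs.map⁺ (AllPairs.map (λ ¬same cong → ¬same (λ
          { zero → cong (suc zero) zero ; (suc i) → cong (suc zero) (suc (suc i)) })) (reps-distinct candidates))

        extensions-restrict : All (λ x → proj₁ x ∘ suc ≡ c) extensions
        extensions-restrict = All.map⁺ (All.universal (λ _ → ≡.refl) (reps candidates))

        -- All distances except the one to x₀ are forgotten, and the candidates are enlarged to E.
        -- For the empty chain, where this is applied, x₀ is the only point from which distances are
        -- taken.
        collisions≤isosceles : collisions ≤ isosceles x₀
        collisions≤isosceles = ∑-select-mono extends? E? (λ _ → proj₁) points
          {λ y → ∑[ z ∈ candidates ] 𝟙 (sameDistances? V y (proj₁ z))} {λ y → ∑[ z ∈ es ] 𝟙 (‖ y -ᴹ x₀ ‖ ≟ ‖ proj₁ z -ᴹ x₀ ‖)}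
          (λ y → ∑-select-mono extends? E? (λ _ → proj₁) points
            (λ z → 𝟙-mono (sameDistances? V y z) (‖ y -ᴹ x₀ ‖ ≟ ‖ z -ᴹ x₀ ‖) (λ same → same zero)))

        -- The constant 8 is 2², from bounding ∣E∣² by the square of the number of candidates, times
        -- the 2 of the pin.
        many-distances : 0 < ∣E∣ → q ℕ.* isosceles x₀ ≤ 2 ℕ.* (∣E∣ ℕ.* ∣E∣) → q ≤ 8 ℕ.* length extensions
        many-distances 0<e pinned = ℕ.*-cancelʳ-≤ q _ (e ℕ.* e) {{ℕ.>-nonZero (ℕ.*-mono-≤ 0<e 0<e)}} (begin
          q ℕ.* (e ℕ.* e)
            ≤⟨ ℕ.*-monoʳ-≤ q (ℕ.*-mono-≤ ∣E∣≤2∣candidates∣ ∣E∣≤2∣candidates∣) ⟩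
          q ℕ.* (2 ℕ.* m ℕ.* (2 ℕ.* m))
            ≡⟨ solve 2 (λ q m → q :* (con 2 :* m :* (con 2 :* m)) := con 4 :* (q :* (m :* m))) ≡.refl q m ⟩
          4 ℕ.* (q ℕ.* (m ℕ.* m))
            ≤⟨ ℕ.*-monoʳ-≤ 4 (ℕ.*-monoʳ-≤ q (ℕ.≤-trans collisions-bound (ℕ.*-monoʳ-≤ n collisions≤isosceles))) ⟩
          4 ℕ.* (q ℕ.* (n ℕ.* isosceles x₀))
            ≡⟨ solve 3 (λ q n i → con 4 :* (q :* (n :* i)) := con 4 :* n :* (q :* i)) ≡.refl q n (isosceles x₀) ⟩
          4 ℕ.* n ℕ.* (q ℕ.* isosceles x₀)            ≤⟨ ℕ.*-monoʳ-≤ (4 ℕ.* n) pinned ⟩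
          4 ℕ.* n ℕ.* (2 ℕ.* (e ℕ.* e))
            ≡⟨ solve 2 (λ n e → con 4 :* n :* (con 2 :* e) := con 8 :* n :* e) ≡.refl n (e ℕ.* e) ⟩
          8 ℕ.* n ℕ.* (e ℕ.* e)                       ∎)
          where
          open ℕ.≤-Reasoning
          open +-*-Solver using (solve; _:=_; _:+_; _:*_; con)
          e = ∣E∣
          m = length candidates
          n = length extensions

      extend : ∀ {k} → k < d → Chain k → List (Chain (suc k))
      extend k<d (c , tri , c⊆E) = let u , u-ann , u≉0 = nonzero-annihilator k<d (from x₀ c) tri
        in Extend.extensions c tri c⊆E u u-ann u≉0

      tree : ∀ k → k ≤ d → List (Chain k)
      tree zero    _   = (Vector.[] , tt , λ ()) ∷ []
      tree (suc k) k<d = concat (map (extend k<d) (tree k (ℕ.<⇒≤ k<d)))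

      Distinct : ∀ {k} → Chain k → Chain k → Set
      Distinct a b = ¬ Congruent (vertices a) (vertices b)

      congruent-restrict : ∀ {k} {c c′ : Vector Point (suc k)} → Congruent (x₀ Vector.∷ c) (x₀ Vector.∷ c′) →
        Congruent (x₀ Vector.∷ (c ∘ suc)) (x₀ Vector.∷ (c′ ∘ suc))
      congruent-restrict cong zero    zero    = cong zero zero
      congruent-restrict cong zero    (suc j) = cong zero (suc (suc j))
      congruent-restrict cong (suc i) zero    = cong (suc (suc i)) zero
      congruent-restrict cong (suc i) (suc j) = cong (suc (suc i)) (suc (suc j))

      -- New points are inserted directly after x₀, so deleting position 1 recovers the parent. A
      -- congruence between children of different parents would therefore restrict to the parents.
      tree-distinct : ∀ k (k≤d : k ≤ d) → AllPairs Distinct (tree k k≤d)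
      tree-distinct zero    _   = [] ∷ []
      tree-distinct (suc k) k<d = AllPairs.concat⁺
        (All.map⁺ (All.universal distinct-siblings (tree k (ℕ.<⇒≤ k<d))))
        (AllPairs.map⁺ (AllPairs.map distinct-cousins (tree-distinct k (ℕ.<⇒≤ k<d))))
        where
        distinct-siblings : ∀ c → AllPairs Distinct (extend k<d c)
        distinct-siblings (c , tri , c⊆E) = let u , u-ann , u≉0 = nonzero-annihilator k<d (from x₀ c) tri
          in Extend.extensions-distinct c tri c⊆E u u-ann u≉0
        restrict : ∀ c → All (λ x → proj₁ x ∘ suc ≡ proj₁ c) (extend k<d c)
        restrict (c , tri , c⊆E) = let u , u-ann , u≉0 = nonzero-annihilator k<d (from x₀ c) tri
          in Extend.extensions-restrict c tri c⊆E u u-ann u≉0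
        distinct-cousins : ∀ {a b} → Distinct a b → All (λ x → All (Distinct x) (extend k<d b)) (extend k<d a)
        distinct-cousins {a} {b} a≢b = All.map (λ {x} x↾ → All.map (λ {y} y↾ cong → a≢b
          (≡.subst₂ (λ c c′ → Congruent (x₀ Vector.∷ c) (x₀ Vector.∷ c′)) x↾ y↾ (congruent-restrict cong))) (restrict b)) (restrict a)

      tree-step : 0 < ∣E∣ → ∀ k (k<d : k < d) →
        q ℕ.^ suc k ℕ.* ∣E∣ ℕ.* length (tree k (ℕ.<⇒≤ k<d)) ≤ 4 ℕ.* q ℕ.^ d ℕ.* length (tree (suc k) k<d)
      tree-step 0<e k k<d = begin
        A ℕ.* length cs                                              ≡⟨ ℕ.*-comm A (length cs) ⟩
        length cs ℕ.* A                                              ≡⟨ ∑-const cs A ⟨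
        ∑[ _ ∈ cs ] A                                                ≤⟨ ∑-mono cs (λ (c , tri , c⊆E) →
                                                                        let u , u-ann , u≉0 = nonzero-annihilator k<d (from x₀ c) tri
                                                                        in Extend.many-extensions c tri c⊆E u u-ann u≉0 0<e) ⟩
        ∑[ c ∈ cs ] 4 ℕ.* q ℕ.^ d ℕ.* length (extend k<d c)          ≡⟨ ∑-*ˡ cs (4 ℕ.* q ℕ.^ d) _ ⟩
        4 ℕ.* q ℕ.^ d ℕ.* (∑[ c ∈ cs ] length (extend k<d c))
          ≡⟨ ≡.cong (4 ℕ.* q ℕ.^ d ℕ.*_) (length-concatMap (extend k<d) cs) ⟨
        4 ℕ.* q ℕ.^ d ℕ.* length (tree (suc k) k<d)                  ∎
        where
        open ℕ.≤-Reasoning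
        cs = tree k (ℕ.<⇒≤ k<d)
        A = q ℕ.^ suc k ℕ.* ∣E∣

      tree-base : 0 < ∣E∣ → q ℕ.* isosceles x₀ ≤ 2 ℕ.* (∣E∣ ℕ.* ∣E∣) → (0<d : 0 < d) → q ≤ 8 ℕ.* length (tree 1 0<d)
      tree-base 0<e pinned 0<d = begin
        q                                           ≤⟨ bound ⟩
        8 ℕ.* length (extend 0<d root)              ≡⟨ ≡.cong (8 ℕ.*_) (ℕ.+-identityʳ (length (extend 0<d root))) ⟨
        8 ℕ.* (length (extend 0<d root) ℕ.+ 0)      ≡⟨ ≡.cong (8 ℕ.*_) (length-concatMap (extend 0<d) (root ∷ [])) ⟨
        8 ℕ.* length (tree 1 0<d)                   ∎
        where
        open ℕ.≤-Reasoning
        root : Chain 0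
        root = Vector.[] , tt , λ ()
        bound : q ≤ 8 ℕ.* length (extend 0<d root)
        bound = let u , u-ann , u≉0 = nonzero-annihilator 0<d (from x₀ (proj₁ root)) tt
          in Extend.many-distances (proj₁ root) tt (proj₂ (proj₂ root)) u u-ann u≉0 0<e pinned

      tree-size : 0 < ∣E∣ → q ℕ.* isosceles x₀ ≤ 2 ℕ.* (∣E∣ ℕ.* ∣E∣) → ∀ k (k<d : suc k ≤ d) →
        q ℕ.^ (suc (suc k) choose 2) ℕ.* ∣E∣ ℕ.^ k ≤ 8 ℕ.* 4 ℕ.^ k ℕ.* (q ℕ.^ d) ℕ.^ k ℕ.* length (tree (suc k) k<d)
      tree-size 0<e pinned = growth q ∣E∣ (q ℕ.^ d) (λ k k≤d → length (tree k k≤d)) (tree-base 0<e pinned) (tree-step 0<e)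

-- Congruence classes of simplices

module Simplices (F : HeytingField 0ℓ 0ℓ 0ℓ) {q : ℕ} (q-odd : OddPrimePower q)
  (card : HasCardinality (HeytingField._≈_ F) q) (d : ℕ) where

  open Configurations F q-odd card d public
  open 𝔽-Solver using (solve; _:=_; _:+_; _:*_; :-_)

  ≈ᴹ-refl : ∀ {x} → x ≈ᴹ x
  ≈ᴹ-refl j = ≈-refl

  ≈ᴹ-trans : ∀ {x y z} → x ≈ᴹ y → y ≈ᴹ z → x ≈ᴹ z
  ≈ᴹ-trans e f j = ≈-trans (e j) (f j)

  -ᴹ-cong₂ : ∀ {x x′ y y′} → x ≈ᴹ x′ → y ≈ᴹ y′ → x -ᴹ y ≈ᴹ x′ -ᴹ y′
  -ᴹ-cong₂ e f j = ⊕-cong (e j) (⊝-cong (f j))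

  ∼⇒congruent : ∀ {k} {V W : Vector Point (suc k)} → V ∼ W → Congruent V W
  ∼⇒congruent {V = V} {W} (τ , O , (O-hom , O-norm) , W≈) i j = ≈-sym (≈-trans (‖‖-cong difference) (O-norm (V i -ᴹ V j)))
    where
    open LeftModuleMorphisms.IsLeftModuleHomomorphism O-hom
    difference : W i -ᴹ W j ≈ᴹ O (V i -ᴹ V j)
    difference = ≈ᴹ-trans (-ᴹ-cong₂ (W≈ i) (W≈ j))
      (≈ᴹ-trans (λ l → solve 3 (λ t a b → (t :+ a) :+ :- (t :+ b) := a :+ :- b) ≈-refl (τ l) (O (V i) l) (O (V j) l))
      (≈ᴹ-trans (λ l → ⊕-congˡ (≈-sym (-ᴹ-homo (V j) l))) (≈ᴹ-sym (+ᴹ-homo (V i) (-ᴹ V j)))))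

  combination : ∀ {k} → Vector Point k → Vector 𝔽 k → Point
  combination v a = sumᴹ (λ i → a i *ₗ v i)

  sumᴹ-cong : ∀ {k} {f g : Vector Point k} → (∀ i → f i ≈ᴹ g i) → sumᴹ f ≈ᴹ sumᴹ g
  sumᴹ-cong {zero}  e j = ≈-refl
  sumᴹ-cong {suc k} e j = ⊕-cong (e zero j) (sumᴹ-cong (e ∘ suc) j)

  combination-congˡ : ∀ {k} {v w : Vector Point k} a → (∀ i → v i ≈ᴹ w i) → combination v a ≈ᴹ combination w a
  combination-congˡ a e = sumᴹ-cong (λ i j → ⊗-congˡ (e i j))

  combination-congʳ : ∀ {k} (v : Vector Point k) {a b} → (∀ i → a i ≈ b i) → combination v a ≈ᴹ combination v b
  combination-congʳ v e = sumᴹ-cong (λ i j → ⊗-congʳ (e i))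

  combination-+ : ∀ {k} (v : Vector Point k) a b → combination v (λ i → a i ⊕ b i) ≈ᴹ combination v a +ᴹ combination v b
  combination-+ {zero}  v a b j = ≈-sym (⊕-identityˡ 0#)
  combination-+ {suc k} v a b j = ≈-trans (⊕-congˡ (combination-+ (v ∘ suc) (a ∘ suc) (b ∘ suc) j))
    (solve 5 (λ x y v s t → (x :+ y) :* v :+ (s :+ t) := (x :* v :+ s) :+ (y :* v :+ t)) ≈-refl (a zero) (b zero) (v zero j) _ _)

  combination-* : ∀ {k} (v : Vector Point k) s a → combination v (λ i → s ⊗ a i) ≈ᴹ s *ₗ combination v a
  combination-* {zero}  v s a j = ≈-sym (⊗-zeroʳ s)
  combination-* {suc k} v s a j = ≈-trans (⊕-congˡ (combination-* (v ∘ suc) s (a ∘ suc) j))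
    (solve 4 (λ s x v t → s :* x :* v :+ s :* t := s :* (x :* v :+ t)) ≈-refl s (a zero) (v zero j) _)

  combination-neg : ∀ {k} (v : Vector Point k) a → combination v (λ i → ⊝ a i) ≈ᴹ -ᴹ combination v a
  combination-neg {zero}  v a j = solve 0 (con (ℤ.+ 0) := :- con (ℤ.+ 0)) ≈-refl
    where open 𝔽-Solver using (con)
  combination-neg {suc k} v a j = ≈-trans (⊕-congˡ (combination-neg (v ∘ suc) (a ∘ suc) j))
    (solve 3 (λ x v t → (:- x) :* v :+ :- t := :- (x :* v :+ t)) ≈-refl (a zero) (v zero j) _)

  combination-0 : ∀ {k} (v : Vector Point k) → combination v (λ _ → 0#) ≈ᴹ 0ᴹ
  combination-0 {zero}  v j = ≈-refl
  combination-0 {suc k} v j = ≈-trans (⊕-cong (⊗-zeroˡ _) (combination-0 (v ∘ suc) j)) (⊕-identityˡ 0#)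

  unit : ∀ {k} → Fin k → Vector 𝔽 k
  unit zero    = 1# Vector.∷ λ _ → 0#
  unit (suc i) = 0# Vector.∷ unit i

  combination-unit : ∀ {k} (v : Vector Point k) i → combination v (unit i) ≈ᴹ v i
  combination-unit v zero    j = ≈-trans (⊕-cong (⊗-identityˡ _) (combination-0 (v ∘ suc) j)) (⊕-identityʳ _)
  combination-unit v (suc i) j = ≈-trans (⊕-cong (⊗-zeroˡ _) (combination-unit (v ∘ suc) i j)) (⊕-identityˡ _)

  sum-cong : ∀ {k} {f g : Vector 𝔽 k} → (∀ i → f i ≈ g i) → sum f ≈ sum g
  sum-cong {zero}  e = ≈-refl
  sum-cong {suc k} e = ⊕-cong (e zero) (sum-cong (e ∘ suc))

  dot-combinationʳ : ∀ {k} x (v : Vector Point k) a → dot x (combination v a) ≈ sum (λ i → a i ⊗ dot x (v i))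
  dot-combinationʳ x v a = ≈-trans (dot-sumʳ x (λ i → a i *ₗ v i)) (sum-cong (λ i → dot-*ʳ (a i) x (v i)))

  -- Expanding the two arguments of `dot` one after the other leaves only the coefficients a and the
  -- entries of the Gram matrix.
  gram⇒norm : ∀ {k} (v w : Vector Point k) → (∀ i j → dot (v i) (v j) ≈ dot (w i) (w j)) →
    ∀ a → ‖ combination v a ‖ ≈ ‖ combination w a ‖
  gram⇒norm v w gram a = begin
    dot (combination v a) (combination v a)               ≈⟨ dot-combinationʳ (combination v a) v a ⟩
    sum (λ i → a i ⊗ dot (combination v a) (v i))         ≈⟨ sum-cong (λ i → ⊗-congˡ (partial i)) ⟩
    sum (λ i → a i ⊗ dot (combination w a) (w i))         ≈⟨ dot-combinationʳ (combination w a) w a ⟨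
    dot (combination w a) (combination w a)               ∎
    where
    open ≈-Reasoning
    partial : ∀ i → dot (combination v a) (v i) ≈ dot (combination w a) (w i)
    partial i = begin
      dot (combination v a) (v i)             ≈⟨ dot-comm _ (v i) ⟩
      dot (v i) (combination v a)             ≈⟨ dot-combinationʳ (v i) v a ⟩
      sum (λ j → a j ⊗ dot (v i) (v j))       ≈⟨ sum-cong (λ j → ⊗-congˡ (gram i j)) ⟩
      sum (λ j → a j ⊗ dot (w i) (w j))       ≈⟨ dot-combinationʳ (w i) w a ⟨
      dot (w i) (combination w a)             ≈⟨ dot-comm (w i) _ ⟩
      dot (combination w a) (w i)             ∎

  edges : ∀ {k} → Vector Point (suc k) → Vector Point k
  edges V = from (V zero) (V ∘ suc)

  congruent⇒gram : ∀ {k} {V W : Vector Point (suc k)} → Congruent V W →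
    ∀ i j → dot (edges V i) (edges V j) ≈ dot (edges W i) (edges W j)
  congruent⇒gram {V = V} {W} cong i j = halve (begin
    -- With x and z both equal to the base vertex, y - z and c - x are the two edges in question.
    _   ≈⟨ polarisation (V zero) (V (suc i)) (V zero) (V (suc j)) ⟩
    _   ≈⟨ ⊕-cong (⊕-cong (cong (suc i) zero) (⊝-cong (cong zero zero)))
                  (⊝-cong (⊕-cong (cong (suc i) (suc j)) (⊝-cong (cong zero (suc j))))) ⟩
    _   ≈⟨ polarisation (W zero) (W (suc i)) (W zero) (W (suc j)) ⟨
    _   ∎)
    where open ≈-Reasoning

  module _ {v : Vector Point d} (independent : LinearlyIndependent v) where

    combination-injective : ∀ a b → combination v a ≈ᴹ combination v b → ∀ i → a i ≈ b i
    combination-injective a b e i = x-y≈0⇒x≈y (independent (λ i → a i ⊕ ⊝ b i)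
      (≈ᴹ-trans (combination-+ v a (λ i → ⊝ b i)) (λ j → ≈-trans (⊕-congˡ (combination-neg v b j)) (x≈y⇒x-y≈0 (e j)))) i)

    -- Vectors of d scalars are points, so pigeonhole applies to a ↦ combination v a.
    spanning : ∀ x → ∃[ a ] combination v a ≈ᴹ x
    spanning = Pointₛ.injective⇒surjective (combination v) (combination-congʳ v) combination-injective

    module Extension (w : Vector Point d) where

      coordinates : Point → Vector 𝔽 d
      coordinates x = proj₁ (spanning x)

      coordinates-unique : ∀ {x} a → combination v a ≈ᴹ x → ∀ i → coordinates x i ≈ a i
      coordinates-unique {x} a e = combination-injective _ a (≈ᴹ-trans (proj₂ (spanning x)) (≈ᴹ-sym e))

      extension : Point → Point
      extension x = combination w (coordinates x)

      -- Coordinates are unique, so the image can be computed from any combination that represents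
      -- x. Additivity, homogeneity and the images of the basis vectors are all instances of this.
      extension-combination : ∀ {x} a → combination v a ≈ᴹ x → extension x ≈ᴹ combination w a
      extension-combination a e = combination-congʳ w (coordinates-unique a e)

      extension-+ : ∀ x y → extension (x +ᴹ y) ≈ᴹ extension x +ᴹ extension y
      extension-+ x y = ≈ᴹ-trans (extension-combination _ (≈ᴹ-trans (combination-+ v (coordinates x) (coordinates y))
        (λ j → ⊕-cong (proj₂ (spanning x) j) (proj₂ (spanning y) j)))) (combination-+ w (coordinates x) (coordinates y))

      isHomomorphism : LeftModuleMorphisms.IsLeftModuleHomomorphism space space extension
      isHomomorphism = record
        { +ᴹ-isGroupHomomorphism = record
          { isMonoidHomomorphism = record
            { isMagmaHomomorphism = record
              { isRelHomomorphism = record { cong = λ {x} {y} x≈y → extension-combination (coordinates y) (≈ᴹ-trans (proj₂ (spanning y)) (≈ᴹ-sym x≈y)) }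
              ; homo = extension-+
              }
            ; ε-homo = ≈ᴹ-trans (extension-combination (λ _ → 0#) (combination-0 v)) (combination-0 w)
            }
          ; ⁻¹-homo = λ x → ≈ᴹ-trans (extension-combination _ (≈ᴹ-trans (combination-neg v (coordinates x)) (λ j → ⊝-cong (proj₂ (spanning x) j))))
              (combination-neg w (coordinates x))
          }
        ; *ₗ-homo = λ s x → ≈ᴹ-trans (extension-combination _ (≈ᴹ-trans (combination-* v s (coordinates x)) (λ j → ⊗-congˡ (proj₂ (spanning x) j))))
            (combination-* w s (coordinates x))
        }

  -- The edges of V form a basis, so some linear map carries them to the edges of W. Equal distances
  -- mean equal Gram matrices, hence the map preserves norms, and τ is determined by the images of
  -- the base vertices.
  congruent⇒∼ : {V W : Vector Point (suc d)} → IsSimplex V → Congruent V W → V ∼ W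
  congruent⇒∼ {V} {W} simplex congruent = τ , extension , (isHomomorphism , isometry) , image
    where
    open Extension simplex (edges W)
    open LeftModuleMorphisms.IsLeftModuleHomomorphism isHomomorphism using (+ᴹ-homo; ⟦⟧-cong)
    τ : Point
    τ = W zero -ᴹ extension (V zero)
    isometry : ∀ x → ‖ extension x ‖ ≈ ‖ x ‖
    isometry x = ≈-trans (≈-sym (gram⇒norm (edges V) (edges W) (congruent⇒gram {V = V} {W} congruent) (coordinates x)))
      (‖‖-cong (proj₂ (spanning simplex x)))
    image : ∀ i → W i ≈ᴹ τ +ᴹ extension (V i)
    image zero    j = solve 2 (λ w o → w := (w :+ :- o) :+ o) ≈-refl (W zero j) (extension (V zero) j)
    image (suc i) j = ≈-trans (solve 3 (λ w w₀ o → w := (w₀ :+ :- o) :+ ((w :+ :- w₀) :+ o)) ≈-refl (W (suc i) j) (W zero j) (extension (V zero) j))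
      (⊕-congˡ (≈-sym (≈-trans (⟦⟧-cong {V (suc i)} {edges V i +ᴹ V zero}
          (λ j → solve 2 (λ x y → x := (x :+ :- y) :+ y) ≈-refl (V (suc i) j) (V zero j)) j)
        (≈-trans (+ᴹ-homo (edges V i) (V zero) j) (⊕-congʳ (edge j))))))
      where
      edge : extension (edges V i) ≈ᴹ edges W i
      edge = ≈ᴹ-trans (extension-combination (unit i) (combination-unit (edges V) i)) (combination-unit (edges W) i)

  congruent? : ∀ {k} (V W : Vector Point k) → Dec (Congruent V W)
  congruent? V W = Fin.all? (λ i → Fin.all? (λ j → ‖ V i -ᴹ V j ‖ ≟ ‖ W i -ᴹ W j ‖))

  independent? : (v : Vector Point d) → Dec (LinearlyIndependent v)
  independent? v = Pointₛ.∀? (λ a → (combination v a ≟ᴹ 0ᴹ) →-dec Fin.all? (λ i → a i ≟ 0#))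
    (λ a≈b h e i → ≈-trans (≈-sym (a≈b i)) (h (≈ᴹ-trans (combination-congʳ v a≈b) e) i))

  Tupleₛ : FiniteSetoid
  Tupleₛ = vectorSetoid Pointₛ (suc d)

  module SimplexClasses {E : Pred Point 0ℓ} (E-resp : ∀ {x y} → x ≈ᴹ y → E x → E y) (E? : ∀ x → Dec (E x)) where

    _≅_ : SimplexIn d E → SimplexIn d E → Set
    _≅_ = _∼_ on proj₁

    -- The laws are transported from `Congruent`, where they are those of equality of scalars,
    -- instead of inverting and composing orthogonal maps.
    ≅-isEquivalence : IsEquivalence _≅_
    ≅-isEquivalence = record
      { refl  = λ {(V , s , _)} → congruent⇒∼ s (λ i j → ≈-refl)
      ; sym   = λ {(V , _)} {(W , s , _)} V≅W → congruent⇒∼ s (λ i j → ≈-sym (∼⇒congruent {V = V} {W} V≅W i j))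
      ; trans = λ {(U , s , _)} {(V , _)} {(W , _)} U≅V V≅W → congruent⇒∼ s
                  (λ i j → ≈-trans (∼⇒congruent {V = U} {V} U≅V i j) (∼⇒congruent {V = V} {W} V≅W i j))
      }

    -- Comparing finitely many distances takes the place of a search for τ and O.
    _≅?_ : ∀ V W → Dec (V ≅ W)
    (V , s , _) ≅? (W , _) = map′ (congruent⇒∼ s) (∼⇒congruent {V = V} {W}) (congruent? V W)

    simplexIn? : ∀ V → Dec (IsSimplex V × (∀ i → E (V i)))
    simplexIn? V = independent? (edges V) ×-dec Fin.all? (λ i → E? (V i))

    simplexIn-resp : ∀ {V W : Vector Point (suc d)} → (∀ i → V i ≈ᴹ W i) → IsSimplex V × (∀ i → E (V i)) → IsSimplex W × (∀ i → E (W i))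
    simplexIn-resp e (s , V⊆E) =
      (λ a Σ≈0 → s a (≈ᴹ-trans (combination-congˡ a (λ i → -ᴹ-cong₂ (e (suc i)) (e zero))) Σ≈0)) ,
      λ i → E-resp (e i) (V⊆E i)

    simplices : List (SimplexIn d E)
    simplices = select simplexIn? (FiniteSetoid.elements Tupleₛ)

    listed : ∀ V → Any (V ≅_) simplices
    listed (V , p) = Any.map (λ {(W , _)} W≈V → congruent⇒∼ (proj₁ p) (λ i j → ‖‖-cong (-ᴹ-cong₂ (≈ᴹ-sym (W≈V i)) (≈ᴹ-sym (W≈V j)))))
      (select-Any {Q = λ W → ∀ i → W i ≈ᴹ V i} simplexIn? (λ W≈V → simplexIn-resp (λ i → ≈ᴹ-sym (W≈V i)) p) (FiniteSetoid.member Tupleₛ V))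

    classes : ∃[ t ] ∣T d ⟨ E ⟩∣≡ t
    classes = listed⇒cardinality ≅-isEquivalence _≅?_ simplices listed

-- The leaves of the tree are simplices with pairwise different systems of distances, so they inject
-- into the classes, and `tree-size` at full depth bounds t. Here k is d - 1.
many-classes : (F : HeytingField 0ℓ 0ℓ 0ℓ) {q : ℕ} (q-odd : OddPrimePower q) (card : HasCardinality (HeytingField._≈_ F) q) (k : ℕ) →
  let open Simplices F q-odd card (suc k) in
  {E : Pred Point 0ℓ} (E-resp : ∀ {x y} → x ≈ᴹ y → E x → E y) (E? : ∀ x → Dec (E x)) →
  let e = PointSet.∣E∣ E-resp E? in
  0 < e → q ℕ.* q ℕ.^ suc k ≤ e ℕ.* e → 2 ℕ.* q ℕ.^ suc k ≤ q ℕ.* e → ∀ {t} → ∣T suc k ⟨ E ⟩∣≡ t →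
  q ℕ.^ (suc (suc k) choose 2) ℕ.* e ℕ.^ k ≤ 8 ℕ.* 4 ℕ.^ k ℕ.* (q ℕ.^ suc k) ℕ.^ k ℕ.* t
many-classes F {q} q-odd card k {E} E-resp E? 0<e pinnable large {t} T =
  ℕ.≤-trans (tree-size 0<e pinned k ℕ.≤-refl) (ℕ.*-monoʳ-≤ (8 ℕ.* 4 ℕ.^ k ℕ.* (q ℕ.^ suc k) ℕ.^ k) (begin
    length leaves                   ≡⟨ length-map simplex leaves ⟨
    length (map simplex leaves)     ≤⟨ distinct-length≤cardinality ≅-isEquivalence T (AllPairs.map⁺ (AllPairs.map
                                         (λ {a} {b} distinct a∼b → distinct (∼⇒congruent {V = vertices a} {vertices b} a∼b))
                                         (tree-distinct (suc k) ℕ.≤-refl))) ⟩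
    t                               ∎))
  where
  open ℕ.≤-Reasoning
  open Simplices F q-odd card (suc k)
  open SimplexClasses E-resp E?
  open PointSet E-resp E?
  pinning = pin 0<e pinnable
  x₀ : Point
  x₀ = proj₁ pinning
  x₀∈E : E x₀
  x₀∈E = proj₁ (proj₂ pinning)
  pinned = proj₂ (proj₂ pinning)
  open Pinned x₀ large
  leaves : List (Chain (suc k))
  leaves = tree (suc k) ℕ.≤-refl
  simplex : Chain (suc k) → SimplexIn (suc k) E
  simplex chain@(c , tri , c⊆E) = vertices chain , triangular⇒independent (from x₀ c) tri , λ { zero → x₀∈E ; (suc i) → c⊆E i }

-- Real inequalities from natural ones, and back

module RationalBounds where
  open ≡ using (refl; sym; trans; cong; cong₂; subst)

  ι : ℕ → ℚ
  ι n = ℤ.+ n / 1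

  private
    ι-toℚᵘ : ∀ n → ℚ.toℚᵘ (ι n) ℚᵘ.≃ ℚᵘ.mkℚᵘ (ℤ.+ n) 0
    ι-toℚᵘ n = ℚ.toℚᵘ-fromℚᵘ (ℚᵘ.mkℚᵘ (ℤ.+ n) 0)

  ι-+ : ∀ m n → ι (m ℕ.+ n) ≡ ι m ℚ.+ ι n
  ι-+ m n = ℚ.toℚᵘ-injective (begin-equality
    ℚ.toℚᵘ (ι (m ℕ.+ n))                                ≃⟨ ι-toℚᵘ (m ℕ.+ n) ⟩
    ℚᵘ.mkℚᵘ (ℤ.+ (m ℕ.+ n)) 0
      ≃⟨ ℚᵘ.*≡* (cong (ℤ._* ℤ.+ 1) (trans (ℤ.pos-+ m n) (sym (cong₂ ℤ._+_ (ℤ.*-identityʳ (ℤ.+ m)) (ℤ.*-identityʳ (ℤ.+ n)))))) ⟩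
    ℚᵘ.mkℚᵘ (ℤ.+ m) 0 ℚᵘ.+ ℚᵘ.mkℚᵘ (ℤ.+ n) 0            ≃⟨ ℚᵘ.+-cong (ι-toℚᵘ m) (ι-toℚᵘ n) ⟨
    ℚ.toℚᵘ (ι m) ℚᵘ.+ ℚ.toℚᵘ (ι n)                      ≃⟨ ℚ.toℚᵘ-homo-+ (ι m) (ι n) ⟨
    ℚ.toℚᵘ (ι m ℚ.+ ι n)                                ∎)
    where open ℚᵘ.≤-Reasoning

  ι-* : ∀ m n → ι (m ℕ.* n) ≡ ι m ℚ.* ι n
  ι-* m n = ℚ.toℚᵘ-injective (begin-equality
    ℚ.toℚᵘ (ι (m ℕ.* n))                                ≃⟨ ι-toℚᵘ (m ℕ.* n) ⟩
    ℚᵘ.mkℚᵘ (ℤ.+ (m ℕ.* n)) 0                           ≃⟨ ℚᵘ.*≡* (cong (ℤ._* ℤ.+ 1) (ℤ.pos-* m n)) ⟩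
    ℚᵘ.mkℚᵘ (ℤ.+ m) 0 ℚᵘ.* ℚᵘ.mkℚᵘ (ℤ.+ n) 0            ≃⟨ ℚᵘ.*-cong (ι-toℚᵘ m) (ι-toℚᵘ n) ⟨
    ℚ.toℚᵘ (ι m) ℚᵘ.* ℚ.toℚᵘ (ι n)                      ≃⟨ ℚ.toℚᵘ-homo-* (ι m) (ι n) ⟨
    ℚ.toℚᵘ (ι m ℚ.* ι n)                                ∎)
    where open ℚᵘ.≤-Reasoning

  ι-mono-≤ : ∀ m n → m ℕ.≤ n → ι m ℚ.≤ ι n
  ι-mono-≤ m n m≤n = ℚ.toℚᵘ-cancel-≤ (begin
    ℚ.toℚᵘ (ι m)          ≃⟨ ι-toℚᵘ m ⟩
    ℚᵘ.mkℚᵘ (ℤ.+ m) 0     ≤⟨ ℚᵘ.*≤* (ℤ.*-monoʳ-≤-nonNeg (ℤ.+ 1) (ℤ.+≤+ m≤n)) ⟩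
    ℚᵘ.mkℚᵘ (ℤ.+ n) 0     ≃⟨ ι-toℚᵘ n ⟨
    ℚ.toℚᵘ (ι n)          ∎)
    where open ℚᵘ.≤-Reasoning

  ι-cancel-< : ∀ m n → ι m ℚ.< ι n → m ℕ.< n
  ι-cancel-< m n lt = ℕ.≰⇒> λ n≤m → ℚ.<-irrefl refl (ℚ.<-≤-trans lt (ι-mono-≤ n m n≤m))

  0≤ι : ∀ n → 0ℚ ℚ.≤ ι n
  0≤ι n = ι-mono-≤ 0 n ℕ.z≤n

  0<ι : ∀ n .{{_ : ℕ.NonZero n}} → 0ℚ ℚ.< ι n
  0<ι (suc n) = ℚ.<-≤-trans (ℚ.positive⁻¹ 1ℚ) (ι-mono-≤ 1 (suc n) (ℕ.s≤s ℕ.z≤n))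

  *-mono-≤ : ∀ {a b c d} → 0ℚ ℚ.≤ a → a ℚ.≤ b → 0ℚ ℚ.≤ c → c ℚ.≤ d → a ℚ.* c ℚ.≤ b ℚ.* d
  *-mono-≤ {a} {b} {c} {d} 0≤a a≤b 0≤c c≤d = ℚ.≤-trans (ℚ.*-monoʳ-≤-nonNeg c {{ℚ.nonNegative 0≤c}} a≤b)
    (ℚ.*-monoˡ-≤-nonNeg b {{ℚ.nonNegative (ℚ.≤-trans 0≤a a≤b)}} c≤d)

  0≤* : ∀ {a b} → 0ℚ ℚ.≤ a → 0ℚ ℚ.≤ b → 0ℚ ℚ.≤ a ℚ.* b
  0≤* {a} {b} 0≤a 0≤b = ℚ.nonNegative⁻¹ (a ℚ.* b) {{ℚ.nonNeg*nonNeg⇒nonNeg a {{ℚ.nonNegative 0≤a}} b {{ℚ.nonNegative 0≤b}}}}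

  0≤+ : ∀ {a b} → 0ℚ ℚ.≤ a → 0ℚ ℚ.≤ b → 0ℚ ℚ.≤ a ℚ.+ b
  0≤+ {a} {b} = ℚ.+-mono-≤

  *-monoˡ : ∀ {a b} c → 0ℚ ℚ.≤ c → a ℚ.≤ b → c ℚ.* a ℚ.≤ c ℚ.* b
  *-monoˡ c 0≤c = ℚ.*-monoˡ-≤-nonNeg c {{ℚ.nonNegative 0≤c}}

  *-monoʳ : ∀ {a b} c → 0ℚ ℚ.≤ c → a ℚ.≤ b → a ℚ.* c ℚ.≤ b ℚ.* c
  *-monoʳ c 0≤c = ℚ.*-monoʳ-≤-nonNeg c {{ℚ.nonNegative 0≤c}}

  divide : ∀ n .{{_ : ℕ.NonZero n}} x → 0ℚ ℚ.< x → ∃[ y ] 0ℚ ℚ.< y × y ℚ.* ι n ≡ x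
  divide n x 0<x = x ℚ.* r , ℚ.positive⁻¹ (x ℚ.* r) {{ℚ.pos*pos⇒pos x {{ℚ.positive 0<x}} r {{ℚ.1/pos⇒pos (ι n) {{ι>0}}}}}} ,
    trans (ℚ.*-assoc x r (ι n)) (trans (cong (x ℚ.*_) (ℚ.*-inverseˡ (ι n) {{nz}})) (ℚ.*-identityʳ x))
    where
    ι>0 : ℚ.Positive (ι n)
    ι>0 = ℚ.positive (0<ι n)
    nz : ℚ.NonZero (ι n)
    nz = ℚ.pos⇒nonZero (ι n) {{ι>0}}
    r : ℚ
    r = ℚ.1/_ (ι n) {{nz}}

  module Density {r ρ N e q δ : ℚ} (0≤r : 0ℚ ℚ.≤ r) (0≤N : 0ℚ ℚ.≤ N) (0≤e : 0ℚ ℚ.≤ e) (0≤q : 0ℚ ℚ.≤ q) (0≤δ : 0ℚ ℚ.≤ δ)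
    (small : δ ℚ.* (1ℚ ℚ.+ N) ℚ.≤ 1ℚ) (r≤ρ : ι 2 ℚ.* r ℚ.≤ ρ ℚ.+ δ) (ρ≤e : ρ ℚ.* N ℚ.≤ e ℚ.+ δ) (1≤r²q : 1ℚ ℚ.≤ r ℚ.* r ℚ.* q ℚ.+ δ) where

    open ℚ.≤-Reasoning
    open ℚ.+-*-Solver using (solve; _:=_; _:+_; _:*_; con)

    private
      two η : ℚ
      two = ι 2
      η = δ ℚ.* (1ℚ ℚ.+ N)
      0≤1+N : 0ℚ ℚ.≤ 1ℚ ℚ.+ N
      0≤1+N = 0≤+ (ℚ.nonNegative⁻¹ 1ℚ) 0≤N
      0≤η : 0ℚ ℚ.≤ η
      0≤η = 0≤* 0≤δ 0≤1+N
      0≤2 : 0ℚ ℚ.≤ two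
      0≤2 = 0≤ι 2

    2rN≤e+η : two ℚ.* r ℚ.* N ℚ.≤ e ℚ.+ η
    2rN≤e+η = begin
      two ℚ.* r ℚ.* N                ≤⟨ *-monoʳ N 0≤N r≤ρ ⟩
      (ρ ℚ.+ δ) ℚ.* N                ≡⟨ ℚ.*-distribʳ-+ N ρ δ ⟩
      ρ ℚ.* N ℚ.+ δ ℚ.* N            ≤⟨ ℚ.+-monoˡ-≤ (δ ℚ.* N) ρ≤e ⟩
      e ℚ.+ δ ℚ.+ δ ℚ.* N            ≡⟨ solve 3 (λ e d N → e :+ d :+ d :* N := e :+ d :* (con 1ℚ :+ N)) refl e δ N ⟩
      e ℚ.+ η                        ∎

    [e+η]²≤ : (e ℚ.+ η) ℚ.* (e ℚ.+ η) ℚ.≤ e ℚ.* e ℚ.+ δ ℚ.* ((two ℚ.* e ℚ.+ 1ℚ) ℚ.* (1ℚ ℚ.+ N))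
    [e+η]²≤ = begin
      (e ℚ.+ η) ℚ.* (e ℚ.+ η)
        ≡⟨ solve 2 (λ e h → (e :+ h) :* (e :+ h) := e :* e :+ h :* (con (ι 2) :* e :+ h)) refl e η ⟩
      e ℚ.* e ℚ.+ η ℚ.* (two ℚ.* e ℚ.+ η)
        ≤⟨ ℚ.+-monoʳ-≤ (e ℚ.* e) (*-monoˡ η 0≤η (ℚ.+-monoʳ-≤ (two ℚ.* e) small)) ⟩
      e ℚ.* e ℚ.+ η ℚ.* (two ℚ.* e ℚ.+ 1ℚ)
        ≡⟨ cong (e ℚ.* e ℚ.+_) (solve 3 (λ d n f → d :* n :* f := d :* (f :* n)) refl δ (1ℚ ℚ.+ N) (two ℚ.* e ℚ.+ 1ℚ)) ⟩
      e ℚ.* e ℚ.+ δ ℚ.* ((two ℚ.* e ℚ.+ 1ℚ) ℚ.* (1ℚ ℚ.+ N))       ∎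

    -- Here r stands for an approximation of q^(-1/2): the inequality 2 r N ≤ e, up to an error, is
    -- squared and multiplied by q. The final error is δ times a quantity free of r and ρ, so δ can
    -- be fixed before the approximations are chosen.
    density : two ℚ.* N ℚ.* (two ℚ.* N) ℚ.≤ e ℚ.* e ℚ.* q ℚ.+ δ ℚ.* ((two ℚ.* e ℚ.+ 1ℚ) ℚ.* (1ℚ ℚ.+ N) ℚ.* q ℚ.+ two ℚ.* N ℚ.* (two ℚ.* N))
    density = begin
      M                                                                         ≡⟨ ℚ.*-identityʳ M ⟨
      M ℚ.* 1ℚ
        ≤⟨ *-monoˡ M (0≤* (0≤* 0≤2 0≤N) (0≤* 0≤2 0≤N)) 1≤r²q ⟩
      M ℚ.* (r ℚ.* r ℚ.* q ℚ.+ δ)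
        ≡⟨ solve 5 (λ t N r q d → t :* N :* (t :* N) :* (r :* r :* q :+ d) := t :* r :* N :* (t :* r :* N) :* q :+ d :* (t :* N :* (t :* N))) refl two N r q δ ⟩
      two ℚ.* r ℚ.* N ℚ.* (two ℚ.* r ℚ.* N) ℚ.* q ℚ.+ δ ℚ.* M
        ≤⟨ ℚ.+-monoˡ-≤ (δ ℚ.* M) (*-monoʳ q 0≤q (ℚ.≤-trans (*-mono-≤ 0≤2rN 2rN≤e+η 0≤2rN 2rN≤e+η) [e+η]²≤)) ⟩
      (e ℚ.* e ℚ.+ δ ℚ.* L) ℚ.* q ℚ.+ δ ℚ.* M
        ≡⟨ solve 5 (λ e d l q m → (e :* e :+ d :* l) :* q :+ d :* m := e :* e :* q :+ d :* (l :* q :+ m)) refl e δ L q M ⟩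
      e ℚ.* e ℚ.* q ℚ.+ δ ℚ.* (L ℚ.* q ℚ.+ M)                                   ∎
      where
      M L : ℚ
      M = two ℚ.* N ℚ.* (two ℚ.* N)
      L = (two ℚ.* e ℚ.+ 1ℚ) ℚ.* (1ℚ ℚ.+ N)
      0≤2rN : 0ℚ ℚ.≤ two ℚ.* r ℚ.* N
      0≤2rN = 0≤* (0≤* 0≤2 0≤r) 0≤N

  -- Shows that seq (q ^-½) n is nonnegative: its numerator is private to Defs, but
  -- can be left to unification once the fraction is written with mkℚ+.
  0≤mkℚ+ : ∀ a b .{b≢0 : ℕ.NonZero b} .{c : Coprime a b} → 0ℚ ℚ.≤ ℚ.mkℚ+ a b {{b≢0}} c
  0≤mkℚ+ a b {b≢0} {c} = ℚ.nonNegative⁻¹ (ℚ.mkℚ+ a b {{b≢0}} c) {{ℚ.mkℚ+-nonNeg a b {{b≢0}}}}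

  0≤^-½ : ∀ q n → 0ℚ ℚ.≤ seq (q ^-½) n
  0≤^-½ q n = 0≤mkℚ+ _ _

  -- Both sides are natural numbers, so an error below 1 is harmless. With L the coefficient of δ in
  -- `Density.density`, the choice δ = 1 / (L + 1) achieves this.
  square-density : ∀ (q N e : ℕ) .{{_ : ℕ.NonZero q}} (ρ : ℝ) → fromℕ 2 *ᵣ q ^-½ ≤ᵣ ρ → ρ *ᵣ fromℕ N ≤ᵣ fromℕ e →
    2 ℕ.* N ℕ.* (2 ℕ.* N) ℕ.≤ e ℕ.* e ℕ.* q
  square-density q N e ρ r≤ρ ρ≤e = ℕ.≤-pred (ι-cancel-< (2 ℕ.* N ℕ.* (2 ℕ.* N)) (suc (e ℕ.* e ℕ.* q)) (begin-strict
    ι (2 ℕ.* N ℕ.* (2 ℕ.* N))                                  ≡⟨ ι-M ⟩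
    ι 2 ℚ.* ι N ℚ.* (ι 2 ℚ.* ι N)                              ≤⟨ bound ⟩
    ι e ℚ.* ι e ℚ.* ι q ℚ.+ δ ℚ.* _                            ≡⟨ cong₂ ℚ._+_ (sym ι-eeq) (cong (δ ℚ.*_) (sym ι-L)) ⟩
    ι (e ℕ.* e ℕ.* q) ℚ.+ δ ℚ.* ι L
      <⟨ ℚ.+-monoʳ-< (ι (e ℕ.* e ℕ.* q)) (ℚ.*-monoʳ-<-pos δ {{ℚ.positive 0<δ}} ι-L<) ⟩
    ι (e ℕ.* e ℕ.* q) ℚ.+ δ ℚ.* ι (suc L)                      ≡⟨ cong (ι (e ℕ.* e ℕ.* q) ℚ.+_) δL≡1 ⟩
    ι (e ℕ.* e ℕ.* q) ℚ.+ ι 1                                  ≡⟨ ι-+ (e ℕ.* e ℕ.* q) 1 ⟨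
    ι (e ℕ.* e ℕ.* q ℕ.+ 1)                                    ≡⟨ cong ι (ℕ.+-comm (e ℕ.* e ℕ.* q) 1) ⟩
    ι (suc (e ℕ.* e ℕ.* q))                                    ∎))
    where
    open ℚ.≤-Reasoning
    L = (2 ℕ.* e ℕ.+ 1) ℕ.* (1 ℕ.+ N) ℕ.* q ℕ.+ 2 ℕ.* N ℕ.* (2 ℕ.* N)
    δ-spec = divide (suc L) 1ℚ (ℚ.positive⁻¹ 1ℚ)
    δ : ℚ
    δ = proj₁ δ-spec
    0<δ : 0ℚ ℚ.< δ
    0<δ = proj₁ (proj₂ δ-spec)
    δL≡1 : δ ℚ.* ι (suc L) ≡ 1ℚ
    δL≡1 = proj₂ (proj₂ δ-spec)
    ι-M : ι (2 ℕ.* N ℕ.* (2 ℕ.* N)) ≡ ι 2 ℚ.* ι N ℚ.* (ι 2 ℚ.* ι N)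
    ι-M = trans (ι-* (2 ℕ.* N) (2 ℕ.* N)) (cong₂ ℚ._*_ (ι-* 2 N) (ι-* 2 N))
    ι-eeq : ι (e ℕ.* e ℕ.* q) ≡ ι e ℚ.* ι e ℚ.* ι q
    ι-eeq = trans (ι-* (e ℕ.* e) q) (cong (ℚ._* ι q) (ι-* e e))
    ι-L : ι L ≡ (ι 2 ℚ.* ι e ℚ.+ 1ℚ) ℚ.* (1ℚ ℚ.+ ι N) ℚ.* ι q ℚ.+ ι 2 ℚ.* ι N ℚ.* (ι 2 ℚ.* ι N)
    ι-L = trans (ι-+ ((2 ℕ.* e ℕ.+ 1) ℕ.* (1 ℕ.+ N) ℕ.* q) _) (cong₂ ℚ._+_
      (trans (ι-* ((2 ℕ.* e ℕ.+ 1) ℕ.* (1 ℕ.+ N)) q) (cong (ℚ._* ι q) (trans (ι-* (2 ℕ.* e ℕ.+ 1) (1 ℕ.+ N))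
        (cong₂ ℚ._*_ (trans (ι-+ (2 ℕ.* e) 1) (cong (ℚ._+ 1ℚ) (ι-* 2 e))) (ι-+ 1 N))))) ι-M)
    ι-L< : ι L ℚ.< ι (suc L)
    ι-L< = subst (ι L ℚ.<_) (sym (ι-+ 1 L)) (subst (ℚ._< 1ℚ ℚ.+ ι L) (ℚ.+-identityˡ (ι L)) (ℚ.+-monoˡ-< (ι L) (ℚ.positive⁻¹ 1ℚ)))
    small : δ ℚ.* (1ℚ ℚ.+ ι N) ℚ.≤ 1ℚ
    small = begin
      δ ℚ.* (1ℚ ℚ.+ ι N)       ≡⟨ cong (δ ℚ.*_) (ι-+ 1 N) ⟨
      δ ℚ.* ι (1 ℕ.+ N)        ≤⟨ *-monoˡ δ (ℚ.<⇒≤ 0<δ) (ι-mono-≤ (1 ℕ.+ N) (suc L) 1+N≤) ⟩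
      δ ℚ.* ι (suc L)          ≡⟨ δL≡1 ⟩
      1ℚ                       ∎
      where
      1+N≤ : 1 ℕ.+ N ℕ.≤ suc L
      1+N≤ = ℕ.≤-trans (ℕ.≤-trans (ℕ.≤-trans (ℕ.m≤n*m (1 ℕ.+ N) (2 ℕ.* e ℕ.+ 1) {{ℕ.>-nonZero (ℕ.m≤n+m 1 (2 ℕ.* e))}}) (ℕ.m≤m*n _ q)) (ℕ.m≤m+n _ _)) (ℕ.n≤1+n L)
    bound : ι 2 ℚ.* ι N ℚ.* (ι 2 ℚ.* ι N) ℚ.≤ ι e ℚ.* ι e ℚ.* ι q ℚ.+ δ ℚ.* ((ι 2 ℚ.* ι e ℚ.+ 1ℚ) ℚ.* (1ℚ ℚ.+ ι N) ℚ.* ι q ℚ.+ ι 2 ℚ.* ι N ℚ.* (ι 2 ℚ.* ι N))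
    bound =
      let N₁ , p₁ = r≤ρ δ 0<δ
          N₂ , p₂ = ρ≤e δ 0<δ
          N₃ , p₃ = proj₂ (^-½-spec q) δ 0<δ
          n = N₁ ℕ.⊔ (N₂ ℕ.⊔ N₃)
      in Density.density {r = seq (q ^-½) n} {ρ = seq ρ n} (0≤^-½ q n) (0≤ι N) (0≤ι e) (0≤ι q) (ℚ.<⇒≤ 0<δ) small
           (p₁ n (ℕ.m≤m⊔n N₁ _)) (p₂ n (ℕ.≤-trans (ℕ.m≤m⊔n N₂ N₃) (ℕ.m≤n⊔m N₁ _))) (p₃ n (ℕ.≤-trans (ℕ.m≤n⊔m N₂ N₃) (ℕ.m≤n⊔m N₁ _)))

  pow : ℚ → ℕ → ℚ
  pow x zero    = 1ℚ
  pow x (suc k) = x ℚ.* pow x k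

  seq-^ : ∀ x k n → seq (x ^ᵣ k) n ≡ pow (seq x n) k
  seq-^ x zero    n = refl
  seq-^ x (suc k) n = cong (seq x n ℚ.*_) (seq-^ x k n)

  pow-ι : ∀ m k → pow (ι m) k ≡ ι (m ℕ.^ k)
  pow-ι m zero    = refl
  pow-ι m (suc k) = trans (cong (ι m ℚ.*_) (pow-ι m k)) (sym (ι-* m (m ℕ.^ k)))

  pow-* : ∀ x y k → pow (x ℚ.* y) k ≡ pow x k ℚ.* pow y k
  pow-* x y zero    = refl
  pow-* x y (suc k) = trans (cong (x ℚ.* y ℚ.*_) (pow-* x y k))
    (solve 4 (λ x y a b → x :* y :* (a :* b) := x :* a :* (y :* b)) refl x y (pow x k) (pow y k))
    where open ℚ.+-*-Solver

  0≤pow : ∀ {x} → 0ℚ ℚ.≤ x → ∀ k → 0ℚ ℚ.≤ pow x k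
  0≤pow 0≤x zero    = ℚ.nonNegative⁻¹ 1ℚ
  0≤pow 0≤x (suc k) = 0≤* 0≤x (0≤pow 0≤x k)

  pow-mono : ∀ {x y} → 0ℚ ℚ.≤ x → x ℚ.≤ y → ∀ k → pow x k ℚ.≤ pow y k
  pow-mono 0≤x x≤y zero    = ℚ.≤-refl
  pow-mono 0≤x x≤y (suc k) = *-mono-≤ 0≤x x≤y (0≤pow 0≤x k) (pow-mono 0≤x x≤y k)

  ∣pow∣ : ∀ x k → ∣ pow x k ∣ ≡ pow ∣ x ∣ k
  ∣pow∣ x zero    = refl
  ∣pow∣ x (suc k) = trans (ℚ.∣p*q∣≡∣p∣*∣q∣ x (pow x k)) (cong (∣ x ∣ ℚ.*_) (∣pow∣ x k))

  p≤∣p∣ : ∀ p → p ℚ.≤ ∣ p ∣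
  p≤∣p∣ p = [ (λ 0≤p → ℚ.≤-reflexive (sym (ℚ.0≤p⇒∣p∣≡p 0≤p))) , (λ p≤0 → ℚ.≤-trans p≤0 (ℚ.0≤∣p∣ p)) ]′ (ℚ.≤-total 0ℚ p)

  pow-∣∣ : ∀ {x y} → ∣ x ∣ ℚ.≤ y → ∀ k → pow x k ℚ.≤ pow y k
  pow-∣∣ {x} ∣x∣≤y k = ℚ.≤-trans (p≤∣p∣ (pow x k)) (ℚ.≤-trans (ℚ.≤-reflexive (∣pow∣ x k)) (pow-mono (ℚ.0≤∣p∣ x) ∣x∣≤y k))

  -- This is (e + 1)^k - e^k, the slope of the chord of the k-th power over the interval from e to e
  -- + 1. By convexity it controls (e + η)^k for 0 ≤ η ≤ 1.
  slope : ℕ → ℕ → ℕ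
  slope e zero    = 0
  slope e (suc k) = slope e k ℕ.* e ℕ.+ e ℕ.^ k ℕ.+ slope e k

  pow-slope : ∀ e {η} → 0ℚ ℚ.≤ η → η ℚ.≤ 1ℚ → ∀ k → pow (ι e ℚ.+ η) k ℚ.≤ ι (e ℕ.^ k) ℚ.+ η ℚ.* ι (slope e k)
  pow-slope e {η} 0≤η η≤1 zero    = ℚ.≤-reflexive (sym (trans (cong (1ℚ ℚ.+_) (ℚ.*-zeroʳ η)) (ℚ.+-identityʳ 1ℚ)))
  pow-slope e {η} 0≤η η≤1 (suc k) = begin
    (ι e ℚ.+ η) ℚ.* pow (ι e ℚ.+ η) k
      ≤⟨ *-monoˡ (ι e ℚ.+ η) (0≤+ (0≤ι e) 0≤η) (pow-slope e 0≤η η≤1 k) ⟩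
    (ι e ℚ.+ η) ℚ.* (p ℚ.+ η ℚ.* s)
      ≡⟨ solve 4 (λ e h p s → (e :+ h) :* (p :+ h :* s) := e :* p :+ h :* (s :* e :+ p) :+ h :* s :* h) refl (ι e) η p s ⟩
    ι e ℚ.* p ℚ.+ η ℚ.* (s ℚ.* ι e ℚ.+ p) ℚ.+ η ℚ.* s ℚ.* η
      ≤⟨ ℚ.+-monoʳ-≤ (ι e ℚ.* p ℚ.+ η ℚ.* (s ℚ.* ι e ℚ.+ p)) (*-monoˡ (η ℚ.* s) (0≤* 0≤η (0≤ι (slope e k))) η≤1) ⟩
    ι e ℚ.* p ℚ.+ η ℚ.* (s ℚ.* ι e ℚ.+ p) ℚ.+ η ℚ.* s ℚ.* 1ℚ
      ≡⟨ solve 4 (λ e h p s → e :* p :+ h :* (s :* e :+ p) :+ h :* s :* con 1ℚ := e :* p :+ h :* (s :* e :+ p :+ s)) refl (ι e) η p s ⟩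
    ι e ℚ.* p ℚ.+ η ℚ.* (s ℚ.* ι e ℚ.+ p ℚ.+ s)
      ≡⟨ cong₂ (λ a b → a ℚ.+ η ℚ.* b) (ι-* e (e ℕ.^ k)) ι-slope ⟨
    ι (e ℕ.* e ℕ.^ k) ℚ.+ η ℚ.* ι (slope e (suc k))            ∎
    where
    open ℚ.≤-Reasoning
    open ℚ.+-*-Solver using (solve; _:=_; _:+_; _:*_; con)
    p s : ℚ
    p = ι (e ℕ.^ k)
    s = ι (slope e k)
    ι-slope : ι (slope e (suc k)) ≡ s ℚ.* ι e ℚ.+ p ℚ.+ s
    ι-slope = trans (ι-+ (slope e k ℕ.* e ℕ.+ e ℕ.^ k) (slope e k))
      (cong (ℚ._+ s) (trans (ι-+ (slope e k ℕ.* e) (e ℕ.^ k)) (cong (ℚ._+ p) (ι-* (slope e k) e))))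

  -- A term x of the sequence of a nonnegative real is nonnegative only up to δ, so powers are not
  -- monotone at x itself. The shifted value x + 2δ dominates ∣x∣, and the shift is absorbed into
  -- the factor 1 + 2N.
  power-bound : ∀ k N e {x δ} → 0ℚ ℚ.≤ δ → δ ℚ.* (1ℚ ℚ.+ ι 2 ℚ.* ι N) ℚ.≤ 1ℚ → 0ℚ ℚ.≤ x ℚ.+ δ → x ℚ.* ι N ℚ.≤ ι e ℚ.+ δ →
    pow x k ℚ.* ι (N ℕ.^ k) ℚ.≤ ι (e ℕ.^ k) ℚ.+ δ ℚ.* (1ℚ ℚ.+ ι 2 ℚ.* ι N) ℚ.* ι (slope e k)
  power-bound k N e {x} {δ} 0≤δ η≤1 0≤x+δ xN≤e = begin
    pow x k ℚ.* ι (N ℕ.^ k)             ≤⟨ *-monoʳ (ι (N ℕ.^ k)) (0≤ι (N ℕ.^ k)) (pow-∣∣ ∣x∣≤a k) ⟩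
    pow a k ℚ.* ι (N ℕ.^ k)             ≡⟨ cong (pow a k ℚ.*_) (pow-ι N k) ⟨
    pow a k ℚ.* pow (ι N) k             ≡⟨ pow-* a (ι N) k ⟨
    pow (a ℚ.* ι N) k                   ≤⟨ pow-mono (0≤* (ℚ.≤-trans (ℚ.0≤∣p∣ x) ∣x∣≤a) (0≤ι N)) aN≤ k ⟩
    pow (ι e ℚ.+ η) k
      ≤⟨ pow-slope e (0≤* 0≤δ (0≤+ (ℚ.nonNegative⁻¹ 1ℚ) (0≤* (0≤ι 2) (0≤ι N)))) η≤1 k ⟩
    ι (e ℕ.^ k) ℚ.+ η ℚ.* ι (slope e k) ∎
    where
    open ℚ.≤-Reasoning
    open ℚ.+-*-Solver using (solve; _:=_; _:+_; _:*_; :-_; con)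
    a η : ℚ
    a = x ℚ.+ δ ℚ.+ δ
    η = δ ℚ.* (1ℚ ℚ.+ ι 2 ℚ.* ι N)
    aN≤ : a ℚ.* ι N ℚ.≤ ι e ℚ.+ η
    aN≤ = begin
      a ℚ.* ι N
        ≡⟨ solve 3 (λ x d n → (x :+ d :+ d) :* n := x :* n :+ d :* (con (ι 2) :* n)) refl x δ (ι N) ⟩
      x ℚ.* ι N ℚ.+ δ ℚ.* (ι 2 ℚ.* ι N)              ≤⟨ ℚ.+-monoˡ-≤ (δ ℚ.* (ι 2 ℚ.* ι N)) xN≤e ⟩
      ι e ℚ.+ δ ℚ.+ δ ℚ.* (ι 2 ℚ.* ι N)
        ≡⟨ solve 3 (λ e d m → e :+ d :+ d :* m := e :+ d :* (con 1ℚ :+ m)) refl (ι e) δ (ι 2 ℚ.* ι N) ⟩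
      ι e ℚ.+ η                                      ∎
    x≤a : x ℚ.≤ a
    x≤a = begin
      x                        ≡⟨ solve 1 (λ x → x := x :+ con 0ℚ :+ con 0ℚ) refl x ⟩
      x ℚ.+ 0ℚ ℚ.+ 0ℚ          ≤⟨ ℚ.+-mono-≤ (ℚ.+-monoʳ-≤ x 0≤δ) 0≤δ ⟩
      a                        ∎
    -x≤a : ℚ.- x ℚ.≤ a
    -x≤a = begin
      ℚ.- x                                ≡⟨ solve 1 (λ x → :- x := :- x :+ (con 0ℚ :+ con 0ℚ)) refl x ⟩
      ℚ.- x ℚ.+ (0ℚ ℚ.+ 0ℚ)                ≤⟨ ℚ.+-monoʳ-≤ (ℚ.- x) (ℚ.+-mono-≤ 0≤x+δ 0≤x+δ) ⟩
      ℚ.- x ℚ.+ ((x ℚ.+ δ) ℚ.+ (x ℚ.+ δ))  ≡⟨ solve 2 (λ x d → :- x :+ ((x :+ d) :+ (x :+ d)) := x :+ d :+ d) refl x δ ⟩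
      a                                    ∎
    ∣x∣≤a : ∣ x ∣ ℚ.≤ a
    ∣x∣≤a = [ (λ eq → ℚ.≤-trans (ℚ.≤-reflexive eq) x≤a) , (λ eq → ℚ.≤-trans (ℚ.≤-reflexive eq) -x≤a) ]′ (ℚ.∣p∣≡p∨∣p∣≡-p x)

  scaled-power-≤ : ∀ (k N e B K t : ℕ) .{{_ : ℕ.NonZero N}} .{{_ : ℕ.NonZero K}} (c : ℚ) → c ℚ.* ι K ≡ 1ℚ → (ρ : ℝ) →
    fromℕ 0 ≤ᵣ ρ → ρ *ᵣ fromℕ N ≤ᵣ fromℕ e → B ℕ.* e ℕ.^ k ℕ.≤ K ℕ.* N ℕ.^ k ℕ.* t →
    fromℚ c *ᵣ ρ ^ᵣ k *ᵣ fromℕ B ≤ᵣ fromℕ t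
  scaled-power-≤ k N e B K t c cK≡1 ρ 0≤ρ ρN≤e count ε 0<ε =
    let N₁ , p₁ = 0≤ρ δ 0<δ
        N₂ , p₂ = ρN≤e δ 0<δ
    in N₁ ℕ.⊔ N₂ , λ n le → subst (λ p → c ℚ.* p ℚ.* ι B ℚ.≤ ι t ℚ.+ ε) (sym (seq-^ ρ k n))
         (at (seq ρ n) (p₁ n (ℕ.≤-trans (ℕ.m≤m⊔n N₁ N₂) le)) (p₂ n (ℕ.≤-trans (ℕ.m≤n⊔m N₁ N₂) le)))
    where
    open ℚ.≤-Reasoning
    open ℚ.+-*-Solver using (solve; _:=_; _:+_; _:*_; con)
    M S : ℕ
    M = K ℕ.* N ℕ.^ k
    S = slope e k ℕ.* B
    0<ε⊓1 : 0ℚ ℚ.< ε ℚ.⊓ 1ℚ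
    0<ε⊓1 = [ (λ eq → subst (0ℚ ℚ.<_) (sym eq) 0<ε) , (λ eq → subst (0ℚ ℚ.<_) (sym eq) (ℚ.positive⁻¹ 1ℚ)) ]′ (ℚ.⊓-sel ε 1ℚ)
    -- After multiplication by B the error of `power-bound` is η S, which has to be at most ε, while
    -- the chord estimate asks for η ≤ 1; hence the minimum. The successor keeps the divisor nonzero
    -- and yields both bounds.
    η-spec = divide (suc S) (ε ℚ.⊓ 1ℚ) 0<ε⊓1
    η = proj₁ η-spec
    δ-spec = divide (1 ℕ.+ 2 ℕ.* N) η (proj₁ (proj₂ η-spec))
    δ = proj₁ δ-spec
    0<δ : 0ℚ ℚ.< δ
    0<δ = proj₁ (proj₂ δ-spec)
    0≤η : 0ℚ ℚ.≤ η
    0≤η = ℚ.<⇒≤ (proj₁ (proj₂ η-spec))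
    δ≡η : δ ℚ.* (1ℚ ℚ.+ ι 2 ℚ.* ι N) ≡ η
    δ≡η = trans (cong (δ ℚ.*_) (sym (trans (ι-+ 1 (2 ℕ.* N)) (cong (1ℚ ℚ.+_) (ι-* 2 N))))) (proj₂ (proj₂ δ-spec))
    η-≤ : ∀ m → m ℕ.≤ suc S → η ℚ.* ι m ℚ.≤ ε ℚ.⊓ 1ℚ
    η-≤ m m≤ = ℚ.≤-trans (*-monoˡ η 0≤η (ι-mono-≤ m (suc S) m≤)) (ℚ.≤-reflexive (proj₂ (proj₂ η-spec)))
    η≤1 : η ℚ.≤ 1ℚ
    η≤1 = ℚ.≤-trans (ℚ.≤-reflexive (sym (ℚ.*-identityʳ η))) (ℚ.≤-trans (η-≤ 1 (ℕ.s≤s ℕ.z≤n)) (ℚ.p⊓q≤q ε 1ℚ))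
    M≥1 : 1 ℕ.≤ M
    M≥1 = ℕ.*-mono-≤ {1} {K} {1} (ℕ.>-nonZero⁻¹ K) (ℕ.m^n>0 N k)
    at : ∀ x → 0ℚ ℚ.≤ x ℚ.+ δ → x ℚ.* ι N ℚ.≤ ι e ℚ.+ δ → c ℚ.* pow x k ℚ.* ι B ℚ.≤ ι t ℚ.+ ε
    at x 0≤x+δ xN≤e = ℚ.*-cancelʳ-≤-pos (ι M) {{ℚ.positive (ℚ.<-≤-trans (ℚ.positive⁻¹ 1ℚ) (ι-mono-≤ 1 M M≥1))}} (begin
      c ℚ.* pow x k ℚ.* ι B ℚ.* ι M
        ≡⟨ cong (c ℚ.* pow x k ℚ.* ι B ℚ.*_) (ι-* K (N ℕ.^ k)) ⟩
      c ℚ.* pow x k ℚ.* ι B ℚ.* (ι K ℚ.* ι (N ℕ.^ k))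
        ≡⟨ solve 5 (λ c p b κ n → c :* p :* b :* (κ :* n) := c :* κ :* (p :* n :* b)) refl c (pow x k) (ι B) (ι K) (ι (N ℕ.^ k)) ⟩
      c ℚ.* ι K ℚ.* (pow x k ℚ.* ι (N ℕ.^ k) ℚ.* ι B)
        ≡⟨ trans (cong (ℚ._* (pow x k ℚ.* ι (N ℕ.^ k) ℚ.* ι B)) cK≡1) (ℚ.*-identityˡ _) ⟩
      pow x k ℚ.* ι (N ℕ.^ k) ℚ.* ι B                            ≤⟨ *-monoʳ (ι B) (0≤ι B) powers ⟩
      (ι (e ℕ.^ k) ℚ.+ η ℚ.* ι (slope e k)) ℚ.* ι B
        ≡⟨ solve 4 (λ p h s b → (p :+ h :* s) :* b := b :* p :+ h :* (s :* b)) refl (ι (e ℕ.^ k)) η (ι (slope e k)) (ι B) ⟩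
      ι B ℚ.* ι (e ℕ.^ k) ℚ.+ η ℚ.* (ι (slope e k) ℚ.* ι B)
        ≡⟨ cong₂ (λ a b → a ℚ.+ η ℚ.* b) (ι-* B (e ℕ.^ k)) (ι-* (slope e k) B) ⟨
      ι (B ℕ.* e ℕ.^ k) ℚ.+ η ℚ.* ι S
        ≤⟨ ℚ.+-mono-≤ (ι-mono-≤ (B ℕ.* e ℕ.^ k) (M ℕ.* t) count) (ℚ.≤-trans (η-≤ S (ℕ.n≤1+n S)) (ℚ.p⊓q≤p ε 1ℚ)) ⟩
      ι (M ℕ.* t) ℚ.+ ε                                          ≡⟨ cong (ι (M ℕ.* t) ℚ.+_) (ℚ.*-identityʳ ε) ⟨
      ι (M ℕ.* t) ℚ.+ ε ℚ.* 1ℚ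
        ≤⟨ ℚ.+-monoʳ-≤ (ι (M ℕ.* t)) (*-monoˡ ε (ℚ.<⇒≤ 0<ε) (ι-mono-≤ 1 M M≥1)) ⟩
      ι (M ℕ.* t) ℚ.+ ε ℚ.* ι M
        ≡⟨ cong (ℚ._+ ε ℚ.* ι M) (trans (ι-* M t) (ℚ.*-comm (ι M) (ι t))) ⟩
      ι t ℚ.* ι M ℚ.+ ε ℚ.* ι M                                  ≡⟨ ℚ.*-distribʳ-+ (ι M) (ι t) ε ⟨
      (ι t ℚ.+ ε) ℚ.* ι M                                        ∎)
      where
      powers : pow x k ℚ.* ι (N ℕ.^ k) ℚ.≤ ι (e ℕ.^ k) ℚ.+ η ℚ.* ι (slope e k)
      powers = subst (λ h → pow x k ℚ.* ι (N ℕ.^ k) ℚ.≤ ι (e ℕ.^ k) ℚ.+ h ℚ.* ι (slope e k)) δ≡η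
        (power-bound k N e (ℚ.<⇒≤ 0<δ) (ℚ.≤-trans (ℚ.≤-reflexive δ≡η) η≤1) 0≤x+δ xN≤e)

  0≤^-½⇒0≤ : ∀ q ρ → fromℕ 2 *ᵣ q ^-½ ≤ᵣ ρ → fromℕ 0 ≤ᵣ ρ
  0≤^-½⇒0≤ q ρ r≤ρ ε 0<ε = let N , p = r≤ρ ε 0<ε in
    N , λ n N≤n → ℚ.≤-trans (0≤* (0≤ι 2) (0≤^-½ q n)) (p n N≤n)

open RationalBounds

-- Membership in E, numerical consequences of the density, and the conclusion

module _ (F : HeytingField 0ℓ 0ℓ 0ℓ) {q : ℕ} (q-odd : OddPrimePower q)
  (card : HasCardinality (HeytingField._≈_ F) q) (d : ℕ) where
  open Simplices F q-odd card d

  module _ {E : Pred Point 0ℓ} (E-resp : ∀ {x y} → x ≈ᴹ y → E x → E y) {e : ℕ} (∣E∣≡e : ∣ E ∣≡ e) where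

    private
      index : ∃ E → Fin e
      index = proj₁ ∣E∣≡e
      index-injective : ∀ {x y} → index x ≡ index y → proj₁ x ≈ᴹ proj₁ y
      index-injective = proj₁ (proj₂ (proj₂ ∣E∣≡e))
      point : Fin e → ∃ E
      point i = proj₁ (proj₂ (proj₂ (proj₂ ∣E∣≡e)) i)
      index-point : ∀ {i x} → proj₁ x ≈ᴹ proj₁ (point i) → index x ≡ i
      index-point {i} = proj₂ (proj₂ (proj₂ (proj₂ ∣E∣≡e)) i)

    -- The cardinality supplies finitely many points of E that represent all others up to `_≈ᴹ_`,
    -- and E respects `_≈ᴹ_`; so x is compared with each of them.
    member? : ∀ x → Dec (E x)
    member? x = map′ (λ (i , x≈) → E-resp (≈ᴹ-sym x≈) (proj₂ (point i)))
      (λ Ex → index (x , Ex) , ≈ᴹ-sym (index-injective {point (index (x , Ex))} {x , Ex} (index-point ≈ᴹ-refl)))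
      (Fin.any? (λ i → x ≟ᴹ proj₁ (point i)))

    -- The pairs of an index i and a listed point x equal to `point i` are counted twice: every
    -- index has one such x, while every x has at most one index, and none outside E.
    cardinality≤∣E∣ : e ≤ PointSet.∣E∣ E-resp member?
    cardinality≤∣E∣ = begin
      e                                                                       ≡⟨ length-tabulate id ⟨
      length is                                                               ≡⟨ ∑-one is ⟨
      ∑[ _ ∈ is ] 1
        ≡⟨ ∑-cong is (λ i → Pointₛ.once (proj₁ (point i))) ⟨
      ∑[ i ∈ is ] ∑[ x ∈ points ] 𝟙 (x ≟ᴹ proj₁ (point i))                    ≡⟨ ∑-swap is points _ ⟩
      ∑[ x ∈ points ] ∑[ i ∈ is ] 𝟙 (x ≟ᴹ proj₁ (point i))
        ≤⟨ ∑-mono points (λ x → at x (member? x)) ⟩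
      ∑[ x ∈ points ] 𝟙 (member? x)                                           ≡⟨ length-select member? points ⟨
      PointSet.∣E∣ E-resp member?                                             ∎
      where
      open ℕ.≤-Reasoning
      is : List (Fin e)
      is = tabulate id
      at : ∀ x (Ex? : Dec (E x)) → ∑[ i ∈ is ] 𝟙 (x ≟ᴹ proj₁ (point i)) ≤ 𝟙 Ex?
      at x (yes Ex) = ℕ.≤-trans (∑-mono is (λ i → 𝟙-mono (x ≟ᴹ proj₁ (point i)) (i Fin.≟ index (x , Ex)) (λ x≈ → ≡.sym (index-point {x = x , Ex} x≈))))
        (ℕ.≤-reflexive (∑-Fin-once (index (x , Ex))))
      at x (no ¬Ex) = ℕ.≤-reflexive (≡.trans (∑-cong is (λ i → 𝟙-false (x ≟ᴹ proj₁ (point i)) (λ x≈ → ¬Ex (E-resp (≈ᴹ-sym x≈) (proj₂ (point i)))))) (∑-zero is))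

module DensityBounds (q k e : ℕ) .{{_ : ℕ.NonZero q}} (dense : 2 ℕ.* q ^ suc (suc k) ℕ.* (2 ℕ.* q ^ suc (suc k)) ≤ e ℕ.* e ℕ.* q) where

  private
    N : ℕ
    N = q ^ suc (suc k)
    1≤N : 1 ≤ N
    1≤N = ℕ.m^n>0 q (suc (suc k))
    open ℕ.≤-Reasoning
    open +-*-Solver using (solve; _:=_; _:*_)

  -- From e² q ≤ (q e)² the hypothesis becomes (2N)² ≤ (q e)², and the square root is taken by
  -- contradiction.
  hyperplane-bound : 2 ℕ.* N ≤ q ℕ.* e
  hyperplane-bound = ℕ.≮⇒≥ λ qe<2N → ℕ.<-irrefl ≡.refl (begin-strict
    q ℕ.* e ℕ.* (q ℕ.* e)           <⟨ ℕ.*-mono-< qe<2N qe<2N ⟩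
    2 ℕ.* N ℕ.* (2 ℕ.* N)           ≤⟨ dense ⟩
    e ℕ.* e ℕ.* q                   ≤⟨ ℕ.m≤m*n (e ℕ.* e ℕ.* q) q ⟩
    e ℕ.* e ℕ.* q ℕ.* q             ≡⟨ solve 2 (λ e q → e :* e :* q :* q := q :* e :* (q :* e)) ≡.refl e q ⟩
    q ℕ.* e ℕ.* (q ℕ.* e)           ∎)

  positive-bound : 0 < e
  positive-bound = ℕ.*-cancelˡ-< q 0 e (begin-strict
    q ℕ.* 0       ≡⟨ ℕ.*-zeroʳ q ⟩
    0             <⟨ ℕ.*-mono-≤ {1} {2} (s≤s z≤n) 1≤N ⟩
    2 ℕ.* N       ≤⟨ hyperplane-bound ⟩
    q ℕ.* e       ∎)

  -- The exponent of N is at least 2, so q² ≤ N and q² N ≤ N². This is where d ≥ 2 enters the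
  -- estimates.
  pinning-bound : q ℕ.* N ≤ e ℕ.* e
  pinning-bound = ℕ.*-cancelʳ-≤ (q ℕ.* N) (e ℕ.* e) q (begin
    q ℕ.* N ℕ.* q                   ≡⟨ solve 2 (λ q n → q :* n :* q := q :* q :* n) ≡.refl q N ⟩
    q ℕ.* q ℕ.* N                   ≤⟨ ℕ.*-monoˡ-≤ N (ℕ.*-monoʳ-≤ q (ℕ.m≤m*n q (q ^ k) {{ℕ.>-nonZero (ℕ.m^n>0 q k)}})) ⟩
    N ℕ.* N                         ≤⟨ ℕ.*-mono-≤ (ℕ.m≤n*m N 2) (ℕ.m≤n*m N 2) ⟩
    2 ℕ.* N ℕ.* (2 ℕ.* N)           ≤⟨ dense ⟩
    e ℕ.* e ℕ.* q                   ∎)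

0<fromℚ : ∀ {x} → 0ℚ ℚ.< x → fromℕ 0 <ᵣ fromℚ x
0<fromℚ {x} 0<x = x , 0<x , 0 , λ _ _ → ℚ.≤-reflexive (ℚ.+-identityˡ x)

theorem1p1 : (d : ℕ) → 2 ≤ d →
    ∃[ C ] ∃[ c ] ∃[ q₀ ] (fromℕ 0 <ᵣ C) × (fromℕ 0 <ᵣ c) × (fromℕ 0 <ᵣ q₀) ×
    ((q : ℕ) → OddPrimePower q → q₀ ≤ᵣ fromℕ q →
    (F : HeytingField 0ℓ 0ℓ 0ℓ) → HasCardinality (HeytingField._≈_ F) q →
    let open Geometry F d in
    (ρ : ℝ) → C *ᵣ q ^-½ ≤ᵣ ρ → ρ ≤ᵣ fromℕ 1 →
    (E : Pred Point 0ℓ) → E Respects _≈ᴹ_ →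
    (e : ℕ) → ∣ E ∣≡ e → ρ *ᵣ fromℕ (q ^ d) ≤ᵣ fromℕ e →
    ∃[ t ] (∣T d ⟨ E ⟩∣≡ t) ×
    c *ᵣ ρ ^ᵣ (d ∸ 1) *ᵣ fromℕ (q ^ (suc d choose 2)) ≤ᵣ fromℕ t)
theorem1p1 (suc zero) (s≤s ())
theorem1p1 d@(suc k@(suc j)) _ =
  -- The value 2 of C is the factor by which `hyperplane-bound` confines a hyperplane to half of E;
  -- c is the reciprocal of the constant 8 · 4^(d-1) in `many-classes`.
  fromℕ 2 , fromℚ c , fromℕ 1 , 0<fromℚ (0<ι 2) , 0<fromℚ (proj₁ (proj₂ c-spec)) , 0<fromℚ (0<ι 1) , conclusion
  where
  K : ℕ
  K = 8 ℕ.* 4 ^ k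
  instance
    K≢0 : ℕ.NonZero K
    K≢0 = ℕ.>-nonZero (ℕ.*-mono-≤ {1} {8} (s≤s z≤n) (ℕ.m^n>0 4 k))
  c-spec = divide K 1ℚ (ℚ.positive⁻¹ 1ℚ)
  c : ℚ
  c = proj₁ c-spec
  conclusion : (q : ℕ) → OddPrimePower q → fromℕ 1 ≤ᵣ fromℕ q →
    (F : HeytingField 0ℓ 0ℓ 0ℓ) → HasCardinality (HeytingField._≈_ F) q →
    let open Geometry F d in
    (ρ : ℝ) → fromℕ 2 *ᵣ q ^-½ ≤ᵣ ρ → ρ ≤ᵣ fromℕ 1 →
    (E : Pred Point 0ℓ) → E Respects _≈ᴹ_ →
    (e : ℕ) → ∣ E ∣≡ e → ρ *ᵣ fromℕ (q ^ d) ≤ᵣ fromℕ e →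
    ∃[ t ] (∣T d ⟨ E ⟩∣≡ t) × fromℚ c *ᵣ ρ ^ᵣ k *ᵣ fromℕ (q ^ (suc d choose 2)) ≤ᵣ fromℕ t
  conclusion q q-odd _ F card ρ r≤ρ _ E E-resp e ∣E∣≡e ρN≤e =
    t , T , scaled-power-≤ k (q ^ d) ∣E∣ (q ^ (suc d choose 2)) K t {{ℕ.m^n≢0 q d}} c (proj₂ (proj₂ c-spec)) ρ (0≤^-½⇒0≤ q ρ r≤ρ) ρN≤∣E∣
      (many-classes F q-odd card k E-resp E? positive-bound pinning-bound hyperplane-bound T)
    where
    E? = member? F q-odd card d E-resp ∣E∣≡e
    ∣E∣ : ℕ
    ∣E∣ = Simplices.PointSet.∣E∣ F q-odd card d E-resp E?
    instance
      q≢0 : ℕ.NonZero q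
      q≢0 = ℕ.>-nonZero (ℕ.<-trans ℕ.z<s (primePower>1 q-odd))
    -- The counting is done with the length of the list of points of E; the density hypothesis
    -- passes from e to this length because e is at most as large.
    ρN≤∣E∣ : ρ *ᵣ fromℕ (q ^ d) ≤ᵣ fromℕ ∣E∣
    ρN≤∣E∣ ε 0<ε = let N , p = ρN≤e ε 0<ε in N , λ n N≤n →
      ℚ.≤-trans (p n N≤n) (ℚ.+-monoˡ-≤ ε (ι-mono-≤ e ∣E∣ (cardinality≤∣E∣ F q-odd card d E-resp ∣E∣≡e)))
    open DensityBounds q j ∣E∣ (square-density q (q ^ d) ∣E∣ ρ r≤ρ ρN≤∣E∣)
    classes = Simplices.SimplexClasses.classes F q-odd card d E-resp E?
    t : ℕ
    t = proj₁ classes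
    T = proj₂ classes
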